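{- For every integer $k\ge1$, the decidability of $\mathcal B\Sigma_k[\mathrm{Reg}]$ reduces to the decidability of $\mathcal B\Sigma_k[<,+1]$, and the decidability of $\mathrm{FO}^2_k[\mathrm{Reg}]$ reduces to the decidability of $\mathrm{FO}^2_k[<,+1]$ (that is, if the fragment with signature $[<,+1]$ is decidable, then so is the same fragment with signature $\mathrm{Reg}$). Consequently, the fragments $\mathrm{FO}^2[<,\mathrm{MOD}]$, $\mathrm{FO}^2_k[\mathrm{Reg}]$ for every $k\ge1$, and $\mathcal B\Sigma_2[\mathrm{Reg}]$ are decidable.
   Context: A word $u$ over a finite alphabet $A$ is a set of positions $0,\dots,|u|-1$ labelled by letters; $\mathrm{FO}[\sigma]$ is the set of first order sentences over words using the numerical predicates of $\sigma$ and the letter predicates $\mathbf a(x)$ (position $x$ carries letter $a$). $<$ is the linear order on positions. The symbol $+1$ denotes the class of descriptive local predicates $\mathbf a(x+j)$, $\mathbf a(\min+j)$, $\mathbf a(\max-j)$ for $j\ge0$, holding if the position $x+j$ (resp. the $j$-th position after the first one, the $j$-th position before the last one) is labelled by $a$. For $d\ge1$, $\mathrm{MOD}^d$ consists of, for $0\le i<d$, the unary predicates $\mathbf{MOD}_i^d(x)$ (position $x$ is congruent to $i$ mod $d$) and the constants $\mathbf D_i^d$ (the length of the word is congruent to $i$ mod $d$); $\mathrm{MOD}=\bigcup_{d\ge1}\mathrm{MOD}^d$ and $\mathrm{Reg}=\{<\}\cup{+1}\cup\mathrm{MOD}$. The quantifier alternation depth of a first order formula is the number of blocks of quantifiers $\forall$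 and $\exists$ in its prenex normal form. $\mathcal B\Sigma_k[\sigma]$ is the set of prenex normal formulas of $\mathrm{FO}[\sigma]$ whose quantifier alternation depth is at most $k$; these levels are taken to be fragments of logic, and in particular to be closed under conjunction and disjunction. $\mathrm{FO}^2[\sigma]$ is the set of sentences of $\mathrm{FO}[\sigma]$ using only two variable symbols (which may be reused), and $\mathrm{FO}^2_k[\sigma]$ is the set of sentences of $\mathrm{FO}^2[\sigma]$ with at most $k-1$ quantifier alternations: once negations have been pushed to the leaves, on every branch of the parse tree the sequence of quantifiers has at most $k-1$ alternations between $\exists$ and $\forall$. A language belongs to a fragment if it is the set of words satisfying some sentence of it, and a fragment is decidable if, given a regular language, one can decide whether it belongs to the fragment. The consequence uses the known results that $\mathrm{FO}^2_k[<,+1]$ is decidable for every $k\ge1$ (Kufleitner–Lauser), that $\mathcal B\Sigma_2[<]$ is decidable (Place–Zeitoun), and that the decidability of $\mathcal B\Sigma_k[<,+1]$ reduces to that of $\mathcal B\Sigma_k[<]$ (Straubing). -}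

module Defs where

open import Data.Empty using (⊥)
open import Data.Fin.Base using (Fin; toℕ)
open import Data.Fin.Properties using (nonZeroIndex)
open import Data.Fin.Subset as Subset using (Subset; ⁅_⁆)
open import Data.List.Base as List using (List; []; _∷_; _++_; length; reverse; drop; head; foldl)
open import Data.List.Relation.Unary.All using (All)
open import Data.Maybe.Base using (just)
open import Data.Nat.Base using (ℕ; suc; _+_; _∸_; _≤_; _<_)
open import Data.Nat.DivMod using (_%_)
open import Data.Product.Base using (Σ-syntax; ∃-syntax; _×_)
open import Data.Sum.Base using (_⊎_)
open import Data.Unit.Base using (⊤)
open import Data.Vec.Base as Vec using (Vec; []; _∷_)
open import Data.Vec.Functional using (Vector; updateAt)
open import Function.Base using (const)
open import Function.Bundles using (_⇔_)
open import Level using (0ℓ)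
open import Relation.Binary.PropositionalEquality using (_≡_)
open import Relation.Nullary.Decidable.Core using (Dec)
open import Relation.Nullary.Negation.Core using (¬_)
open import Relation.Unary using (Pred; ｛_｝; _∪_; ⋃)

------------------------------------------------------------------------
-- Words and regular languages

-- The alphabet is Fin n, positions are 0, …, length w − 1, and the empty
-- word is allowed.

Word : ℕ → Set
Word n = List (Fin n)

Language : ℕ → Set₁
Language n = Pred (Word n) 0ℓ

-- False when p is not a position of w.
_has_at_ : ∀ {n} → Word n → Fin n → ℕ → Set
w has a at p = head (drop p w) ≡ just a

record DFA (n : ℕ) : Set where
  field
    states : ℕ
    start  : Fin states
    δ      : Fin states → Fin n → Fin states
    final  : Subset states

L : ∀ {n} → DFA n → Language n
L M w = foldl δ start w Subset.∈ final
  where open DFA M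

------------------------------------------------------------------------
-- Numerical predicates and signatures

-- Predicates of arity r over words on n letters.  In MOD and D the
-- modulus d is nonzero, since Fin 0 is empty.
data Predicate (n : ℕ) : (r : ℕ) → Set where
  less       : Predicate n 2
  letter-x+  : (a : Fin n) (j : ℕ) → Predicate n 1
  letter-min+ letter-max- : (a : Fin n) (j : ℕ) → Predicate n 0
  MOD-       : (d : ℕ) (i : Fin d) → Predicate n 1
  D-         : (d : ℕ) (i : Fin d) → Predicate n 0

congruent : (d : ℕ) → Fin d → ℕ → Set
congruent d i p = _%_ p d {{nonZeroIndex i}} ≡ toℕ i

Holds : ∀ {n r} → Word n → Predicate n r → Vec ℕ r → Set
Holds w less              (p ∷ q ∷ []) = p < q
Holds w (letter-x+ a j)   (p ∷ [])     = w has a at (p + j)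
Holds w (letter-min+ a j) []           = w has a at j
Holds w (letter-max- a j) []           = reverse w has a at j
Holds w (MOD- d i)        (p ∷ [])     = congruent d i p
Holds w (D- d i)          []           = congruent d i (length w)

data Class : Set where
  order local : Class
  modular     : (d : ℕ) → Class

class : ∀ {n r} → Predicate n r → Class
class less              = order
class (letter-x+ _ _)   = local
class (letter-min+ _ _) = local
class (letter-max- _ _) = local
class (MOD- d _)        = modular d
class (D- d _)          = modular d

Signature : Set₁
Signature = Pred Class 0ℓ

⟨<⟩ ⟨+1⟩ MOD : Signature
⟨<⟩  = ｛ order ｝
⟨+1⟩ = ｛ local ｝
MOD  = ⋃[ d ∶ ℕ ] ｛ modular d ｝

[<] [<,+1] [<,MOD] Reg : Signature
[<]     = ⟨<⟩
[<,+1]  = ⟨<⟩ ∪ ⟨+1⟩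
[<,MOD] = ⟨<⟩ ∪ MOD
Reg     = ⟨<⟩ ∪ ⟨+1⟩ ∪ MOD

------------------------------------------------------------------------
-- First-order formulas

data Quantifier : Set where
  ∃′ ∀′ : Quantifier

infixr 6 _∧_
infixr 5 _∨_

-- Formulas of FO[σ] over words on n letters, written with v variable
-- symbols, each of which may be quantified repeatedly.
data Formula (σ : Signature) (n v : ℕ) : Set where
  true false : Formula σ n v
  _≐_        : (x y : Fin v) → Formula σ n v
  letter     : (a : Fin n) (x : Fin v) → Formula σ n v
  pred       : ∀ {r} (P : Predicate n r) → σ (class P) → Vec (Fin v) r → Formula σ n v
  ¬′_        : Formula σ n v → Formula σ n v
  _∧_ _∨_    : (φ ψ : Formula σ n v) → Formula σ n v
  quant      : Quantifier → (x : Fin v) → Formula σ n v → Formula σ n v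

private
  variable
    σ : Signature
    n v : ℕ

Sat : Word n → Vector ℕ v → Formula σ n v → Set
Sat w ρ true           = ⊤
Sat w ρ false          = ⊥
Sat w ρ (x ≐ y)        = ρ x ≡ ρ y
Sat w ρ (letter a x)   = w has a at ρ x
Sat w ρ (pred P _ xs)  = Holds w P (Vec.map ρ xs)
Sat w ρ (¬′ φ)         = ¬ Sat w ρ φ
Sat w ρ (φ ∧ ψ)        = Sat w ρ φ × Sat w ρ ψ
Sat w ρ (φ ∨ ψ)        = Sat w ρ φ ⊎ Sat w ρ ψ
Sat w ρ (quant ∃′ x φ) = Σ[ p ∈ Fin (length w) ] Sat w (updateAt ρ x (const (toℕ p))) φ
Sat w ρ (quant ∀′ x φ) = (p : Fin (length w)) → Sat w (updateAt ρ x (const (toℕ p))) φ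

freeVariables : Formula σ n v → Subset v
freeVariables true           = Subset.⊥
freeVariables false          = Subset.⊥
freeVariables (x ≐ y)        = ⁅ x ⁆ Subset.∪ ⁅ y ⁆
freeVariables (letter a x)   = ⁅ x ⁆
freeVariables (pred _ _ xs)  = Subset.⋃ (List.map ⁅_⁆ (Vec.toList xs))
freeVariables (¬′ φ)         = freeVariables φ
freeVariables (φ ∧ ψ)        = freeVariables φ Subset.∪ freeVariables ψ
freeVariables (φ ∨ ψ)        = freeVariables φ Subset.∪ freeVariables ψ
freeVariables (quant _ x φ)  = freeVariables φ Subset.- x

Sentence : Pred (Formula σ n v) 0ℓ
Sentence φ = Subset.Empty (freeVariables φ)

-- Only used for sentences, where the initial assignment is irrelevant
-- (in the empty word, 0 is not a position).
_⊨_ : Word n → Formula σ n v → Set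
w ⊨ φ = Sat w (const 0) φ

------------------------------------------------------------------------
-- Quantifier alternation

-- The number of alternations between ∃ and ∀ in a sequence of quantifiers.
alternations : List Quantifier → ℕ
alternations []             = 0
alternations (_ ∷ [])       = 0
alternations (∃′ ∷ ∃′ ∷ qs) = alternations (∃′ ∷ qs)
alternations (∀′ ∷ ∀′ ∷ qs) = alternations (∀′ ∷ qs)
alternations (∃′ ∷ ∀′ ∷ qs) = suc (alternations (∀′ ∷ qs))
alternations (∀′ ∷ ∃′ ∷ qs) = suc (alternations (∃′ ∷ qs))

blocks : List Quantifier → ℕ
blocks []       = 0
blocks (q ∷ qs) = suc (alternations (q ∷ qs))

data QuantifierFree {σ n v} : Pred (Formula σ n v) 0ℓ where
  true   : QuantifierFree true
  false  : QuantifierFree false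
  _≐_    : ∀ x y → QuantifierFree (x ≐ y)
  letter : ∀ a x → QuantifierFree (letter a x)
  pred   : ∀ {r} (P : Predicate n r) (P∈σ : σ (class P)) xs → QuantifierFree (pred P P∈σ xs)
  ¬′_    : ∀ {φ} → QuantifierFree φ → QuantifierFree (¬′ φ)
  _∧_    : ∀ {φ ψ} → QuantifierFree φ → QuantifierFree ψ → QuantifierFree (φ ∧ ψ)
  _∨_    : ∀ {φ ψ} → QuantifierFree φ → QuantifierFree ψ → QuantifierFree (φ ∨ ψ)

-- Prenex qs φ: φ is in prenex normal form with quantifier prefix qs.
data Prenex {σ n v} : List Quantifier → Pred (Formula σ n v) 0ℓ where
  matrix : ∀ {φ} → QuantifierFree φ → Prenex [] φ
  prefix : ∀ {qs φ} q x → Prenex qs φ → Prenex (q ∷ qs) (quant q x φ)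

dual : Quantifier → Quantifier
dual ∃′ = ∀′
dual ∀′ = ∃′

-- nnf φ pushes the negations of φ to the leaves; nnf¬ φ those of ¬ φ.
mutual
  nnf : Formula σ n v → Formula σ n v
  nnf (¬′ φ)          = nnf¬ φ
  nnf (φ ∧ ψ)         = nnf φ ∧ nnf ψ
  nnf (φ ∨ ψ)         = nnf φ ∨ nnf ψ
  nnf (quant q x φ)   = quant q x (nnf φ)
  nnf true            = true
  nnf false           = false
  nnf (x ≐ y)         = x ≐ y
  nnf (letter a x)    = letter a x
  nnf (pred P P∈σ xs) = pred P P∈σ xs

  nnf¬ : Formula σ n v → Formula σ n v
  nnf¬ (¬′ φ)          = nnf φ
  nnf¬ (φ ∧ ψ)         = nnf¬ φ ∨ nnf¬ ψ
  nnf¬ (φ ∨ ψ)         = nnf¬ φ ∧ nnf¬ ψ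
  nnf¬ (quant q x φ)   = quant (dual q) x (nnf¬ φ)
  nnf¬ true            = false
  nnf¬ false           = true
  nnf¬ (x ≐ y)         = ¬′ (x ≐ y)
  nnf¬ (letter a x)    = ¬′ letter a x
  nnf¬ (pred P P∈σ xs) = ¬′ pred P P∈σ xs

-- The sequences of quantifiers along the branches of the parse tree.
branches : Formula σ n v → List (List Quantifier)
branches true          = [] ∷ []
branches false         = [] ∷ []
branches (_ ≐ _)       = [] ∷ []
branches (letter _ _)  = [] ∷ []
branches (pred _ _ _)  = [] ∷ []
branches (¬′ φ)        = branches φ
branches (φ ∧ ψ)       = branches φ ++ branches ψ
branches (φ ∨ ψ)       = branches φ ++ branches ψ
branches (quant q _ φ) = List.map (q ∷_) (branches φ)

------------------------------------------------------------------------
-- Fragments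

Fragment : Signature → Set₁
Fragment σ = ∀ {n v} → Pred (Formula σ n v) 0ℓ

-- Prenex formulas with at most k blocks, closed under conjunction and
-- disjunction.  Up to equivalence this is also closed under negation, as
-- the prefix may start with either quantifier.
data BΣ (k : ℕ) (σ : Signature) {n v} : Pred (Formula σ n v) 0ℓ where
  prenex : ∀ {qs φ} → Prenex qs φ → blocks qs ≤ k → BΣ k σ φ
  _∧_    : ∀ {φ ψ} → BΣ k σ φ → BΣ k σ ψ → BΣ k σ (φ ∧ ψ)
  _∨_    : ∀ {φ ψ} → BΣ k σ φ → BΣ k σ ψ → BΣ k σ (φ ∨ ψ)

FO² : (σ : Signature) → Fragment σ
FO² σ {v = v} φ = v ≡ 2

-- Meant for k ≥ 1.
FO²[_] : (k : ℕ) (σ : Signature) → Fragment σ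
FO²[ k ] σ φ = FO² σ φ × All (λ qs → alternations qs ≤ k ∸ 1) (branches (nnf φ))

_BelongsTo_ : Language n → Fragment σ → Set
_BelongsTo_ {n} {σ} K F =
  ∃[ v ] Σ[ φ ∈ Formula σ n v ] Sentence φ × F φ × (∀ w → K w ⇔ w ⊨ φ)

-- An inhabitant is a procedure which, given a regular language (presented
-- by an automaton) over any finite alphabet, decides membership in F.
Decidable : Fragment σ → Set
Decidable F = ∀ {n} (M : DFA n) → Dec (L M BelongsTo F)

{-# OPTIONS --safe #-}
module Submission where

-- Let the words of length s act on the states of an automaton for L like words
-- of length s t, for every t ≥ 1.  Cut words into blocks of length s and regard
-- the blocks as letters.  Then L is in a fragment with signature Reg if and only
-- if, for every word r shorter than s, the language of the words W of blocks
-- with W r in L is in the same fragment with signature [<,+1].  If the latter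
-- holds, blocks are represented by their first positions, which the modular
-- predicates recognise.  Conversely, take a common multiple t of the moduli in a
-- formula for L and replace every block by an equivalent word of length s t: the
-- residue of a position now depends only on its offset in the image of its
-- block, so the formula can be evaluated in W, each variable standing for a
-- position together with an offset.  This keeps the number of variables and the
-- alternations on the branches; for BΣ, a formula with few alternations on its
-- branches is brought to prenex form in the end.
--
-- For FO²[<,MOD], no bound on the alternation is given.  Here L is definable if
-- and only if its syntactic monoid satisfies (xy)^ω y (xy)^ω = (xy)^ω =
-- (xy)^ω x (xy)^ω for all words x, y of lengths divisible by s.  The identities
-- are necessary because of a game with two pebbles.  They are sufficient since
-- they imply that whether a letter leaves the 𝓡-class of the prefix before it
-- depends only on that class, on the letter and on its residue.  Hence a word is
-- cut, at the first letter of this kind, into a factor over a smaller alphabet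
-- and a factor starting in a lower 𝓡-class; by induction 𝓡-classes, and dually
-- 𝓛-classes, are definable, and together they determine the element.

open import Defs
open import Data.Bool.Base as Bool using (Bool; true; false; T; if_then_else_)
open import Data.Bool.Properties using (T-≡)
open import Data.Empty using (⊥; ⊥-elim)
open import Data.Fin.Base as Fin using (Fin; zero; suc; toℕ; fromℕ<; funToFin; finToFun)
open import Data.Fin.Induction using (spo-wellFounded)
open import Data.Fin.Properties as Fin using (all?; any?; toℕ-fromℕ<; toℕ<n)
open import Data.Fin.Subset as Subset using (Subset; ⁅_⁆; inside; outside)
open import Data.Fin.Subset.Induction using (⊂-wellFounded)
import Data.Fin.Subset.Properties as Subset
open import Data.List.Base as List
  using (List; []; _∷_; _++_; length; reverse; drop; take; head; concatMap; allFin; tabulate; lookup;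
    cartesianProductWith; foldl)
open import Data.List.Membership.Propositional using (_∈_)
open import Data.List.Membership.Propositional.Properties
  using (∈-cartesianProductWith⁺; ∈-cartesianProductWith⁻; ∈-allFin; ∈-lookup)
open import Data.List.Properties as List
  using (length-++; length-reverse; reverse-++; unfold-reverse; reverse-involutive; ++-assoc; ++-identityʳ;
    drop-drop; take++drop≡id)
open import Data.List.Relation.Unary.All as All using (All; []; _∷_)
import Data.List.Relation.Unary.All.Properties as All
open import Data.List.Relation.Unary.Any using (here; there; index)
import Data.List.Relation.Unary.Any.Properties as Any
open import Data.Maybe.Base using (Maybe; just)
import Data.Maybe.Properties as Maybe
open import Data.Nat.Base hiding (pred)
open import Data.Nat.DivMod
open import Data.Nat.Divisibility using (_∣_; divides; ∣-trans; m∣m*n; n∣m*n)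
open import Data.Nat.Induction using (<-rec)
open import Data.Nat.Properties
open import Data.Nat.Tactic.RingSolver using (solve-∀)
open import Data.Product.Base as Prod using (Σ; Σ-syntax; ∃; ∃-syntax; _×_; _,_; proj₁; proj₂; map₂)
open import Data.Product.Function.NonDependent.Propositional using (_×-⇔_)
open import Data.Sum.Base as Sum using (_⊎_; inj₁; inj₂; [_,_]′)
open import Data.Sum.Function.Propositional using (_⊎-⇔_)
open import Data.Unit.Base using (⊤; tt)
open import Data.Vec.Base as Vec using (Vec; []; _∷_; here; there)
open import Data.Vec.Functional as Vector using (Vector; updateAt)
open import Data.Vec.Functional.Properties using (updateAt-updates; updateAt-minimal)
import Data.Vec.Properties as Vec
open import Data.Vec.Relation.Binary.Pointwise.Inductive using (Pointwise; []; _∷_)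
open import Data.Vec.Relation.Unary.All as VecAll using ([]; _∷_)
import Data.Vec.Relation.Unary.All.Properties as VecAll
open import Function.Base using (_∘_; id; const; case_of_; _∋_)
open import Function.Bundles using (_⇔_; mk⇔; Equivalence)
open import Function.Construct.Composition using (_⇔-∘_)
open import Function.Construct.Identity using (⇔-id)
open import Function.Construct.Symmetry using (⇔-sym)
open import Function.Related.TypeIsomorphisms using (¬-cong-⇔)
open import Induction.WellFounded using (Acc; acc)
open import Level using (0ℓ)
open import Relation.Binary.Definitions using (tri<; tri≈; tri>)
open import Relation.Binary.PropositionalEquality
open import Relation.Nullary using (Dec; yes; no; ¬_; ⌊_⌋)
open import Relation.Nullary.Decidable as Dec
  using (decidable-stable; _→-dec_; _×-dec_; _⊎-dec_; ¬?; toWitness; fromWitness)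
open import Relation.Nullary.Negation using (contradiction)
open import Relation.Unary using (Pred)

open Equivalence using (to; from)

-- The number s must depend on the automaton alone, since the moduli of a hypothetical formula are
-- unknown when the procedure starts. It exists because the set of transformations induced by the
-- words of length k takes finitely many values, and an inclusion between two such sets persists
-- when letters are added in front. The moduli of a formula are then absorbed by the choice of t.
-- Empty words need care twice: over the empty domain a quantifier cannot be pulled out of a
-- connective, and the positions of the remainder r need some position of W to represent them. A
-- quantifier-free test for emptiness settles both. For FO²[<,MOD] the route through blocks is
-- closed also because two variables without local predicates do not suffice to read off a block.
-- Reversal, which yields the 𝓛-classes, turns the residue of p into that of l - 1 - p, where l is
-- the length; so the induction admits every labelling of positions that is injective on residues,
-- and fixes lengths modulo s. Searches through words stop at bounds from the pigeonhole principle.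

private
  variable
    σ τ : Signature
    m n v v₁ v₂ k c G : ℕ
    q : Quantifier
    A B C : Set

-- Satisfaction and finite connectives

⇔-reflexive : A ≡ B → A ⇔ B
⇔-reflexive refl = ⇔-id _

infixr 0 _⟨⇔⟩_
_⟨⇔⟩_ : A ⇔ B → B ⇔ C → A ⇔ C
f ⟨⇔⟩ g = g ⇔-∘ f

holds? : (w : Word n) {r : ℕ} (P : Predicate n r) (ps : Vec ℕ r) → Dec (Holds w P ps)
holds? w less              (p ∷ q ∷ []) = p <? q
holds? w (letter-x+ a j)   (p ∷ [])     = Maybe.≡-dec Fin._≟_ _ _
holds? w (letter-min+ a j) []           = Maybe.≡-dec Fin._≟_ _ _
holds? w (letter-max- a j) []           = Maybe.≡-dec Fin._≟_ _ _
holds? w (MOD- d i)        (p ∷ [])     = _ ≟ _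
holds? w (D- d i)          []           = _ ≟ _

-- This supplies the classical steps of the prenex transformation: double negation, the De Morgan
-- laws, and pulling ∀ out of a disjunction.
sat? : (w : Word n) (ρ : Vector ℕ v) (φ : Formula σ n v) → Dec (Sat w ρ φ)
sat? w ρ true           = yes tt
sat? w ρ false          = no λ ()
sat? w ρ (x ≐ y)        = _ ≟ _
sat? w ρ (letter a x)   = Maybe.≡-dec Fin._≟_ _ _
sat? w ρ (pred P _ xs)  = holds? w P (Vec.map ρ xs)
sat? w ρ (¬′ φ)         = ¬? (sat? w ρ φ)
sat? w ρ (φ ∧ ψ)        = sat? w ρ φ ×-dec sat? w ρ ψ
sat? w ρ (φ ∨ ψ)        = sat? w ρ φ ⊎-dec sat? w ρ ψ
sat? w ρ (quant ∃′ x φ) = any? λ p → sat? w (updateAt ρ x (const (toℕ p))) φ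
sat? w ρ (quant ∀′ x φ) = all? λ p → sat? w (updateAt ρ x (const (toℕ p))) φ

⋁ : (c : ℕ) → (Fin c → Formula σ n v) → Formula σ n v
⋁ zero    f = false
⋁ (suc c) f = f zero ∨ ⋁ c (f ∘ suc)

⋀ : (c : ℕ) → (Fin c → Formula σ n v) → Formula σ n v
⋀ zero    f = true
⋀ (suc c) f = f zero ∧ ⋀ c (f ∘ suc)

⌜_⌝ : Bool → Formula σ n v
⌜ true  ⌝ = true
⌜ false ⌝ = false

module _ {w : Word n} {ρ : Vector ℕ v} where

  sat-⋁ : ∀ c {f : Fin c → Formula σ n v} → Sat w ρ (⋁ c f) ⇔ (∃[ i ] Sat w ρ (f i))
  sat-⋁ zero    = mk⇔ (λ ()) (λ ())
  sat-⋁ (suc c) = mk⇔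
    [ (zero ,_) , (λ s → let i , t = to (sat-⋁ c) s in suc i , t) ]′
    λ { (zero , s) → inj₁ s ; (suc i , s) → inj₂ (from (sat-⋁ c) (i , s)) }

  sat-⋀ : ∀ c {f : Fin c → Formula σ n v} → Sat w ρ (⋀ c f) ⇔ (∀ i → Sat w ρ (f i))
  sat-⋀ zero    = mk⇔ (λ _ ()) (λ _ → tt)
  sat-⋀ (suc c) = mk⇔
    (λ { (s , _) zero → s ; (_ , s) (suc i) → to (sat-⋀ c) s i })
    λ s → s zero , from (sat-⋀ c) (s ∘ suc)

  sat-⌜⌝ : ∀ {b} → Sat w ρ (⌜_⌝ {σ} {n} {v} b) ⇔ T b
  sat-⌜⌝ {b = true}  = ⇔-id _
  sat-⌜⌝ {b = false} = ⇔-id _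

∃-cong : {P Q : A → Set} → (∀ x → P x ⇔ Q x) → ∃ P ⇔ ∃ Q
∃-cong e = mk⇔ (map₂ (to (e _))) (map₂ (from (e _)))

∀-cong : {P Q : A → Set} → (∀ x → P x ⇔ Q x) → ((x : A) → P x) ⇔ ((x : A) → Q x)
∀-cong e = mk⇔ (λ f x → to (e x) (f x)) (λ f x → from (e x) (f x))

sat-cong : ∀ {w : Word n} {ρ ρ′ : Vector ℕ v} (φ : Formula σ n v) →
           (∀ x → ρ x ≡ ρ′ x) → Sat w ρ φ ⇔ Sat w ρ′ φ
updateAt-cong : ∀ {ρ ρ′ : Vector ℕ v} x {p : ℕ} → (∀ y → ρ y ≡ ρ′ y) →
                ∀ y → updateAt ρ x (const p) y ≡ updateAt ρ′ x (const p) y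
updateAt-cong zero    e zero    = refl
updateAt-cong zero    e (suc y) = e (suc y)
updateAt-cong (suc x) e zero    = e zero
updateAt-cong (suc x) e (suc y) = updateAt-cong x (e ∘ suc) y

sat-cong true           e = ⇔-id _
sat-cong false          e = ⇔-id _
sat-cong (x ≐ y)        e = ⇔-reflexive (cong₂ _≡_ (e x) (e y))
sat-cong (letter a x)   e = ⇔-reflexive (cong (_ has a at_) (e x))
sat-cong (pred P _ xs)  e = ⇔-reflexive (cong (Holds _ P) (Vec.map-cong e xs))
sat-cong (¬′ φ)         e = ¬-cong-⇔ (sat-cong φ e)
sat-cong (φ ∧ ψ)        e = sat-cong φ e ×-⇔ sat-cong ψ e
sat-cong (φ ∨ ψ)        e = sat-cong φ e ⊎-⇔ sat-cong ψ e
sat-cong (quant ∃′ x φ) e = ∃-cong λ _ → sat-cong φ (updateAt-cong x e)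
sat-cong (quant ∀′ x φ) e = ∀-cong λ _ → sat-cong φ (updateAt-cong x e)

-- Free variables

x∈p─q⇒x∉q : ∀ {x} {p q : Subset n} → x Subset.∈ p Subset.─ q → x Subset.∉ q
x∈p─q⇒x∉q {p = _ ∷ _} {q = inside  ∷ _} (there x∈) (there x∈q) = x∈p─q⇒x∉q x∈ x∈q
x∈p─q⇒x∉q {p = _ ∷ _} {q = outside ∷ _} (there x∈) (there x∈q) = x∈p─q⇒x∉q x∈ x∈q

-- A record and not a function type, so that φ and V are found by unification although
-- `freeVariables` computes.
record _FreeIn_ (φ : Formula σ n v) (V : Pred (Fin v) 0ℓ) : Set where
  constructor ⟪_⟫
  field
    satisfies : ∀ {x} → x Subset.∈ freeVariables φ → V x

open _FreeIn_

module _ {V : Pred (Fin v) 0ℓ} where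

  free-true : _FreeIn_ {σ} {n} true V
  free-true = ⟪ ⊥-elim ∘ Subset.∉⊥ ⟫

  free-false : _FreeIn_ {σ} {n} false V
  free-false = ⟪ ⊥-elim ∘ Subset.∉⊥ ⟫

  free-⌜⌝ : ∀ b → _FreeIn_ {σ} {n} ⌜ b ⌝ V
  free-⌜⌝ true  = free-true
  free-⌜⌝ false = free-false

  private
    ∈⁅⁆ : ∀ {x z} → V x → z Subset.∈ ⁅ x ⁆ → V z
    ∈⁅⁆ Vx z∈ = subst V (sym (Subset.x∈⁅y⁆⇒x≡y _ z∈)) Vx

  free-≐ : ∀ {x y} → V x → V y → _FreeIn_ {σ} {n} (x ≐ y) V
  free-≐ Vx Vy = ⟪ [ ∈⁅⁆ Vx , ∈⁅⁆ Vy ]′ ∘ Subset.x∈p∪q⁻ _ _ ⟫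

  free-letter : ∀ {a x} → V x → _FreeIn_ {σ} {n} (letter a x) V
  free-letter Vx = ⟪ ∈⁅⁆ Vx ⟫

  free-pred : ∀ {r} {P : Predicate n r} {P∈σ : σ (class P)} {xs} → VecAll.All V xs →
              _FreeIn_ {σ} (pred P P∈σ xs) V
  free-pred [] = ⟪ ⊥-elim ∘ Subset.∉⊥ ⟫
  free-pred {P = P} {P∈σ} (_∷_ {xs = xs} Vx Vxs) = ⟪ [ ∈⁅⁆ Vx , go Vxs ]′ ∘ Subset.x∈p∪q⁻ _ _ ⟫
    where
    go : ∀ {r} {xs : Vec (Fin v) r} {z} → VecAll.All V xs →
         z Subset.∈ Subset.⋃ (List.map ⁅_⁆ (Vec.toList xs)) → V z
    go []         z∈ = ⊥-elim (Subset.∉⊥ z∈)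
    go (Vx ∷ Vxs) z∈ = [ ∈⁅⁆ Vx , go Vxs ]′ (Subset.x∈p∪q⁻ _ _ z∈)

  free-¬ : {φ : Formula σ n v} → φ FreeIn V → (¬′ φ) FreeIn V
  free-¬ f = ⟪ satisfies f ⟫

  free-∧ : {φ ψ : Formula σ n v} → φ FreeIn V → ψ FreeIn V → (φ ∧ ψ) FreeIn V
  free-∧ f g = ⟪ [ satisfies f , satisfies g ]′ ∘ Subset.x∈p∪q⁻ _ _ ⟫

  free-∨ : {φ ψ : Formula σ n v} → φ FreeIn V → ψ FreeIn V → (φ ∨ ψ) FreeIn V
  free-∨ f g = ⟪ [ satisfies f , satisfies g ]′ ∘ Subset.x∈p∪q⁻ _ _ ⟫

  free-quant : ∀ {q x} {φ : Formula σ n v} → φ FreeIn (λ y → y ≢ x → V y) → quant q x φ FreeIn V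
  free-quant f = ⟪ (λ z∈ → satisfies f (Subset.p─q⊆p _ _ z∈)
    λ { refl → x∈p─q⇒x∉q z∈ (Subset.x∈⁅x⁆ _) }) ⟫

  free-⋁ : ∀ c {f : Fin c → Formula σ n v} → (∀ i → f i FreeIn V) → ⋁ c f FreeIn V
  free-⋁ zero    h = free-false
  free-⋁ (suc c) h = free-∨ (h zero) (free-⋁ c (h ∘ suc))

  free-⋀ : ∀ c {f : Fin c → Formula σ n v} → (∀ i → f i FreeIn V) → ⋀ c f FreeIn V
  free-⋀ zero    h = free-true
  free-⋀ (suc c) h = free-∧ (h zero) (free-⋀ c (h ∘ suc))

free-mono : {φ : Formula σ n v} {V V′ : Pred (Fin v) 0ℓ} → (∀ {x} → V x → V′ x) →
            φ FreeIn V → φ FreeIn V′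
free-mono V⊆V′ f = ⟪ V⊆V′ ∘ satisfies f ⟫

Free : Formula σ n v → Pred (Fin v) 0ℓ
Free φ x = x Subset.∈ freeVariables φ

Free-quant : ∀ {q x y} {φ : Formula σ n v} → Free φ y → y ≢ x → Free (quant q x φ) y
Free-quant = Subset.x∈p∧x≢y⇒x∈p-y

Free-pred : ∀ {r} {P : Predicate n r} {P∈σ : σ (class P)} {V : Pred (Fin v) 0ℓ} xs →
            (∀ {x} → Free {σ} (pred P P∈σ xs) x → V x) → VecAll.All V xs
Free-pred {V = V} xs h = go xs h
  where
  go : ∀ {r} (xs : Vec (Fin _) r) →
       (∀ {x} → x Subset.∈ Subset.⋃ (List.map ⁅_⁆ (Vec.toList xs)) → V x) → VecAll.All V xs
  go []       h = []
  go (x ∷ xs) h = h (Subset.x∈p∪q⁺ (inj₁ (Subset.x∈⁅x⁆ x))) ∷ go xs (h ∘ Subset.x∈p∪q⁺ ∘ inj₂)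

-- Branches

-- Translations graft quantifier-free guards at inner nodes of the parse tree. The new branches are
-- prefixes of old ones, so a condition on branches has to pass to prefixes, as bounds on
-- alternations do.
PrefixClosed : Pred (List Quantifier) 0ℓ → Set
PrefixClosed P = ∀ qs {rs} → P (qs ++ rs) → P qs

data Sign : Set where
  pos neg : Sign

opposite : Sign → Sign
opposite pos = neg
opposite neg = pos

signed : Sign → Quantifier → Quantifier
signed pos q = q
signed neg q = dual q

normal : Sign → Formula σ n v → Formula σ n v
normal pos = nnf
normal neg = nnf¬

-- Computed on φ itself, not on the normal form of φ (or of ¬ φ) whose branches
-- are meant.
Branches : Sign → Pred (List Quantifier) 0ℓ → Pred (Formula σ n v) 0ℓ
Branches s P (¬′ φ)        = Branches (opposite s) P φ
Branches s P (φ ∧ ψ)       = Branches s P φ × Branches s P ψ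
Branches s P (φ ∨ ψ)       = Branches s P φ × Branches s P ψ
Branches s P (quant q x φ) = Branches s (P ∘ (signed s q ∷_)) φ
Branches s P _             = P []

++⇔ : ∀ {P : Pred A 0ℓ} xs {ys} → All P (xs ++ ys) ⇔ (All P xs × All P ys)
++⇔ xs = mk⇔ (All.++⁻ xs) (Prod.uncurry All.++⁺)

branches⇔ : ∀ s (φ : Formula σ n v) {P} → All P (branches (normal s φ)) ⇔ Branches s P φ
branches⇔ pos true          = mk⇔ All.head (_∷ [])
branches⇔ neg true          = mk⇔ All.head (_∷ [])
branches⇔ pos false         = mk⇔ All.head (_∷ [])
branches⇔ neg false         = mk⇔ All.head (_∷ [])
branches⇔ pos (x ≐ y)       = mk⇔ All.head (_∷ [])
branches⇔ neg (x ≐ y)       = mk⇔ All.head (_∷ [])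
branches⇔ pos (letter a x)  = mk⇔ All.head (_∷ [])
branches⇔ neg (letter a x)  = mk⇔ All.head (_∷ [])
branches⇔ pos (pred _ _ _)  = mk⇔ All.head (_∷ [])
branches⇔ neg (pred _ _ _)  = mk⇔ All.head (_∷ [])
branches⇔ pos (¬′ φ)        = branches⇔ neg φ
branches⇔ neg (¬′ φ)        = branches⇔ pos φ
branches⇔ pos (φ ∧ ψ)       = ++⇔ (branches (nnf φ)) ⟨⇔⟩ branches⇔ pos φ ×-⇔ branches⇔ pos ψ
branches⇔ neg (φ ∧ ψ)       = ++⇔ (branches (nnf¬ φ)) ⟨⇔⟩ branches⇔ neg φ ×-⇔ branches⇔ neg ψ
branches⇔ pos (φ ∨ ψ)       = ++⇔ (branches (nnf φ)) ⟨⇔⟩ branches⇔ pos φ ×-⇔ branches⇔ pos ψ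
branches⇔ neg (φ ∨ ψ)       = ++⇔ (branches (nnf¬ φ)) ⟨⇔⟩ branches⇔ neg φ ×-⇔ branches⇔ neg ψ
branches⇔ pos (quant q x φ) = mk⇔ All.map⁻ All.map⁺ ⟨⇔⟩ branches⇔ pos φ
branches⇔ neg (quant q x φ) = mk⇔ All.map⁻ All.map⁺ ⟨⇔⟩ branches⇔ neg φ

branches-map : ∀ s (φ : Formula σ n v) {P Q} → (∀ {qs} → P qs → Q qs) → Branches s P φ → Branches s Q φ
branches-map s true          P⊆Q = P⊆Q
branches-map s false         P⊆Q = P⊆Q
branches-map s (x ≐ y)       P⊆Q = P⊆Q
branches-map s (letter a x)  P⊆Q = P⊆Q
branches-map s (pred _ _ _)  P⊆Q = P⊆Q
branches-map s (¬′ φ)        P⊆Q = branches-map (opposite s) φ P⊆Q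
branches-map s (φ ∧ ψ)       P⊆Q = Prod.map (branches-map s φ P⊆Q) (branches-map s ψ P⊆Q)
branches-map s (φ ∨ ψ)       P⊆Q = Prod.map (branches-map s φ P⊆Q) (branches-map s ψ P⊆Q)
branches-map s (quant q x φ) P⊆Q = branches-map s φ P⊆Q

-- Every formula has a branch, and the empty sequence is a prefix of it.
branches⇒[] : ∀ s (φ : Formula σ n v) {P} → PrefixClosed P → Branches s P φ → P []
branches⇒[] s true          closed p       = p
branches⇒[] s false         closed p       = p
branches⇒[] s (x ≐ y)       closed p       = p
branches⇒[] s (letter a x)  closed p       = p
branches⇒[] s (pred _ _ _)  closed p       = p
branches⇒[] s (¬′ φ)        closed ps      = branches⇒[] (opposite s) φ closed ps
branches⇒[] s (φ ∧ ψ)       closed (p , _) = branches⇒[] s φ closed p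
branches⇒[] s (φ ∨ ψ)       closed (p , _) = branches⇒[] s φ closed p
branches⇒[] s (quant q x φ) closed ps      = closed [] (branches⇒[] s φ (λ qs → closed (signed s q ∷ qs)) ps)

module _ {P : Pred (List Quantifier) 0ℓ} (p : P []) where

  branches-quantifierFree : ∀ s {φ : Formula σ n v} → QuantifierFree φ → Branches s P φ
  branches-quantifierFree s true            = p
  branches-quantifierFree s false           = p
  branches-quantifierFree s (x ≐ y)         = p
  branches-quantifierFree s (letter a x)    = p
  branches-quantifierFree s (pred P P∈σ xs) = p
  branches-quantifierFree s (¬′ φ)          = branches-quantifierFree (opposite s) φ
  branches-quantifierFree s (φ ∧ ψ)         = branches-quantifierFree s φ , branches-quantifierFree s ψ
  branches-quantifierFree s (φ ∨ ψ)         = branches-quantifierFree s φ , branches-quantifierFree s ψ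

  branches-⋁ : ∀ s c {f : Fin c → Formula σ n v} → (∀ i → Branches s P (f i)) → Branches s P (⋁ c f)
  branches-⋁ s zero    h = p
  branches-⋁ s (suc c) h = h zero , branches-⋁ s c (h ∘ suc)

  branches-⋀ : ∀ s c {f : Fin c → Formula σ n v} → (∀ i → Branches s P (f i)) → Branches s P (⋀ c f)
  branches-⋀ s zero    h = p
  branches-⋀ s (suc c) h = h zero , branches-⋀ s c (h ∘ suc)

Elementary : Pred (Fin v) 0ℓ → Pred (Formula σ n v) 0ℓ
Elementary V φ = QuantifierFree φ × φ FreeIn V

module _ {V : Pred (Fin v) 0ℓ} where

  elementary-⌜⌝ : ∀ b → Elementary {σ = σ} {n} V ⌜ b ⌝
  elementary-⌜⌝ true  = true , free-true
  elementary-⌜⌝ false = false , free-false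

  elementary-≐ : ∀ {x y} → V x → V y → Elementary {σ = σ} {n} V (x ≐ y)
  elementary-≐ Vx Vy = _ ≐ _ , free-≐ Vx Vy

  elementary-pred : ∀ {r} (P : Predicate n r) (P∈σ : σ (class P)) {xs} → VecAll.All V xs →
    Elementary {σ = σ} V (pred P P∈σ xs)
  elementary-pred P P∈σ Vxs = pred P P∈σ _ , free-pred Vxs

  elementary-¬ : {φ : Formula σ n v} → Elementary V φ → Elementary V (¬′ φ)
  elementary-¬ (p , f) = ¬′ p , free-¬ f

  elementary-∧ : {φ ψ : Formula σ n v} → Elementary V φ → Elementary V ψ → Elementary V (φ ∧ ψ)
  elementary-∧ (p , f) (q , g) = p ∧ q , free-∧ f g

  elementary-∨ : {φ ψ : Formula σ n v} → Elementary V φ → Elementary V ψ → Elementary V (φ ∨ ψ)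
  elementary-∨ (p , f) (q , g) = p ∨ q , free-∨ f g

  elementary-⋁ : ∀ c {f : Fin c → Formula σ n v} → (∀ i → Elementary V (f i)) → Elementary V (⋁ c f)
  elementary-⋁ zero    h = false , free-false
  elementary-⋁ (suc c) h = elementary-∨ (h zero) (elementary-⋁ c (h ∘ suc))

-- The common form of both hierarchies: `FO²[ k ]` adds the restriction to two variables, and over
-- signatures with the local predicates `BΣ k` defines the same languages for k ≥ 1.
Alternating : ℕ → (σ : Signature) → Fragment σ
Alternating k σ φ = Branches pos (λ qs → alternations qs ≤ k ∸ 1) φ

alternations-∷ : ∀ q qs → alternations qs ≤ alternations (q ∷ qs)
alternations-∷ q  []        = z≤n
alternations-∷ ∃′ (∃′ ∷ qs) = ≤-refl
alternations-∷ ∃′ (∀′ ∷ qs) = n≤1+n _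
alternations-∷ ∀′ (∃′ ∷ qs) = n≤1+n _
alternations-∷ ∀′ (∀′ ∷ qs) = ≤-refl

alternations-++ : ∀ qs {rs} → alternations qs ≤ alternations (qs ++ rs)
alternations-++ []             = z≤n
alternations-++ (_ ∷ [])       = z≤n
alternations-++ (∃′ ∷ ∃′ ∷ qs) = alternations-++ (∃′ ∷ qs)
alternations-++ (∀′ ∷ ∀′ ∷ qs) = alternations-++ (∀′ ∷ qs)
alternations-++ (∃′ ∷ ∀′ ∷ qs) = s≤s (alternations-++ (∀′ ∷ qs))
alternations-++ (∀′ ∷ ∃′ ∷ qs) = s≤s (alternations-++ (∃′ ∷ qs))

alternating-closed : ∀ {k} → PrefixClosed (λ qs → alternations qs ≤ k)
alternating-closed qs = ≤-trans (alternations-++ qs)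

-- The recursion follows the proof of quantifier-freeness, so there are no binders that could
-- capture a variable and α need not be injective.
rename : {φ : Formula σ n v} → QuantifierFree φ → (Fin v → Fin v₁) → Formula σ n v₁
rename true            α = true
rename false           α = false
rename (x ≐ y)         α = α x ≐ α y
rename (letter a x)    α = letter a (α x)
rename (pred P P∈σ xs) α = pred P P∈σ (Vec.map α xs)
rename (¬′ φ)          α = ¬′ rename φ α
rename (φ ∧ ψ)         α = rename φ α ∧ rename ψ α
rename (φ ∨ ψ)         α = rename φ α ∨ rename ψ α

rename-quantifierFree : {φ : Formula σ n v} (φ-qf : QuantifierFree φ) (α : Fin v → Fin v₁) →
                        QuantifierFree (rename φ-qf α)
rename-quantifierFree true            α = true
rename-quantifierFree false           α = false
rename-quantifierFree (x ≐ y)         α = α x ≐ α y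
rename-quantifierFree (letter a x)    α = letter a (α x)
rename-quantifierFree (pred P P∈σ xs) α = pred P P∈σ (Vec.map α xs)
rename-quantifierFree (¬′ φ)          α = ¬′ rename-quantifierFree φ α
rename-quantifierFree (φ ∧ ψ)         α = rename-quantifierFree φ α ∧ rename-quantifierFree ψ α
rename-quantifierFree (φ ∨ ψ)         α = rename-quantifierFree φ α ∨ rename-quantifierFree ψ α

rename-free : {φ : Formula σ n v} (φ-qf : QuantifierFree φ) (α : Fin v → Fin v₁)
              {V : Pred (Fin v₁) 0ℓ} → (∀ {x} → Free φ x → V (α x)) → rename φ-qf α FreeIn V
rename-free true            α h = free-true
rename-free false           α h = free-false
rename-free (x ≐ y)         α h = free-≐ (h (Subset.x∈p∪q⁺ (inj₁ (Subset.x∈⁅x⁆ x))))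
  (h (Subset.x∈p∪q⁺ (inj₂ (Subset.x∈⁅x⁆ y))))
rename-free (letter a x)    α h = free-letter (h (Subset.x∈⁅x⁆ x))
rename-free {σ = σ} (pred P P∈σ xs) α h = free-pred (VecAll.map⁺ (Free-pred {σ = σ} {P = P} {P∈σ} xs h))
rename-free (¬′ φ)          α h = free-¬ (rename-free φ α h)
rename-free (φ ∧ ψ)         α h = free-∧ (rename-free φ α (h ∘ Subset.x∈p∪q⁺ ∘ inj₁))
  (rename-free ψ α (h ∘ Subset.x∈p∪q⁺ ∘ inj₂))
rename-free (φ ∨ ψ)         α h = free-∨ (rename-free φ α (h ∘ Subset.x∈p∪q⁺ ∘ inj₁))
  (rename-free ψ α (h ∘ Subset.x∈p∪q⁺ ∘ inj₂))

map-agree : ∀ {r} {f g : A → B} {xs : Vec A r} → VecAll.All (λ x → f x ≡ g x) xs → Vec.map f xs ≡ Vec.map g xs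
map-agree []       = refl
map-agree (e ∷ es) = cong₂ _∷_ e (map-agree es)

sat-rename : {φ : Formula σ n v} (φ-qf : QuantifierFree φ) (α : Fin v → Fin v₁) {w : Word n} {ρ : Vector ℕ v}
  {ρ′ : Vector ℕ v₁} →
             (∀ {x} → Free φ x → ρ′ (α x) ≡ ρ x) → Sat w ρ′ (rename φ-qf α) ⇔ Sat w ρ φ
sat-rename true            α h = ⇔-id _
sat-rename false           α h = ⇔-id _
sat-rename (x ≐ y)         α h = ⇔-reflexive (cong₂ _≡_ (h (Subset.x∈p∪q⁺ (inj₁ (Subset.x∈⁅x⁆ x))))
  (h (Subset.x∈p∪q⁺ (inj₂ (Subset.x∈⁅x⁆ y)))))
sat-rename (letter a x)    α h = ⇔-reflexive (cong (_ has a at_) (h (Subset.x∈⁅x⁆ x)))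
sat-rename {σ = σ} (pred P P∈σ xs) α {ρ′ = ρ′} h =
  ⇔-reflexive (cong (Holds _ P) (trans (sym (Vec.map-∘ ρ′ α xs)) (map-agree (Free-pred {σ = σ} {P = P} {P∈σ} xs h))))
sat-rename (¬′ φ)          α h = ¬-cong-⇔ (sat-rename φ α h)
sat-rename (φ ∧ ψ)         α h = sat-rename φ α (h ∘ Subset.x∈p∪q⁺ ∘ inj₁) ×-⇔ sat-rename ψ α
  (h ∘ Subset.x∈p∪q⁺ ∘ inj₂)
sat-rename (φ ∨ ψ)         α h = sat-rename φ α (h ∘ Subset.x∈p∪q⁺ ∘ inj₁) ⊎-⇔ sat-rename ψ α
  (h ∘ Subset.x∈p∪q⁺ ∘ inj₂)

-- Pulling quantifiers out of connectives

Quant : Quantifier → (A : Set) → (A → Set) → Set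
Quant ∃′ A P = Σ A P
Quant ∀′ A P = (a : A) → P a

Quant-cong : ∀ q {P Q : A → Set} → (∀ x → P x ⇔ Q x) → Quant q A P ⇔ Quant q A Q
Quant-cong ∃′ = ∃-cong
Quant-cong ∀′ = ∀-cong

quant? : ∀ q {P : Fin n → Set} → (∀ x → Dec (P x)) → Dec (Quant q (Fin n) P)
quant? ∃′ = any?
quant? ∀′ = all?

sat-quant : ∀ q {w : Word n} {ρ : Vector ℕ v} {x} {φ : Formula σ n v} →
            Sat w ρ (quant q x φ) ⇔ Quant q (Fin (length w)) (λ p → Sat w (updateAt ρ x (const (toℕ p))) φ)
sat-quant ∃′ = ⇔-id _
sat-quant ∀′ = ⇔-id _

data Connective : Set where
  and or : Connective

connect : Connective → Formula σ n v → Formula σ n v → Formula σ n v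
connect and = _∧_
connect or  = _∨_

Connect : Connective → Set → Set → Set
Connect and = _×_
Connect or  = _⊎_

connect-quantifierFree : ∀ o {φ ψ : Formula σ n v} → QuantifierFree φ → QuantifierFree ψ →
  QuantifierFree (connect o φ ψ)
connect-quantifierFree and = _∧_
connect-quantifierFree or  = _∨_

sat-connect : ∀ o {w : Word n} {ρ : Vector ℕ v} {φ ψ : Formula σ n v} →
  Sat w ρ (connect o φ ψ) ⇔ Connect o (Sat w ρ φ) (Sat w ρ ψ)
sat-connect and = ⇔-id _
sat-connect or  = ⇔-id _

Connect-cong : ∀ o {A′ B′ : Set} → A ⇔ A′ → B ⇔ B′ → Connect o A B ⇔ Connect o A′ B′
Connect-cong and = _×-⇔_
Connect-cong or  = _⊎-⇔_

Connect-swap : ∀ o → Connect o A B ⇔ Connect o B A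
Connect-swap and = mk⇔ (λ (a , b) → b , a) (λ (a , b) → b , a)
Connect-swap or  = mk⇔ Sum.swap Sum.swap

-- Together with `Branches`, signs let the recursion follow φ or its negation down to the leaves
-- without forming a negation normal form first.
Signed : Sign → Set → Set
Signed pos A = A
Signed neg A = ¬ A

signedConnective : Sign → Connective → Connective
signedConnective pos o   = o
signedConnective neg and = or
signedConnective neg or  = and

Signed-¬ : ∀ s → Dec A → Signed (opposite s) A ⇔ Signed s (¬ A)
Signed-¬ pos A? = ⇔-id _
Signed-¬ neg A? = mk⇔ (λ a ¬a → ¬a a) (decidable-stable A?)

Signed-Connect : ∀ s o → Dec A → Connect (signedConnective s o) (Signed s A) (Signed s B) ⇔ Signed s (Connect o A B)
Signed-Connect pos o   A? = ⇔-id _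
Signed-Connect neg or  A? = mk⇔ (λ (¬a , ¬b) → [ ¬a , ¬b ]′) (λ ¬ab → (¬ab ∘ inj₁) , (¬ab ∘ inj₂))
Signed-Connect neg and A? = mk⇔ (λ { (inj₁ ¬a) (a , _) → ¬a a ; (inj₂ ¬b) (_ , b) → ¬b b })
                                (λ ¬ab → case A? of λ { (yes a) → inj₂ λ b → ¬ab (a , b) ; (no ¬a) → inj₁ ¬a })

Signed-Quant : ∀ s q {P : Fin n → Set} → (∀ x → Dec (P x)) → Quant (signed s q) (Fin n) (Signed s ∘ P)
  ⇔ Signed s (Quant q (Fin n) P)
Signed-Quant pos q  P? = ⇔-id _
Signed-Quant neg ∃′ P? = mk⇔ (λ h (x , p) → h x p) (λ h x p → h (x , p))
Signed-Quant neg ∀′ P? = mk⇔ (λ (x , ¬p) h → ¬p (h x)) (Fin.¬∀⟶∃¬ _ _ P?)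

Signed-cong : ∀ s → A ⇔ B → Signed s A ⇔ Signed s B
Signed-cong pos = id
Signed-cong neg = ¬-cong-⇔

-- The point of the domain cannot be omitted: this fails over the empty domain.
pull : ∀ o q {P : Fin n → Set} → Fin n → Dec B →
  Connect o (Quant q (Fin n) P) B ⇔ Quant q (Fin n) (λ x → Connect o (P x) B)
pull and ∃′ x₀ B? = mk⇔ (λ ((x , p) , b) → x , p , b) (λ (x , p , b) → (x , p) , b)
pull and ∀′ x₀ B? = mk⇔ (λ (h , b) x → h x , b) (λ h → (λ x → proj₁ (h x)) , proj₂ (h x₀))
pull or  ∃′ x₀ B? = mk⇔ [ (λ (x , p) → x , inj₁ p) , (λ b → x₀ , inj₂ b) ]′ λ { (x , inj₁ p) → inj₁ (x , p) ;
  (x , inj₂ b) → inj₂ b }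
pull or  ∀′ x₀ (yes b) = mk⇔ [ (λ h x → inj₁ (h x)) , (λ b x → inj₂ b) ]′ (λ _ → inj₂ b)
pull or  ∀′ x₀ (no ¬b) = mk⇔ [ (λ h x → inj₁ (h x)) ,
  (λ b x → inj₂ b) ]′ (λ h → inj₁ λ x → [ id , ⊥-elim ∘ ¬b ]′ (h x))

-- A value of Prefixed σ n k q v is a prenex formula in v variables whose
-- prefix has at most k alternations when preceded by q.
data Prefixed (σ : Signature) (n : ℕ) : ℕ → Quantifier → ℕ → Set where
  leaf : {φ : Formula σ n v} → QuantifierFree φ → Prefixed σ n k q v
  bind : Prefixed σ n k q (suc v) → Prefixed σ n k q v
  turn : Prefixed σ n k (dual q) v → Prefixed σ n (suc k) q v

⟦_⟧ : Prefixed σ n k q v → Word n → Vector ℕ v → Set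
⟦ leaf {φ = φ} _ ⟧ w ρ = Sat w ρ φ
⟦ bind {q = q} f ⟧ w ρ = Quant q (Fin (length w)) λ p → ⟦ f ⟧ w (toℕ p Vector.∷ ρ)
⟦ turn f         ⟧ w ρ = ⟦ f ⟧ w ρ

∷-cong : {p : ℕ} {ρ ρ′ : Vector ℕ v} → (∀ x → ρ x ≡ ρ′ x) → ∀ x → (p Vector.∷ ρ) x ≡ (p Vector.∷ ρ′) x
∷-cong e zero    = refl
∷-cong e (suc x) = e x

⟦⟧-cong : (f : Prefixed σ n k q v) {w : Word n} {ρ ρ′ : Vector ℕ v} → (∀ x → ρ x ≡ ρ′ x) → ⟦ f ⟧ w ρ ⇔ ⟦ f ⟧ w ρ′
⟦⟧-cong (leaf {φ = φ} _) e = sat-cong φ e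
⟦⟧-cong (bind {q = q} f) e = Quant-cong q λ p → ⟦⟧-cong f (∷-cong e)
⟦⟧-cong (turn f)         e = ⟦⟧-cong f e

⟦⟧? : (f : Prefixed σ n k q v) (w : Word n) (ρ : Vector ℕ v) → Dec (⟦ f ⟧ w ρ)
⟦⟧? (leaf {φ = φ} _) w ρ = sat? w ρ φ
⟦⟧? (bind {q = q} f) w ρ = quant? q λ p → ⟦⟧? f w _
⟦⟧? (turn f)         w ρ = ⟦⟧? f w ρ

lift : (Fin v → Fin v₁) → Fin (suc v) → Fin (suc v₁)
lift α zero    = zero
lift α (suc x) = suc (α x)

-- All leading q-quantifiers of both formulas come out before either formula turns. The turns of the
-- two prefixes are thus shared instead of added, and the bound k survives. The maps α and β collect
-- the shifts of indices and are applied at the leaves only.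
merge : Connective → Prefixed σ n k q v₁ → Prefixed σ n k q v₂ → (Fin v₁ → Fin v) → (Fin v₂ → Fin v) →
  Prefixed σ n k q v
merge o (bind f) g        α β = bind (merge o f g (lift α) (suc ∘ β))
merge o (leaf φ) (bind g) α β = bind (merge o (leaf φ) g (suc ∘ α) (lift β))
merge o (turn f) (bind g) α β = bind (merge o (turn f) g (suc ∘ α) (lift β))
merge o (leaf φ) (leaf ψ) α β = leaf (connect-quantifierFree o (rename-quantifierFree φ α)
  (rename-quantifierFree ψ β))
merge o (leaf φ) (turn g) α β = turn (merge o (leaf φ) g α β)
merge o (turn f) (leaf ψ) α β = turn (merge o f (leaf ψ) α β)
merge o (turn f) (turn g) α β = turn (merge o f g α β)

lift-∷ : {p : ℕ} {ρ : Vector ℕ v} (α : Fin v₁ → Fin v) → ∀ x → (p Vector.∷ ρ) (lift α x) ≡ (p Vector.∷ (ρ ∘ α)) x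
lift-∷ α zero    = refl
lift-∷ α (suc x) = refl

module _ {w : Word n} (p₀ : Fin (length w)) where

  ⟦merge⟧ : ∀ o (f : Prefixed σ n k q v₁) (g : Prefixed σ n k q v₂) α β {ρ : Vector ℕ v} →
            ⟦ merge o f g α β ⟧ w ρ ⇔ Connect o (⟦ f ⟧ w (ρ ∘ α)) (⟦ g ⟧ w (ρ ∘ β))
  pull-right : ∀ o (f : Prefixed σ n k q v₁) (g : Prefixed σ n k q (suc v₂)) (α : Fin v₁ → Fin v) (β : Fin v₂ → Fin v)
    {ρ : Vector ℕ v} →
               (∀ {p} → ⟦ merge o f g (suc ∘ α) (lift β) ⟧ w (p Vector.∷ ρ) ⇔ Connect o (⟦ f ⟧ w (ρ ∘ α))
                 (⟦ g ⟧ w ((p Vector.∷ ρ) ∘ lift β))) →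
               Quant q (Fin (length w)) (λ p → ⟦ merge o f g (suc ∘ α) (lift β) ⟧ w (toℕ p Vector.∷ ρ))
                 ⇔ Connect o (⟦ f ⟧ w (ρ ∘ α)) (⟦ bind g ⟧ w (ρ ∘ β))
  ⟦merge⟧ o (bind {q = q} f) g        α β {ρ} =
    Quant-cong q (λ p → ⟦merge⟧ o f g (lift α) (suc ∘ β) ⟨⇔⟩ Connect-cong o (⟦⟧-cong f (lift-∷ α)) (⇔-id _))
    ⟨⇔⟩ ⇔-sym (pull o q p₀ (⟦⟧? g w (ρ ∘ β)))
  ⟦merge⟧ o (leaf φ) (bind g) α β = pull-right o (leaf φ) g α β (⟦merge⟧ o (leaf φ) g (suc ∘ α) (lift β))
  ⟦merge⟧ o (turn f) (bind g) α β = pull-right o (turn f) g α β (⟦merge⟧ o (turn f) g (suc ∘ α) (lift β))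
  ⟦merge⟧ o (leaf φ) (leaf ψ) α β = sat-connect o ⟨⇔⟩ Connect-cong o (sat-rename φ α λ _ → refl)
    (sat-rename ψ β λ _ → refl)
  ⟦merge⟧ o (leaf φ) (turn g) α β = ⟦merge⟧ o (leaf φ) g α β
  ⟦merge⟧ o (turn f) (leaf ψ) α β = ⟦merge⟧ o f (leaf ψ) α β
  ⟦merge⟧ o (turn f) (turn g) α β = ⟦merge⟧ o f g α β

  pull-right {q = q} o f g α β {ρ} ih =
    Quant-cong q (λ p → ih ⟨⇔⟩ Connect-cong o (⇔-id _) (⟦⟧-cong g (lift-∷ β)) ⟨⇔⟩ Connect-swap o)
    ⟨⇔⟩ ⇔-sym (pull o q p₀ (⟦⟧? f w (ρ ∘ α))) ⟨⇔⟩ Connect-swap o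

-- A quantifier q′ in the scope of q costs one turn exactly if the two differ. If no turn is left,
-- this contradicts the existence of a branch. The recursive call enters as `rec`, and what is known
-- of its result as `R`, so that `prefixed` stays structurally recursive.
quantify : ∀ q q′ s (φ : Formula σ n v₁) → Branches s (λ qs → alternations (q ∷ q′ ∷ qs) ≤ k) φ →
           {R : ∀ {l} → Prefixed σ n l q′ (suc v) → Set} →
           (∀ {l} → Branches s (λ qs → alternations (q′ ∷ qs) ≤ l) φ → Σ (Prefixed σ n l q′ (suc v)) R) →
           Σ[ f ∈ Prefixed σ n k q v ] ∃[ l ] Σ[ g ∈ Prefixed σ n l q′ (suc v) ]
             R g × (∀ {w ρ} → ⟦ f ⟧ w ρ ⇔ Quant q′ (Fin (length w)) (λ p → ⟦ g ⟧ w (toℕ p Vector.∷ ρ)))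
quantify ∃′ ∃′ s φ bs rec = let f , r = rec bs in bind f , _ , f , r , ⇔-id _
quantify ∀′ ∀′ s φ bs rec = let f , r = rec bs in bind f , _ , f , r , ⇔-id _
quantify {k = zero}  ∃′ ∀′ s φ bs rec = contradiction (branches⇒[] s φ (λ qs → alternating-closed (∃′ ∷ ∀′ ∷ qs)) bs)
  λ ()
quantify {k = zero}  ∀′ ∃′ s φ bs rec = contradiction (branches⇒[] s φ (λ qs → alternating-closed (∀′ ∷ ∃′ ∷ qs)) bs)
  λ ()
quantify {k = suc k} ∃′ ∀′ s φ bs rec = let f , r = rec (branches-map s φ ≤-pred bs) in turn (bind f) ,
  _ , f , r , ⇔-id _
quantify {k = suc k} ∀′ ∃′ s φ bs rec = let f , r = rec (branches-map s φ ≤-pred bs) in turn (bind f) ,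
  _ , f , r , ⇔-id _

updateAt-agree : {φ : Formula σ n v} {α : Fin v → Fin v₁} {ρ : Vector ℕ v} {ρ′ : Vector ℕ v₁} {p : ℕ} → ∀ {q} x →
                 (∀ {y} → Free (quant q x φ) y → ρ′ (α y) ≡ ρ y) →
                 ∀ {y} → Free φ y → (p Vector.∷ ρ′) (updateAt (suc ∘ α) x (const zero) y) ≡ updateAt ρ x (const p) y
updateAt-agree {φ = φ} {α} {ρ} {ρ′} {p} {q} x agree {y} φ∋y with y Fin.≟ x
... | yes refl = trans (cong (p Vector.∷ ρ′) (updateAt-updates y _)) (sym (updateAt-updates y ρ))
... | no  y≢x  = trans (cong (p Vector.∷ ρ′) (updateAt-minimal y x _ y≢x))
                (trans (agree (Free-quant {q = q} {φ = φ} φ∋y y≢x)) (sym (updateAt-minimal y x ρ y≢x)))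

-- The formula f in v₁ de Bruijn indices defines the relation S on the free
-- variables of φ, whose variables are sent to indices by α.
Defines : (φ : Formula σ n v) → (Fin v → Fin v₁) → (Word n → Vector ℕ v → Set) → Prefixed σ n k q v₁ → Set
Defines {n = n} φ α S f = ∀ {w : Word n} → Fin (length w) → ∀ {ρ ρ′} →
  (∀ {x} → Free φ x → ρ′ (α x) ≡ ρ x) → ⟦ f ⟧ w ρ′ ⇔ S w ρ

private
  literal : ∀ s {φ : Formula σ n v} → QuantifierFree φ → (α : Fin v → Fin v₁) →
            Σ (Prefixed σ n k q v₁) (Defines φ α λ w ρ → Signed s (Sat w ρ φ))
  literal pos φ α = leaf (rename-quantifierFree φ α) , λ _ → sat-rename φ α
  literal neg φ α = leaf (¬′ rename-quantifierFree φ α) , λ _ agree → ¬-cong-⇔ (sat-rename φ α agree)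

  merge-defines : ∀ o (φ ψ : Formula σ n v) {α : Fin v → Fin v₁} {S T U : Word n → Vector ℕ v → Set} →
                  Σ (Prefixed σ n k q v₁) (Defines φ α S) → Σ (Prefixed σ n k q v₁) (Defines ψ α T) →
                  (∀ {w ρ} → Connect o (S w ρ) (T w ρ) ⇔ U w ρ) → Σ (Prefixed σ n k q v₁) (Defines (φ ∧ ψ) α U)
  merge-defines o φ ψ (f , f-φ) (g , g-ψ) e = merge o f g id id , λ p₀ agree → ⟦merge⟧ p₀ o f g id id ⟨⇔⟩
    Connect-cong o (f-φ p₀ (agree ∘ Subset.x∈p∪q⁺ ∘ inj₁)) (g-ψ p₀ (agree ∘ Subset.x∈p∪q⁺ ∘ inj₂)) ⟨⇔⟩ e

-- Branches are measured with the enclosing quantifier q in front, because the subformula continues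
-- the block of q as long as it can.
prefixed : ∀ s (φ : Formula σ n v) → Branches s (λ qs → alternations (q ∷ qs) ≤ k) φ → (α : Fin v → Fin v₁) →
           Σ (Prefixed σ n k q v₁) (Defines φ α λ w ρ → Signed s (Sat w ρ φ))
prefixed s true            _ α = literal s true α
prefixed s false           _ α = literal s false α
prefixed s (x ≐ y)         _ α = literal s (x ≐ y) α
prefixed s (letter a x)    _ α = literal s (letter a x) α
prefixed s (pred P P∈σ xs) _ α = literal s (pred P P∈σ xs) α
prefixed s (¬′ φ)         bs α =
  let f , f-φ = prefixed (opposite s) φ bs α in f , λ {w} p₀ {ρ} agree → f-φ p₀ agree ⟨⇔⟩ Signed-¬ s (sat? w ρ φ)
prefixed s (φ ∧ ψ) (bs , bs′) α = merge-defines (signedConnective s and) φ ψ (prefixed s φ bs α) (prefixed s ψ bs′ α)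
  λ {w} {ρ} → Signed-Connect s and (sat? w ρ φ)
prefixed s (φ ∨ ψ) (bs , bs′) α = merge-defines (signedConnective s or) φ ψ (prefixed s φ bs α) (prefixed s ψ bs′ α)
  λ {w} {ρ} → Signed-Connect s or (sat? w ρ φ)
prefixed s (quant q x φ)  bs α =
  let f , _ , g , g-φ , f-g = quantify _ (signed s q) s φ bs
        (λ bs → prefixed s φ bs (updateAt (suc ∘ α) x (const zero)))
  in f , λ {w} p₀ agree → f-g ⟨⇔⟩ Quant-cong (signed s q) (λ p → g-φ p₀ (updateAt-agree {φ = φ} {q = q} x agree))
         ⟨⇔⟩ Signed-Quant s q (λ p → sat? w _ φ) ⟨⇔⟩ Signed-cong s (⇔-sym (sat-quant q))

-- From de Bruijn indices to names: the variable bound below v others is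
-- named v.

depth : Prefixed σ n k q v → ℕ
depth (leaf _) = 0
depth (bind f) = suc (depth f)
depth (turn f) = depth f

alternations-turn : ∀ q qs → alternations (q ∷ qs) ≤ suc (alternations (dual q ∷ qs))
alternations-turn q  []        = z≤n
alternations-turn ∃′ (∃′ ∷ qs) = m≤n⇒m≤1+n (n≤1+n _)
alternations-turn ∃′ (∀′ ∷ qs) = ≤-refl
alternations-turn ∀′ (∃′ ∷ qs) = ≤-refl
alternations-turn ∀′ (∀′ ∷ qs) = m≤n⇒m≤1+n (n≤1+n _)

alternations-∷∷ : ∀ q qs → alternations (q ∷ q ∷ qs) ≡ alternations (q ∷ qs)
alternations-∷∷ ∃′ qs = refl
alternations-∷∷ ∀′ qs = refl

record Named {σ n} (k : ℕ) (q : Quantifier) {v V : ℕ} (α : Fin v → Fin V) (f : Prefixed σ n k q v) : Set where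
  constructor named
  field
    {formula} : Formula σ n V
    {quantifiers} : List Quantifier
    isPrenex : Prenex quantifiers formula
    bounded : alternations (q ∷ quantifiers) ≤ k
    free : formula FreeIn (λ x → ∃[ i ] α i ≡ x)
    sound : ∀ {w ρ ρ′} → (∀ i → ρ (α i) ≡ ρ′ i) → Sat w ρ formula ⇔ ⟦ f ⟧ w ρ′

name : {V : ℕ} (α : Fin v → Fin V) → (∀ i → toℕ (α i) < v) → (f : Prefixed σ n k q v) →
  v + depth f ≤ V → Named k q α f
name α α<v (leaf φ) _ = named (matrix (rename-quantifierFree φ α)) z≤n (rename-free φ α λ {x} _ → x , refl)
  λ agree → sat-rename φ α λ {x} _ → agree x
name {v = v} {V = V} α α<v (bind {q = q} f) v+≤V with
  name α⁺ α⁺<v f (subst (_≤ V) (+-suc v (depth f)) v+≤V)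
  where
  v<V : v < V
  v<V = ≤-trans (≤-trans (s≤s (m≤m+n v (depth f))) (≤-reflexive (sym (+-suc v (depth f))))) v+≤V
  α⁺ : Fin (suc v) → Fin V
  α⁺ = fromℕ< v<V Vector.∷ α
  α⁺<v : ∀ i → toℕ (α⁺ i) < suc v
  α⁺<v zero    = s≤s (≤-reflexive (toℕ-fromℕ< v<V))
  α⁺<v (suc i) = m≤n⇒m≤1+n (α<v i)
... | named {quantifiers = qs} p b fr s = named (prefix q _ p) (≤-trans (≤-reflexive (alternations-∷∷ q qs)) b)
  (free-quant (free-mono (λ { (zero , refl) x≢x → contradiction refl x≢x ; (suc i , e) _ → i , e }) fr))
  -- The names in scope are smaller than v, so the new name v overwrites none of them.
  λ {w} {ρ} agree → sat-quant q ⟨⇔⟩ Quant-cong q λ p → s λ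
    { zero → updateAt-updates _ ρ
    ; (suc i) → trans (updateAt-minimal (α i) _ ρ
      (λ αi≡v → <-irrefl refl (subst (_< v) (trans (cong toℕ αi≡v) (toℕ-fromℕ< _)) (α<v i)))) (agree i) }
name α α<v (turn {q = q} f) v+≤V with name α α<v f v+≤V
... | named {quantifiers = qs} p b fr s = named p (≤-trans (alternations-turn q qs) (s≤s b)) fr s

-- Prenex normal forms

Closed : Pred (Formula σ n v) 0ℓ
Closed φ = φ FreeIn λ _ → ⊥

-- The bound on the number of variables makes room for the variables of other
-- formulas.
Prenexes : (k : ℕ) (φ : Formula σ n v) → (Word n → Vector ℕ v → Set) → Set
Prenexes {σ = σ} {n} k φ S = ∃[ N ] ∀ {V} → N ≤ V → Σ[ ψ ∈ Formula σ n V ] BΣ (suc k) σ ψ × Closed ψ ×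
  (∀ {w : Word n} → Fin (length w) → ∀ {ρ ρ′} → Sat w ρ′ ψ ⇔ S w ρ)

blocks≤ : ∀ q qs → alternations (q ∷ qs) ≤ k → blocks qs ≤ suc k
blocks≤ q []        _ = z≤n
blocks≤ q (r ∷ qs) ≤k = s≤s (≤-trans (alternations-∷ q (r ∷ qs)) ≤k)

-- Only x can be free in φ, so every variable may be sent to the single index 0. The prefix starts
-- with q itself, hence k alternations give at most k + 1 blocks.
prenexes-quant : ∀ q x {φ : Formula σ n v} {S : Word n → Vector ℕ v → Set} → Closed (quant q x φ) →
                 Σ (Prefixed σ n k q 1) (Defines φ (const zero) S) →
                 Prenexes {σ = σ} k φ (λ w ρ → Quant q (Fin (length w)) λ p → S w (updateAt ρ x (const (toℕ p))))
prenexes-quant q x {φ} closed (f , f-φ) = depth (bind f) , λ N≤V →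
  let open Named (name (λ ()) (λ ()) (bind f) N≤V)
  in formula , prenex isPrenex (blocks≤ q quantifiers bounded) , free-mono (λ ()) free ,
     λ p₀ {ρ} → sound {ρ′ = λ ()} (λ ()) ⟨⇔⟩ Quant-cong q λ p → f-φ p₀ λ {y} → agree y
  where
  agree : ∀ {ρ p} y → Free φ y → p ≡ updateAt ρ x (const p) y
  agree {ρ} y φ∋y with y Fin.≟ x
  ... | yes refl = sym (updateAt-updates y ρ)
  ... | no  y≢x  = ⊥-elim (satisfies closed (Free-quant {q = q} {φ = φ} φ∋y y≢x))

prenexes-connect : ∀ o (φ ψ : Formula σ n v) {S T U : Word n → Vector ℕ v → Set} →
                   Prenexes k φ S → Prenexes k ψ T → (∀ {w ρ} → Connect o (S w ρ) (T w ρ) ⇔ U w ρ) →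
                     Prenexes k (φ ∧ ψ) U
prenexes-connect o φ ψ (M , f) (N , g) e = M ⊔ N , λ M⊔N≤V →
  let φ′ , φ-BΣ , φ-closed , φ-sat = f (≤-trans (m≤m⊔n M N) M⊔N≤V)
      ψ′ , ψ-BΣ , ψ-closed , ψ-sat = g (≤-trans (m≤n⊔m M N) M⊔N≤V)
  in connect o φ′ ψ′ , connect-BΣ o φ-BΣ ψ-BΣ , free-connect o φ-closed ψ-closed ,
     λ p₀ → sat-connect o ⟨⇔⟩ Connect-cong o (φ-sat p₀) (ψ-sat p₀) ⟨⇔⟩ e
  where
  connect-BΣ : ∀ o {V} {φ ψ : Formula _ _ V} → BΣ _ _ φ → BΣ _ _ ψ → BΣ _ _ (connect o φ ψ)
  connect-BΣ and = _∧_
  connect-BΣ or  = _∨_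
  free-connect : ∀ o {V} {φ ψ : Formula _ _ V} → Closed φ → Closed ψ → Closed (connect o φ ψ)
  free-connect and = free-∧
  free-connect or  = free-∨

prenexes-literal : ∀ s {φ : Formula σ n v} → QuantifierFree φ → Closed φ → Prenexes k φ (λ w ρ → Signed s (Sat w ρ φ))
-- One variable gives `rename` a target for the variables of φ, none of which is free.
prenexes-literal pos φ-qf closed = 1 , λ { (s≤s _) →
  rename φ-qf (const zero) , prenex (matrix (rename-quantifierFree φ-qf _)) z≤n ,
    rename-free φ-qf _ (satisfies closed) ,
  λ _ → sat-rename φ-qf _ (⊥-elim ∘ satisfies closed) }
prenexes-literal neg φ-qf closed = prenexes-literal pos (¬′ φ-qf) (free-¬ closed)

closed-left : ∀ (φ ψ : Formula σ n v) → Closed (φ ∧ ψ) → Closed φ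
closed-left φ ψ c = ⟪ satisfies c ∘ Subset.x∈p∪q⁺ ∘ inj₁ ⟫

closed-right : ∀ (φ ψ : Formula σ n v) → Closed (φ ∧ ψ) → Closed ψ
closed-right φ ψ c = ⟪ satisfies c ∘ Subset.x∈p∪q⁺ {p = freeVariables φ} ∘ inj₂ ⟫

-- Connectives above the outermost quantifiers stay outside the prefixes: their arguments may start
-- with different quantifiers, and merging these could cost one more block. `BΣ` is closed under ∧
-- and ∨, and signs take care of negation.
prenexes : ∀ s (φ : Formula σ n v) → Branches s (λ qs → alternations qs ≤ k) φ → Closed φ →
           Prenexes k φ (λ w ρ → Signed s (Sat w ρ φ))
prenexes s true            _ c = prenexes-literal s true c
prenexes s false           _ c = prenexes-literal s false c
prenexes s (x ≐ y)         _ c = prenexes-literal s (x ≐ y) c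
prenexes s (letter a x)    _ c = prenexes-literal s (letter a x) c
prenexes s (pred P P∈σ xs) _ c = prenexes-literal s (pred P P∈σ xs) c
prenexes s (¬′ φ)         bs c =
  let N , f = prenexes (opposite s) φ bs ⟪ satisfies c ⟫
  in N , λ N≤V → let ψ , ψ-BΣ , ψ-closed , e = f N≤V in ψ , ψ-BΣ , ψ-closed ,
    λ {w} p₀ {ρ} → e p₀ ⟨⇔⟩ Signed-¬ s (sat? w ρ φ)
prenexes s (φ ∧ ψ) (bs , bs′) c = prenexes-connect (signedConnective s and) φ ψ
  (prenexes s φ bs (closed-left φ ψ c)) (prenexes s ψ bs′ (closed-right φ ψ c)) λ {w} {ρ} →
    Signed-Connect s and (sat? w ρ φ)
prenexes s (φ ∨ ψ) (bs , bs′) c = prenexes-connect (signedConnective s or) φ ψ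
  (prenexes s φ bs (closed-left φ ψ ⟪ satisfies c ⟫)) (prenexes s ψ bs′ (closed-right φ ψ ⟪ satisfies c ⟫))
  λ {w} {ρ} → Signed-Connect s or (sat? w ρ φ)
prenexes s (quant q x φ)  bs c =
  let N , f = prenexes-quant (signed s q) x {φ} ⟪ satisfies c ⟫ (prefixed s φ bs (const zero))
  in N , λ N≤V → let ψ , ψ-BΣ , ψ-closed , e = f N≤V in ψ , ψ-BΣ , ψ-closed ,
     λ {w} p₀ → e p₀ ⟨⇔⟩ Signed-Quant s q (λ p → sat? w _ φ) ⟨⇔⟩ Signed-cong s (⇔-sym (sat-quant q))

sentence⇒closed : {φ : Formula σ n v} → Sentence φ → Closed φ
sentence⇒closed s = ⟪ (λ x∈ → s (_ , x∈)) ⟫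

closed⇒sentence : {φ : Formula σ n v} → Closed φ → Sentence φ
closed⇒sentence c (_ , x∈) = satisfies c x∈

abstract

  -- Being free of quantifiers, this test adds only the empty branch to a formula.
  nonempty : σ local → Formula σ n v
  nonempty {n = n} +1∈σ = ⋁ n λ a → pred (letter-min+ a 0) +1∈σ []

  nonempty-elementary : (+1∈σ : σ local) {V : Pred (Fin v) 0ℓ} → Elementary V (nonempty {σ} {n} +1∈σ)
  nonempty-elementary +1∈σ = elementary-⋁ _ λ a → elementary-pred (letter-min+ a 0) +1∈σ []

  sat-nonempty : (+1∈σ : σ local) {w : Word n} {ρ : Vector ℕ v} → Sat w ρ (nonempty {σ} +1∈σ) ⇔ Fin (length w)
  sat-nonempty {n = n} +1∈σ {w} = sat-⋁ n ⟨⇔⟩ head-letter w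
    where
    head-letter : ∀ (w : Word n) → (∃[ a ] w has a at 0) ⇔ Fin (length w)
    head-letter []      = mk⇔ (λ ()) (λ ())
    head-letter (a ∷ w) = mk⇔ (λ _ → zero) (λ _ → a , refl)

module _ {K : Language n} (k : ℕ) where

  BΣ⇒Alternating : K BelongsTo BΣ (suc k) σ → K BelongsTo Alternating (suc k) σ
  BΣ⇒Alternating (v , φ , s , φ∈BΣ , e) = v , φ , s , go φ∈BΣ , e
    where
    prenexBranches : ∀ {P qs} {φ : Formula σ n v} → Prenex qs φ → P qs → Branches pos P φ
    prenexBranches (matrix φ)     p = branches-quantifierFree p pos φ
    prenexBranches (prefix q x φ) p = prenexBranches φ p
    blocks⇒alternations : ∀ qs → blocks qs ≤ suc k → alternations qs ≤ k
    blocks⇒alternations []       _ = z≤n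
    blocks⇒alternations (q ∷ qs) b = ≤-pred b
    go : ∀ {φ : Formula σ n v} → BΣ (suc k) σ φ → Alternating (suc k) σ φ
    go (prenex {qs = qs} φ b) = prenexBranches φ (blocks⇒alternations qs b)
    go (φ ∧ ψ)                = go φ , go ψ
    go (φ ∨ ψ)                = go φ , go ψ

  -- The prenex form is correct on nonempty words only. The truth value of φ on the empty word is
  -- computed and inserted as a constant.
  Alternating⇒BΣ : σ local → K BelongsTo Alternating (suc k) σ → K BelongsTo BΣ (suc k) σ
  Alternating⇒BΣ {σ = σ} +1∈σ (v , φ , s , bs , e) with prenexes pos φ bs (sentence⇒closed s)
  ... | N , f with f {N} ≤-refl
  ... | ψ , ψ-BΣ , ψ-closed , ψ-sat = N , χ ,
    closed⇒sentence (free-∨ (free-∧ (proj₂ full) ψ-closed) (proj₂ not-full)) ,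
    (prenex (matrix (proj₁ full)) z≤n ∧ ψ-BΣ) ∨ prenex (matrix (proj₁ not-full)) z≤n , λ w → e w ⟨⇔⟩ correct w
    where
    φ[]? = sat? [] (const 0) φ
    full : Elementary (λ _ → ⊥) (Formula σ n N ∋ nonempty +1∈σ)
    full = nonempty-elementary +1∈σ
    not-full : Elementary (λ _ → ⊥) (Formula σ n N ∋ (¬′ nonempty +1∈σ ∧ ⌜ ⌊ φ[]? ⌋ ⌝))
    not-full = elementary-∧ (elementary-¬ full) (elementary-⌜⌝ ⌊ φ[]? ⌋)
    χ : Formula σ n N
    χ = (nonempty +1∈σ ∧ ψ) ∨ (¬′ nonempty +1∈σ ∧ ⌜ ⌊ φ[]? ⌋ ⌝)
    empty : ¬ ([] ⊨ (Formula σ n N ∋ nonempty +1∈σ))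
    empty t with to (sat-nonempty {σ} {n} {N} +1∈σ {[]}) t
    ... | ()
    correct : ∀ w → (w ⊨ φ) ⇔ (w ⊨ χ)
    correct []      = mk⇔ (λ s → inj₂ (empty , from (sat-⌜⌝ {b = ⌊ φ[]? ⌋}) (fromWitness s)))
                          λ { (inj₁ (t , _)) → ⊥-elim (empty t) ; (inj₂ (_ , t)) →
                            toWitness (to (sat-⌜⌝ {b = ⌊ φ[]? ⌋}) t) }
    correct (a ∷ w) = mk⇔ (λ s → inj₁ (from (sat-nonempty +1∈σ {a ∷ w}) zero , from (ψ-sat zero) s))
                          λ { (inj₁ (_ , t)) → to (ψ-sat zero) t ; (inj₂ (¬t , _)) →
                            contradiction (from (sat-nonempty +1∈σ {a ∷ w}) zero) ¬t }

-- Interpretations of words in words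

-- A position of the interpreted word is encoded by a labelled position.
record Interpretation (τ σ : Signature) (m n c : ℕ) : Set₁ where
  field
    guard    : Fin c → Fin v → Formula σ n v
    equality : (x y : Fin c × Fin v) → Formula σ n v
    labelled : Fin m → Fin c × Fin v → Formula σ n v
    numeric  : ∀ {r} (P : Predicate m r) → τ (class P) → Vec (Fin c × Fin v) r → Formula σ n v
    guard-elementary    : ∀ {V : Pred (Fin v) 0ℓ} l {x} → V x → Elementary V (guard l x)
    equality-elementary : ∀ {V : Pred (Fin v) 0ℓ} {x y} → V (proj₂ x) → V (proj₂ y) → Elementary V (equality x y)
    labelled-elementary : ∀ {V : Pred (Fin v) 0ℓ} a {x} → V (proj₂ x) → Elementary V (labelled a x)
    numeric-elementary  : ∀ {V : Pred (Fin v) 0ℓ} {r} (P : Predicate m r) P∈τ {xs} →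
                          VecAll.All (V ∘ proj₂) xs → Elementary V (numeric P P∈τ xs)

  -- Labels never become variables: below each quantifier a finite disjunction or conjunction ranges
  -- over them, and e remembers the label chosen for each variable. The map ι embeds the variables
  -- into a possibly larger set, so that translations of several formulas can be combined.
  translate : (Fin v → Fin v₁) → Vector (Fin c) v → Formula τ m v → Formula σ n v₁
  translate ι e true            = true
  translate ι e false           = false
  translate ι e (x ≐ y)         = equality (e x , ι x) (e y , ι y)
  translate ι e (letter a x)    = labelled a (e x , ι x)
  translate ι e (pred P P∈τ xs) = numeric P P∈τ (Vec.map (λ x → e x , ι x) xs)
  translate ι e (¬′ φ)          = ¬′ translate ι e φ
  translate ι e (φ ∧ ψ)         = translate ι e φ ∧ translate ι e ψ
  translate ι e (φ ∨ ψ)         = translate ι e φ ∨ translate ι e ψ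
  translate ι e (quant ∃′ x φ)  = quant ∃′ (ι x) (⋁ c λ l → guard l (ι x) ∧ translate ι (updateAt e x (const l)) φ)
  translate ι e (quant ∀′ x φ)  = quant ∀′ (ι x) (⋀ c λ l → ¬′ guard l (ι x) ∨ translate ι (updateAt e x (const l)) φ)

  module _ (ι : Fin v → Fin v₁) where

    translate-free : ∀ e (φ : Formula τ m v) {V : Pred (Fin v₁) 0ℓ} → (∀ {x} → Free φ x → V (ι x)) →
      translate ι e φ FreeIn V
    translate-free-body : ∀ q x (φ : Formula τ m v) {V : Pred (Fin v₁) 0ℓ} →
      (∀ {y} → Free (quant q x φ) y → V (ι y)) →
                          ∀ {y} → Free φ y → ι y ≢ ι x → V (ι y)
    translate-free e true            h = free-true
    translate-free e false           h = free-false
    translate-free e (x ≐ y)         h = proj₂ (equality-elementary (h (Subset.x∈p∪q⁺ (inj₁ (Subset.x∈⁅x⁆ x))))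
      (h (Subset.x∈p∪q⁺ (inj₂ (Subset.x∈⁅x⁆ y)))))
    translate-free e (letter a x)    h = proj₂ (labelled-elementary a (h (Subset.x∈⁅x⁆ x)))
    translate-free e (pred P P∈τ xs) h = proj₂
      (numeric-elementary P P∈τ (VecAll.map⁺ (Free-pred {σ = τ} {P = P} {P∈τ} xs h)))
    translate-free e (¬′ φ)          h = free-¬ (translate-free e φ h)
    translate-free e (φ ∧ ψ)         h = free-∧ (translate-free e φ (h ∘ Subset.x∈p∪q⁺ ∘ inj₁))
      (translate-free e ψ (h ∘ Subset.x∈p∪q⁺ ∘ inj₂))
    translate-free e (φ ∨ ψ)         h = free-∨ (translate-free e φ (h ∘ Subset.x∈p∪q⁺ ∘ inj₁))
      (translate-free e ψ (h ∘ Subset.x∈p∪q⁺ ∘ inj₂))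
    translate-free e (quant ∃′ x φ)  {V} h =
      free-quant (free-⋁ c λ l → free-∧ (proj₂ (guard-elementary l (λ x≢x → contradiction refl x≢x)))
      (translate-free _ φ (translate-free-body ∃′ x φ {V} h)))
    translate-free e (quant ∀′ x φ)  {V} h =
      free-quant (free-⋀ c λ l → free-∨ (free-¬ (proj₂ (guard-elementary l (λ x≢x → contradiction refl x≢x))))
      (translate-free _ φ (translate-free-body ∀′ x φ {V} h)))
    translate-free-body q x φ {V} h φ∋y ιy≢ιx = h (Free-quant {q = q} {φ = φ} φ∋y (ιy≢ιx ∘ cong ι))

    translate-branches : ∀ s e {P} → PrefixClosed P → (φ : Formula τ m v) → Branches s P φ →
      Branches s P (translate ι e φ)
    translate-branches s e closed true            p         = p
    translate-branches s e closed false           p         = p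
    translate-branches s e closed (x ≐ y)         p         = branches-quantifierFree p s
      (proj₁ (equality-elementary {V = λ _ → ⊤} tt tt))
    translate-branches s e closed (letter a x)    p         = branches-quantifierFree p s
      (proj₁ (labelled-elementary {V = λ _ → ⊤} a tt))
    translate-branches s e closed (pred P P∈τ xs) p         = branches-quantifierFree p s
      (proj₁ (numeric-elementary {V = λ _ → ⊤} P P∈τ (VecAll.universal _ _)))
    translate-branches s e closed (¬′ φ)          ps        = translate-branches (opposite s) e closed φ ps
    translate-branches s e closed (φ ∧ ψ)         (ps , qs) = translate-branches s e closed φ ps ,
      translate-branches s e closed ψ qs
    translate-branches s e closed (φ ∨ ψ)         (ps , qs) = translate-branches s e closed φ ps ,
      translate-branches s e closed ψ qs
    translate-branches s e closed (quant ∃′ x φ)  ps        =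
      branches-⋁ p s c {λ l → guard l (ι x) ∧ translate ι (updateAt e x (const l)) φ} λ l →
        branches-quantifierFree p s (proj₁ (guard-elementary {V = λ _ → ⊤} l tt)) ,
          translate-branches s (updateAt e x (const l)) closed′ φ ps
      where
      closed′ = λ qs {rs} → closed (signed s ∃′ ∷ qs) {rs}
      p = branches⇒[] s φ closed′ ps
    translate-branches s e closed (quant ∀′ x φ)  ps        =
      branches-⋀ p s c {λ l → ¬′ guard l (ι x) ∨ translate ι (updateAt e x (const l)) φ} λ l →
        branches-quantifierFree p (opposite s) (proj₁ (guard-elementary {V = λ _ → ⊤} l tt)) ,
          translate-branches s (updateAt e x (const l)) closed′ φ ps
      where
      closed′ = λ qs {rs} → closed (signed s ∀′ ∷ qs) {rs}
      p = branches⇒[] s φ closed′ ps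

-- An interpretation may be sound for some predicates only: the blow-up below needs moduli that
-- divide the length of the images.
Predicates : Pred Class 0ℓ → Pred (Formula σ n v) 0ℓ
Predicates G (pred P _ _)  = G (class P)
Predicates G (¬′ φ)        = Predicates G φ
Predicates G (φ ∧ ψ)       = Predicates G φ × Predicates G ψ
Predicates G (φ ∨ ψ)       = Predicates G φ × Predicates G ψ
Predicates G (quant _ _ φ) = Predicates G φ
Predicates G _             = ⊤

-- In Encodes l p p′, position p with label l stands for position p′ of the
-- interpreted word w′.
record Interprets (I : Interpretation τ σ m n c) (G : Pred Class 0ℓ) (w : Word n) (w′ : Word m) : Set₁ where
  open Interpretation I
  field
    Encodes : Fin c → ℕ → ℕ → Set
    decode : ∀ {ρ : Vector ℕ v} {x l} (p : Fin (length w)) → ρ x ≡ toℕ p → Sat w ρ (guard l x) →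
             Σ[ p′ ∈ Fin (length w′) ] Encodes l (toℕ p) (toℕ p′)
    encode : (p′ : Fin (length w′)) → Σ[ l ∈ Fin c ] Σ[ p ∈ Fin (length w) ]
             Encodes l (toℕ p) (toℕ p′) × (∀ {v} {ρ : Vector ℕ v} {x} → ρ x ≡ toℕ p → Sat w ρ (guard l x))
    sat-equality : ∀ {ρ : Vector ℕ v} {l x k y p q} → Encodes l (ρ x) p → Encodes k (ρ y) q →
                   Sat w ρ (equality (l , x) (k , y)) ⇔ p ≡ q
    sat-labelled : ∀ {ρ : Vector ℕ v} {a l x p} → Encodes l (ρ x) p → Sat w ρ (labelled a (l , x)) ⇔ w′ has a at p
    sat-numeric  : ∀ {ρ : Vector ℕ v} {r} (P : Predicate m r) P∈τ {xs ps} → G (class P) →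
                   Pointwise (λ (l , x) → Encodes l (ρ x)) xs ps → Sat w ρ (numeric P P∈τ xs) ⇔ Holds w′ P ps

  module _ (ι : Fin v → Fin v₁) (ι-injective : ∀ {x y} → ι x ≡ ι y → x ≡ y) where

    private
      Agree : (Fin v → Set) → Vector (Fin c) v → Vector ℕ v₁ → Vector ℕ v → Set
      Agree V e ρ ρ′ = ∀ {x} → V x → Encodes (e x) (ρ (ι x)) (ρ′ x)

      agree-update : ∀ q {φ : Formula τ m v} {e ρ ρ′ x l p p′} → Agree (Free (quant q x φ)) e ρ ρ′ → Encodes l p p′ →
                     Agree (Free φ) (updateAt e x (const l)) (updateAt ρ (ι x) (const p)) (updateAt ρ′ x (const p′))
      agree-update q {φ} {e} {ρ} {ρ′} {x} {l} {p} {p′} agree enc {y} φ∋y with y Fin.≟ x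
      ... | yes refl = subst₂ (λ l p → Encodes l p _) (sym (updateAt-updates y e)) (sym (updateAt-updates (ι y) ρ))
                         (subst (Encodes l p) (sym (updateAt-updates y ρ′)) enc)
      ... | no y≢x = subst₂ (λ l p → Encodes l p _) (sym (updateAt-minimal y x e y≢x))
        (sym (updateAt-minimal (ι y) (ι x) ρ (y≢x ∘ ι-injective)))
                       (subst (Encodes _ _) (sym (updateAt-minimal y x ρ′ y≢x))
                         (agree (Free-quant {q = q} {φ = φ} φ∋y y≢x)))

      pointwise : ∀ {e ρ ρ′ r} {xs : Vec (Fin v) r} → VecAll.All (λ x → Encodes (e x) (ρ (ι x)) (ρ′ x)) xs →
                  Pointwise (λ (l , x) → Encodes l (ρ x)) (Vec.map (λ x → e x , ι x) xs) (Vec.map ρ′ xs)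
      pointwise []         = []
      pointwise (enc ∷ es) = enc ∷ pointwise es

    sat-translate : ∀ e {ρ ρ′} (φ : Formula τ m v) → Predicates G φ → Agree (Free φ) e ρ ρ′ →
                    Sat w ρ (translate ι e φ) ⇔ Sat w′ ρ′ φ
    sat-translate e true            g h = ⇔-id _
    sat-translate e false           g h = ⇔-id _
    sat-translate e (x ≐ y)         g h = sat-equality (h (Subset.x∈p∪q⁺ (inj₁ (Subset.x∈⁅x⁆ x))))
      (h (Subset.x∈p∪q⁺ (inj₂ (Subset.x∈⁅x⁆ y))))
    sat-translate e (letter a x)    g h = sat-labelled (h (Subset.x∈⁅x⁆ x))
    sat-translate e {ρ} {ρ′} (pred P P∈τ xs) g h =
      sat-numeric P P∈τ g (pointwise {e} {ρ} {ρ′}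
        (Free-pred {σ = τ} {P = P} {P∈τ} {λ x → Encodes (e x) (ρ (ι x)) (ρ′ x)} xs h))
    sat-translate e (¬′ φ)          g h = ¬-cong-⇔ (sat-translate e φ g h)
    sat-translate e (φ ∧ ψ)   (g , g′) h = sat-translate e φ g (h ∘ Subset.x∈p∪q⁺ ∘ inj₁) ×-⇔ sat-translate e ψ g′
      (h ∘ Subset.x∈p∪q⁺ ∘ inj₂)
    sat-translate e (φ ∨ ψ)   (g , g′) h = sat-translate e φ g (h ∘ Subset.x∈p∪q⁺ ∘ inj₁) ⊎-⇔ sat-translate e ψ g′
      (h ∘ Subset.x∈p∪q⁺ ∘ inj₂)
    sat-translate e {ρ} {ρ′} (quant ∃′ x φ) g h = mk⇔ forth back
      where
      forth : _ → _
      forth (p , s) with to (sat-⋁ c) s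
      ... | l , s₁ , s₂ with decode p (updateAt-updates (ι x) ρ) s₁
      ... | p′ , enc = p′ , to (sat-translate _ φ g (agree-update ∃′ {φ} {e} {ρ} {ρ′} h enc)) s₂
      back : _ → _
      back (p′ , s) with encode p′
      ... | l , p , enc , s₁ = p , from (sat-⋁ c) (l , s₁ (updateAt-updates (ι x) ρ) ,
        from (sat-translate _ φ g (agree-update ∃′ {φ} {e} {ρ} {ρ′} h enc)) s)
    sat-translate e {ρ} {ρ′} (quant ∀′ x φ) g h = mk⇔ forth back
      where
      forth : _ → _
      forth s p′ with encode p′
      ... | l , p , enc , s₁ with to (sat-⋀ c) (s p) l
      ... | inj₁ ¬s = contradiction (s₁ (updateAt-updates (ι x) ρ)) ¬s
      ... | inj₂ s₂ = to (sat-translate _ φ g (agree-update ∀′ {φ} {e} {ρ} {ρ′} h enc)) s₂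
      back : _ → _
      back s p = from (sat-⋀ c) λ l → case sat? w (updateAt ρ (ι x) (const (toℕ p))) (guard l (ι x)) of λ
        { (no ¬s) → inj₁ ¬s
        ; (yes s₁) → let p′ , enc = decode p (updateAt-updates (ι x) ρ) s₁
                     in inj₂ (from (sat-translate _ φ g (agree-update ∀′ {φ} {e} {ρ} {ρ′} h enc)) (s p′)) }

-- Letters and factors of words, and looking at them by local predicates

infixl 9 _!!_
_!!_ : List A → ℕ → Maybe A
w !! k = head (drop k w)

!!-++ˡ : ∀ (u : List A) {w k} → k < length u → (u ++ w) !! k ≡ u !! k
!!-++ˡ (a ∷ u) {k = zero}  _         = refl
!!-++ˡ (a ∷ u) {k = suc k} (s≤s k<u) = !!-++ˡ u k<u

!!-++ʳ : ∀ (u : List A) {w} k → (u ++ w) !! (length u + k) ≡ w !! k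
!!-++ʳ []      k = refl
!!-++ʳ (a ∷ u) k = !!-++ʳ u k

!!-drop : ∀ p (w : List A) j → drop p w !! j ≡ w !! (p + j)
!!-drop p w j = cong head (drop-drop p j w)

!!-prefix : ∀ (u : List A) {w w′} k → (∀ {j} → j ≤ k → w !! j ≡ w′ !! j) → (u ++ w) !! k ≡ (u ++ w′) !! k
!!-prefix []      k       h = h ≤-refl
!!-prefix (a ∷ u) zero    h = refl
!!-prefix (a ∷ u) (suc k) h = !!-prefix u k (h ∘ m≤n⇒m≤1+n)

drop-++ : ∀ (u : List A) {w} → drop (length u) (u ++ w) ≡ w
drop-++ []      = refl
drop-++ (a ∷ u) = drop-++ u

take-++ : ∀ (u : List A) {w} → take (length u) (u ++ w) ≡ u
take-++ []      = refl
take-++ (a ∷ u) = cong (a ∷_) (take-++ u)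

take-drop-take : ∀ s m (w : List A) → take s (drop m (take (m + s) w)) ≡ take s (drop m w)
take-drop-take zero    m       w       = refl
take-drop-take (suc s) m       []      = cong (λ w → take (suc s) (drop m w)) (List.take-[] (m + suc s))
take-drop-take (suc s) zero    (a ∷ w) = cong (a ∷_) (take-drop-take s zero w)
take-drop-take (suc s) (suc m) (a ∷ w) = take-drop-take (suc s) m w

infix 4 _≟ʷ_ _≟ᵐ_

_≟ʷ_ : (u w : Word n) → Dec (u ≡ w)
_≟ʷ_ = List.≡-dec Fin._≟_

_≟ᵐ_ : (a b : Maybe (Fin n)) → Dec (a ≡ b)
_≟ᵐ_ = Maybe.≡-dec Fin._≟_

⌊⌋-sound : {A? : Dec A} → T ⌊ A? ⌋ ⇔ A
⌊⌋-sound = mk⇔ toWitness fromWitness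

-- If read a j says that letter j of z is a, then look read K q P says that P
-- holds of the letters q, …, q + K − 1 of z, or of those that exist.
look : (Fin n → ℕ → Formula σ n v) → ℕ → ℕ → (Word n → Bool) → Formula σ n v
look read zero    q P = ⌜ P [] ⌝
look read (suc K) q P = (⋁ _ λ a → read a q ∧ look read K (suc q) (P ∘ (a ∷_))) ∨ (¬′ (⋁ _ λ a → read a q) ∧ ⌜ P [] ⌝)

look-elementary : {read : Fin n → ℕ → Formula σ n v} {V : Pred (Fin v) 0ℓ} → (∀ a j → Elementary V (read a j)) →
                  ∀ K q P → Elementary V (look read K q P)
look-elementary h zero    q P = elementary-⌜⌝ (P [])
look-elementary h (suc K) q P = elementary-∨ (elementary-⋁ _ λ a →
  elementary-∧ (h a q) (look-elementary h K (suc q) (P ∘ (a ∷_))))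
                                             (elementary-∧ (elementary-¬ (elementary-⋁ _ λ a → h a q))
                                               (elementary-⌜⌝ (P [])))

sat-look : {read : Fin n → ℕ → Formula σ n v} {w : Word n} {ρ : Vector ℕ v} (z : Word n) →
           (∀ a j → Sat w ρ (read a j) ⇔ z has a at j) →
           ∀ K q P → Sat w ρ (look read K q P) ⇔ T (P (take K (drop q z)))
sat-look z h zero    q P = sat-⌜⌝ {b = P []}
sat-look z h (suc K) q P =
  ((sat-⋁ _ ⟨⇔⟩ ∃-cong λ a → h a q ×-⇔ sat-look z h K (suc q) (P ∘ (a ∷_)))
    ⊎-⇔ (¬-cong-⇔ (sat-⋁ _ ⟨⇔⟩ ∃-cong λ a → h a q) ×-⇔ sat-⌜⌝ {b = P []}))
  ⟨⇔⟩ cases (drop q z) (trans (cong (λ k → drop k z) (+-comm 1 q)) (sym (drop-drop q 1 z)))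
  where
  cases : ∀ u → drop (suc q) z ≡ drop 1 u →
          ((∃[ a ] head u ≡ just a × T (P (a ∷ take K (drop (suc q) z)))) ⊎ (¬ (∃[ a ] head u ≡ just a) × T (P [])))
            ⇔ T (P (take (suc K) u))
  cases []      e = mk⇔ (λ { (inj₁ (_ , () , _)) ; (inj₂ (_ , t)) → t }) (λ t → inj₂ ((λ ()) , t))
  cases (a ∷ u) e = mk⇔ (λ { (inj₁ (_ , refl , t)) → subst (λ u → T (P (a ∷ take K u))) e t ; (inj₂ (¬a , _)) →
    contradiction (a , refl) ¬a })
                        (λ t → inj₁ (a , refl , subst (λ u → T (P (a ∷ take K u))) (sym e) t))

module _ (+1∈σ : σ local) where

  abstract
    lookFrom : Fin v → ℕ → (Word n → Bool) → Formula σ n v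
    lookFrom x K = look (λ a j → pred (letter-x+ a j) +1∈σ (x ∷ [])) K 0

    lookMin lookMax : ℕ → (Word n → Bool) → Formula σ n v
    lookMin K = look (λ a j → pred (letter-min+ a j) +1∈σ []) K 0
    lookMax K = look (λ a j → pred (letter-max- a j) +1∈σ []) K 0

    sat-lookFrom : ∀ {w : Word n} {ρ : Vector ℕ v} x K P → Sat w ρ (lookFrom x K P) ⇔ T (P (take K (drop (ρ x) w)))
    sat-lookFrom {w = w} {ρ} x K P = sat-look _
      (λ a j → ⇔-reflexive (cong (_≡ just a) (sym (!!-drop (ρ x) w j)))) K 0 P

    sat-lookMin : ∀ {w : Word n} {ρ : Vector ℕ v} K P → Sat w ρ (lookMin K P) ⇔ T (P (take K w))
    sat-lookMin {w = w} K P = sat-look w (λ a j → ⇔-id _) K 0 P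

    sat-lookMax : ∀ {w : Word n} {ρ : Vector ℕ v} K P → Sat w ρ (lookMax K P) ⇔ T (P (take K (reverse w)))
    sat-lookMax K P = sat-look _ (λ a j → ⇔-id _) K 0 P

    lookFrom-elementary : ∀ {V : Pred (Fin v) 0ℓ} {x} K (P : Word n → Bool) → V x → Elementary V (lookFrom x K P)
    lookFrom-elementary K P Vx = look-elementary (λ a j → elementary-pred (letter-x+ a j) +1∈σ (Vx ∷ [])) K 0 P

    lookMin-elementary : ∀ {V : Pred (Fin v) 0ℓ} K (P : Word n → Bool) → Elementary V (lookMin K P)
    lookMin-elementary K = look-elementary (λ a j → elementary-pred (letter-min+ a j) +1∈σ []) K 0

    lookMax-elementary : ∀ {V : Pred (Fin v) 0ℓ} K (P : Word n → Bool) → Elementary V (lookMax K P)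
    lookMax-elementary K = look-elementary (λ a j → elementary-pred (letter-max- a j) +1∈σ []) K 0

-- Uniform substitutions

module _ {d : ℕ} (g : A → List B) (uniform : ∀ a → length (g a) ≡ d) where

  length-expand : ∀ W → length (concatMap g W) ≡ length W * d
  length-expand []      = refl
  length-expand (a ∷ W) = trans (length-++ (g a)) (cong₂ _+_ (uniform a) (length-expand W))

  drop-expand : ∀ {r} i W → i ≤ length W → drop (i * d) (concatMap g W ++ r) ≡ concatMap g (drop i W) ++ r
  drop-expand zero    W       _         = refl
  drop-expand {r} (suc i) (a ∷ W) (s≤s i≤W) = begin
    drop (d + i * d) ((g a ++ concatMap g W) ++ r)          ≡⟨ cong (drop (d + i * d)) (++-assoc (g a) _ r) ⟩
    drop (d + i * d) (g a ++ (concatMap g W ++ r))          ≡⟨ sym (drop-drop d (i * d) _) ⟩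
    drop (i * d) (drop d (g a ++ (concatMap g W ++ r)))     ≡⟨ cong (λ d → drop (i * _) (drop d _))
      (sym (uniform a)) ⟩
    drop (i * d) (drop (length (g a)) (g a ++ (concatMap g W ++ r))) ≡⟨ cong (drop (i * d)) (drop-++ (g a)) ⟩
    drop (i * d) (concatMap g W ++ r)                       ≡⟨ drop-expand i W i≤W ⟩
    concatMap g (drop i W) ++ r                             ∎
    where open ≡-Reasoning

  !!-expand : ∀ {r k} K W → k < K * d → (concatMap g W ++ r) !! k ≡ (concatMap g (take K W) ++ r) !! k
  !!-expand zero    W       ()
  !!-expand (suc K) []      _ = refl
  !!-expand {r} {k} (suc K) (a ∷ W) k<
    rewrite ++-assoc (g a) (concatMap g W) r | ++-assoc (g a) (concatMap g (take K W)) r with k <? length (g a)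
  ... | yes k<g = trans (!!-++ˡ (g a) k<g) (sym (!!-++ˡ (g a) k<g))
  ... | no  k≮g = subst (λ k → (g a ++ concatMap g W ++ r) !! k ≡ (g a ++ concatMap g (take K W) ++ r) !! k) k≡
                    (trans (!!-++ʳ (g a) _) (trans (!!-expand K W k′<) (sym (!!-++ʳ (g a) _))))
    where
    k≡ : length (g a) + (k ∸ length (g a)) ≡ k
    k≡ = m+[n∸m]≡n (≮⇒≥ k≮g)
    k′< : k ∸ length (g a) < K * d
    k′< = +-cancelˡ-< (length (g a)) _ _ (subst₂ _<_ (sym k≡) (cong (_+ K * d) (sym (uniform a))) k<)

  reverse-expand : ∀ W → reverse (concatMap g W) ≡ concatMap (reverse ∘ g) (reverse W)
  reverse-expand []      = refl
  reverse-expand (a ∷ W) = begin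
    reverse (g a ++ concatMap g W)                              ≡⟨ reverse-++ (g a) _ ⟩
    reverse (concatMap g W) ++ reverse (g a)                    ≡⟨ cong₂ _++_ (reverse-expand W)
      (sym (++-identityʳ _)) ⟩
    concatMap (reverse ∘ g) (reverse W) ++ concatMap (reverse ∘ g) (a ∷ []) ≡⟨ sym
      (List.concatMap-++ (reverse ∘ g) (reverse W) (a ∷ [])) ⟩
    concatMap (reverse ∘ g) (reverse W List.∷ʳ a)               ≡⟨ cong (concatMap (reverse ∘ g))
      (sym (unfold-reverse a W)) ⟩
    concatMap (reverse ∘ g) (reverse (a ∷ W))                   ∎
    where open ≡-Reasoning

  -- The images are aligned at multiples of d, and r is too short to contain another one.
  read-expand : (∀ {a b} → g a ≡ g b → a ≡ b) → ∀ {r} → length r < d → ∀ W j b →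
                (take d (drop (j * d) (concatMap g W ++ r)) ≡ g b) ⇔ (W !! j ≡ just b)
  read-expand g-injective {r} r<d [] j b =
    mk⇔ (λ e → contradiction (subst (_≤ length r) (trans (cong length e) (uniform b)) short) (<⇒≱ r<d))
                                              (λ e → case subst (λ W → head W ≡ just b) (List.drop-[] j) e of λ ())
    where
    short : length (take d (drop (j * d) r)) ≤ length r
    short = ≤-trans (≤-reflexive (List.length-take d _))
      (≤-trans (m⊓n≤n d _) (≤-trans (≤-reflexive (List.length-drop (j * d) r)) (m∸n≤m (length r) (j * d))))
  read-expand g-injective {r} r<d (a ∷ W) zero b = mk⇔ (λ e → cong just (g-injective (trans (sym first) e)))
    (λ { refl → first })
    where
    first : take d ((g a ++ concatMap g W) ++ r) ≡ g a
    first = trans (cong₂ take (sym (uniform a)) (++-assoc (g a) _ r)) (take-++ (g a))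
  read-expand g-injective {r} r<d (a ∷ W) (suc j) b = ⇔-reflexive (cong (λ z → take d z ≡ g b) rest) ⟨⇔⟩ read-expand
    g-injective r<d W j b
    where
    rest : drop (d + j * d) ((g a ++ concatMap g W) ++ r) ≡ drop (j * d) (concatMap g W ++ r)
    rest = trans (cong (drop (d + j * d)) (++-assoc (g a) _ r)) (trans (sym (drop-drop d (j * d) _))
             (cong (drop (j * d)) (trans (cong (λ k → drop k (g a ++ concatMap g W ++ r)) (sym (uniform a)))
               (drop-++ (g a)))))

-- The two interpretations: blown-up images and blocks

order∈ : [<,+1] order
order∈ = inj₁ refl

local∈ : [<,+1] local
local∈ = inj₂ refl

ModuliDivide : ℕ → Pred Class 0ℓ
ModuliDivide d order       = ⊤
ModuliDivide d local       = ⊤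
ModuliDivide d (modular δ) = δ ∣ d

*d+-%  : ∀ {d δ} .{{_ : NonZero δ}} → δ ∣ d → ∀ p o → (p * d + o) % δ ≡ o % δ
*d+-% {δ = δ} (divides e refl) p o = trans (cong (_% δ) (trans (+-comm _ o) (cong (o +_) (sym (*-assoc p e δ)))))
  ([m+kn]%n≡m%n o (p * e) δ)

-- The word concatMap g W ++ r interpreted in W.  Position o of the image of
-- position p of W is encoded by p with label o; as labels from d on, the
-- positions of r are encoded by every position of W.
module BlowUp {N n d : ℕ} (g : Fin N → Word n) (uniform : ∀ b → length (g b) ≡ d) (1≤d : 1 ≤ d) (r : Word n) where

  image : Word N → Word n
  image W = concatMap g W ++ r

  Label : Set
  Label = Fin d ⊎ Fin (length r)

  equality′ : Label → Fin v → Label → Fin v → Formula [<,+1] N v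
  equality′ (inj₁ o) x (inj₁ p) y = x ≐ y ∧ ⌜ ⌊ toℕ o ≟ toℕ p ⌋ ⌝
  equality′ (inj₁ o) x (inj₂ p) y = false
  equality′ (inj₂ o) x (inj₁ p) y = false
  equality′ (inj₂ o) x (inj₂ p) y = ⌜ ⌊ toℕ o ≟ toℕ p ⌋ ⌝

  less′ : Label → Fin v → Label → Fin v → Formula [<,+1] N v
  less′ (inj₁ o) x (inj₁ p) y = pred less order∈ (x ∷ y ∷ []) ∨ x ≐ y ∧ ⌜ ⌊ toℕ o <? toℕ p ⌋ ⌝
  less′ (inj₁ o) x (inj₂ p) y = true
  less′ (inj₂ o) x (inj₁ p) y = false
  less′ (inj₂ o) x (inj₂ p) y = ⌜ ⌊ toℕ o <? toℕ p ⌋ ⌝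

  letter′ : Fin n → ℕ → Label → Fin v → Formula [<,+1] N v
  -- Images are nonempty, so o + j + 1 letters of W from x on determine the letter at distance o +
  -- j.
  letter′ a j (inj₁ o) x = lookFrom local∈ x (suc (toℕ o + j)) λ W → ⌊ image W !! (toℕ o + j) ≟ᵐ just a ⌋
  letter′ a j (inj₂ o) x = ⌜ ⌊ r !! (toℕ o + j) ≟ᵐ just a ⌋ ⌝

  residue : (δ : ℕ) → Fin δ → ℕ → Bool
  residue δ i p = ⌊ _%_ p δ {{Fin.nonZeroIndex i}} ≟ toℕ i ⌋

  mod′ : (δ : ℕ) → Fin δ → Label → Formula [<,+1] N v
  mod′ δ i (inj₁ o) = ⌜ residue δ i (toℕ o) ⌝
  mod′ δ i (inj₂ o) = ⌜ residue δ i (toℕ o) ⌝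

  reversed : Word N → Word n
  reversed W = reverse r ++ concatMap (reverse ∘ g) W

  numeric′ : ∀ {k} (P : Predicate n k) → Vec (Fin (d + length r) × Fin v) k → Formula [<,+1] N v
  numeric′ less              ((l , x) ∷ (k , y) ∷ []) = less′ (Fin.splitAt d l) x (Fin.splitAt d k) y
  numeric′ (letter-x+ a j)   ((l , x) ∷ [])           = letter′ a j (Fin.splitAt d l) x
  numeric′ (letter-min+ a j) []                       = lookMin local∈ (suc j) λ W → ⌊ image W !! j ≟ᵐ just a ⌋
  numeric′ (letter-max- a j) []                       = lookMax local∈ (suc j) λ W → ⌊ reversed W !! j ≟ᵐ just a ⌋
  numeric′ (MOD- δ i)        ((l , x) ∷ [])           = mod′ δ i (Fin.splitAt d l)
  numeric′ (D- δ i)          []                       = ⌜ residue δ i (length r) ⌝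

  module _ {V : Pred (Fin v) 0ℓ} where

    elementary-equality′ : ∀ l {x} k {y} → V x → V y → Elementary V (equality′ l x k y)
    elementary-equality′ (inj₁ o) (inj₁ p) Vx Vy = elementary-∧ (elementary-≐ Vx Vy) (elementary-⌜⌝ _)
    elementary-equality′ (inj₁ o) (inj₂ p) Vx Vy = elementary-⌜⌝ Bool.false
    elementary-equality′ (inj₂ o) (inj₁ p) Vx Vy = elementary-⌜⌝ Bool.false
    elementary-equality′ (inj₂ o) (inj₂ p) Vx Vy = elementary-⌜⌝ _

    elementary-less′ : ∀ l {x} k {y} → V x → V y → Elementary V (less′ l x k y)
    elementary-less′ (inj₁ o) (inj₁ p) Vx Vy =
      elementary-∨ (elementary-pred less order∈ (Vx ∷ Vy ∷ [])) (elementary-∧ (elementary-≐ Vx Vy) (elementary-⌜⌝ _))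
    elementary-less′ (inj₁ o) (inj₂ p) Vx Vy = elementary-⌜⌝ Bool.true
    elementary-less′ (inj₂ o) (inj₁ p) Vx Vy = elementary-⌜⌝ Bool.false
    elementary-less′ (inj₂ o) (inj₂ p) Vx Vy = elementary-⌜⌝ _

    elementary-letter′ : ∀ a j l {x} → V x → Elementary V (letter′ a j l x)
    elementary-letter′ a j (inj₁ o) Vx = lookFrom-elementary _ _ _ Vx
    elementary-letter′ a j (inj₂ o) Vx = elementary-⌜⌝ _

    elementary-numeric′ : ∀ {k} (P : Predicate n k) {xs : Vec (Fin (d + length r) × Fin v) k} →
                          VecAll.All (V ∘ proj₂) xs → Elementary V (numeric′ P xs)
    elementary-numeric′ less              {(l , x) ∷ (k , y) ∷ []} (Vx ∷ Vy ∷ []) = elementary-less′ (Fin.splitAt d l)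
      (Fin.splitAt d k) Vx Vy
    elementary-numeric′ (letter-x+ a j)   {(l , x) ∷ []} (Vx ∷ []) = elementary-letter′ a j (Fin.splitAt d l) Vx
    elementary-numeric′ (letter-min+ a j) {[]}           []        = lookMin-elementary _ _ _
    elementary-numeric′ (letter-max- a j) {[]}           []        = lookMax-elementary _ _ _
    elementary-numeric′ (MOD- δ i)        {(l , x) ∷ []} (Vx ∷ [])  with Fin.splitAt d l
    ... | inj₁ o = elementary-⌜⌝ _
    ... | inj₂ o = elementary-⌜⌝ _
    elementary-numeric′ (D- δ i)          {[]}           []        = elementary-⌜⌝ _

  interpretation : Interpretation Reg [<,+1] n N (d + length r)
  interpretation = record
    { guard    = λ _ _ → true
    ; equality = λ (l , x) (k , y) → equality′ (Fin.splitAt d l) x (Fin.splitAt d k) y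
    ; labelled = λ a (l , x) → letter′ a 0 (Fin.splitAt d l) x
    ; numeric  = λ P _ → numeric′ P
    ; guard-elementary    = λ _ _ → elementary-⌜⌝ Bool.true
    ; equality-elementary = λ {_} {_} {(l , _)} {(k , _)} → elementary-equality′ (Fin.splitAt d l) (Fin.splitAt d k)
    ; labelled-elementary = λ a {(l , _)} → elementary-letter′ a 0 (Fin.splitAt d l)
    ; numeric-elementary  = λ P _ → elementary-numeric′ P
    }

  module _ (W : Word N) (p₀ : Fin (length W)) where

    Encodes′ : Label → ℕ → ℕ → Set
    Encodes′ (inj₁ o) p p′ = p < length W × p′ ≡ p * d + toℕ o
    Encodes′ (inj₂ o) p p′ = p′ ≡ length W * d + toℕ o

    length-image : length (image W) ≡ length W * d + length r
    length-image = trans (length-++ (concatMap g W)) (cong (_+ length r) (length-expand g uniform W))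

    private
      block-<-block : ∀ {p q} (o : Fin d) {o′} → p < q → p * d + toℕ o < q * d + o′
      block-<-block {p} {q} o {o′} p<q = begin-strict
        p * d + toℕ o <⟨ +-monoʳ-< (p * d) (toℕ<n o) ⟩
        p * d + d     ≡⟨ +-comm (p * d) d ⟩
        suc p * d     ≤⟨ *-monoˡ-≤ d p<q ⟩
        q * d         ≤⟨ m≤m+n _ _ ⟩
        q * d + o′    ∎
        where open ≤-Reasoning

      same-block : ∀ {p q} (o o′ : Fin d) → p * d + toℕ o ≡ q * d + toℕ o′ → p ≡ q
      same-block {p} {q} o o′ e with <-cmp p q
      ... | tri< p<q _ _ = contradiction e (<⇒≢ (block-<-block o p<q))
      ... | tri≈ _ p≡q _ = p≡q
      ... | tri> _ _ q<p = contradiction (sym e) (<⇒≢ (block-<-block o′ q<p))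

    sat-equality′ : ∀ {ρ : Vector ℕ v} l {x} k {y p q} → Encodes′ l (ρ x) p → Encodes′ k (ρ y) q →
                    Sat W ρ (equality′ l x k y) ⇔ p ≡ q
    sat-equality′ {ρ = ρ} (inj₁ o) {x} (inj₁ o′) (_ , refl) (_ , refl) = mk⇔
      (λ (x≡y , t) → cong₂ (λ p o → p * d + o) x≡y (toWitness (to (sat-⌜⌝ {b = ⌊ toℕ o ≟ toℕ o′ ⌋}) t)))
      (λ e → let x≡y = same-block o o′ e in x≡y , from (sat-⌜⌝ {b = ⌊ toℕ o ≟ toℕ o′ ⌋}) (fromWitness
        (+-cancelˡ-≡ (ρ x * d) _ _ (trans e (cong (λ p → p * d + toℕ o′) (sym x≡y))))))
    sat-equality′ (inj₁ o) (inj₂ o′) (p< , refl) refl = mk⇔ (λ ()) (λ e → contradiction e (<⇒≢ (block-<-block o p<)))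
    sat-equality′ (inj₂ o) (inj₁ o′) refl (q< , refl) =
      mk⇔ (λ ()) (λ e → contradiction (sym e) (<⇒≢ (block-<-block o′ q<)))
    sat-equality′ (inj₂ o) (inj₂ o′) refl refl = sat-⌜⌝ {b = ⌊ toℕ o ≟ toℕ o′ ⌋} ⟨⇔⟩ ⌊⌋-sound
      ⟨⇔⟩ mk⇔ (cong (length W * d +_)) (+-cancelˡ-≡ (length W * d) _ _)

    sat-less′ : ∀ {ρ : Vector ℕ v} l {x} k {y p q} → Encodes′ l (ρ x) p → Encodes′ k (ρ y) q →
                Sat W ρ (less′ l x k y) ⇔ p < q
    sat-less′ {ρ = ρ} (inj₁ o) {x} (inj₁ o′) {y} (_ , refl) (_ , refl) = mk⇔ forth back
      where
      forth : _ → _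
      forth (inj₁ x<y)       = block-<-block o x<y
      forth (inj₂ (x≡y , t)) = subst (λ q → ρ x * d + toℕ o < q * d + toℕ o′) x≡y
        (+-monoʳ-< (ρ x * d) (toWitness (to (sat-⌜⌝ {b = ⌊ toℕ o <? toℕ o′ ⌋}) t)))
      back : _ → _
      back lt with <-cmp (ρ x) (ρ y)
      ... | tri< x<y _ _ = inj₁ x<y
      ... | tri≈ _ x≡y _ = inj₂ (x≡y , from (sat-⌜⌝ {b = ⌊ toℕ o <? toℕ o′ ⌋}) (fromWitness
        (+-cancelˡ-< (ρ y * d) _ _ (subst (λ p → p * d + toℕ o < ρ y * d + toℕ o′) x≡y lt))))
      ... | tri> _ _ y<x = contradiction (block-<-block o′ y<x) (<-asym lt)
    sat-less′ (inj₁ o) (inj₂ o′) (p< , refl) refl = mk⇔ (λ _ → block-<-block o p<) (λ _ → tt)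
    sat-less′ (inj₂ o) (inj₁ o′) refl (q< , refl) =
      mk⇔ (λ ()) (λ lt → contradiction (block-<-block o′ q<) (<-asym lt))
    sat-less′ (inj₂ o) (inj₂ o′) refl refl = sat-⌜⌝ {b = ⌊ toℕ o <? toℕ o′ ⌋} ⟨⇔⟩ ⌊⌋-sound
      ⟨⇔⟩ mk⇔ (+-monoʳ-< (length W * d)) (+-cancelˡ-< (length W * d) _ _)

    private
      enough : ∀ k → k < suc k * d
      enough k = ≤-trans (≤-reflexive (sym (*-identityʳ (suc k)))) (*-monoʳ-≤ (suc k) 1≤d)

      image-take : ∀ k W → image W !! k ≡ image (take (suc k) W) !! k
      image-take k W = !!-expand g uniform (suc k) W (enough k)

    sat-letter′ : ∀ {ρ : Vector ℕ v} a j l {x p} → Encodes′ l (ρ x) p →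
      Sat W ρ (letter′ a j l x) ⇔ image W has a at (p + j)
    sat-letter′ {ρ = ρ} a j (inj₁ o) {x} (x<W , refl) =
      sat-lookFrom local∈ {w = W} {ρ = ρ} x (suc (toℕ o + j)) (λ W → ⌊ image W !! (toℕ o + j) ≟ᵐ just a ⌋)
        ⟨⇔⟩ ⌊⌋-sound ⟨⇔⟩ ⇔-reflexive (cong (_≡ just a) (begin
        image (take (suc (toℕ o + j)) (drop (ρ x) W)) !! (toℕ o + j) ≡⟨ sym (image-take (toℕ o + j) (drop (ρ x) W)) ⟩
        image (drop (ρ x) W) !! (toℕ o + j)                        ≡⟨ cong (_!! (toℕ o + j))
          (sym (drop-expand g uniform (ρ x) W (<⇒≤ x<W))) ⟩
        drop (ρ x * d) (image W) !! (toℕ o + j)                    ≡⟨ !!-drop (ρ x * d) (image W) _ ⟩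
        image W !! (ρ x * d + (toℕ o + j))                         ≡⟨ cong (image W !!_)
          (sym (+-assoc (ρ x * d) (toℕ o) j)) ⟩
        image W !! (ρ x * d + toℕ o + j)                           ∎))
      where open ≡-Reasoning
    sat-letter′ a j (inj₂ o) refl =
      sat-⌜⌝ {b = ⌊ r !! (toℕ o + j) ≟ᵐ just a ⌋} ⟨⇔⟩ ⌊⌋-sound ⟨⇔⟩ ⇔-reflexive (cong (_≡ just a) (begin
        r !! (toℕ o + j)                                ≡⟨ sym (!!-++ʳ (concatMap g W) (toℕ o + j)) ⟩
        image W !! (length (concatMap g W) + (toℕ o + j)) ≡⟨ cong (λ l → image W !! (l + (toℕ o + j)))
          (length-expand g uniform W) ⟩
        image W !! (length W * d + (toℕ o + j))         ≡⟨ cong (image W !!_)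
          (sym (+-assoc (length W * d) (toℕ o) j)) ⟩
        image W !! (length W * d + toℕ o + j)           ∎))
      where open ≡-Reasoning

    reverse-image : reverse (image W) ≡ reversed (reverse W)
    reverse-image = trans (reverse-++ (concatMap g W) r) (cong (reverse r ++_) (reverse-expand g uniform W))

    reversed-take : ∀ k W → reversed W !! k ≡ reversed (take (suc k) W) !! k
    reversed-take k W = !!-prefix (reverse r) k λ {j} j≤k →
      subst₂ (λ u v → u !! j ≡ v !! j) (++-identityʳ _) (++-identityʳ _)
        (!!-expand (reverse ∘ g) (λ b → trans (length-reverse (g b)) (uniform b)) (suc k) W
          (<-≤-trans (enough j) (*-monoˡ-≤ d (s≤s j≤k))))

    sat-numeric′ : ∀ {ρ : Vector ℕ v} {k} (P : Predicate n k) {xs ps} → ModuliDivide d (class P) →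
                   Pointwise (λ (l , x) → Encodes′ (Fin.splitAt d l) (ρ x)) xs ps → Sat W ρ (numeric′ P xs)
                     ⇔ Holds (image W) P ps
    sat-numeric′ less              {(l , x) ∷ (k , y) ∷ []} _ (e ∷ e′ ∷ []) = sat-less′ (Fin.splitAt d l)
      (Fin.splitAt d k) e e′
    sat-numeric′ (letter-x+ a j)   {(l , x) ∷ []} _ (e ∷ []) = sat-letter′ a j (Fin.splitAt d l) e
    sat-numeric′ {ρ = ρ} (letter-min+ a j) _ [] = sat-lookMin local∈ {w = W} {ρ = ρ} (suc j)
      (λ W → ⌊ image W !! j ≟ᵐ just a ⌋) ⟨⇔⟩ ⌊⌋-sound ⟨⇔⟩ ⇔-reflexive (cong (_≡ just a) (sym (image-take j W)))
    sat-numeric′ {ρ = ρ} (letter-max- a j) _ [] = sat-lookMax local∈ {w = W} {ρ = ρ} (suc j)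
      (λ W → ⌊ reversed W !! j ≟ᵐ just a ⌋) ⟨⇔⟩ ⌊⌋-sound ⟨⇔⟩ ⇔-reflexive (cong (_≡ just a)
      (trans (sym (reversed-take j (reverse W))) (cong (_!! j) (sym reverse-image))))
    sat-numeric′ {ρ = ρ} (MOD- δ i) {(l , x) ∷ []} δ∣d (e ∷ []) with Fin.splitAt d l | e
    ... | inj₁ o | _ , refl = sat-⌜⌝ {b = residue δ i (toℕ o)} ⟨⇔⟩ ⌊⌋-sound ⟨⇔⟩ ⇔-reflexive
      (cong (_≡ toℕ i) (sym (*d+-% {{Fin.nonZeroIndex i}} δ∣d (ρ x) (toℕ o))))
    ... | inj₂ o | refl     = sat-⌜⌝ {b = residue δ i (toℕ o)} ⟨⇔⟩ ⌊⌋-sound ⟨⇔⟩ ⇔-reflexive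
      (cong (_≡ toℕ i) (sym (*d+-% {{Fin.nonZeroIndex i}} δ∣d (length W) (toℕ o))))
    sat-numeric′ (D- δ i) δ∣d [] = sat-⌜⌝ {b = residue δ i (length r)} ⟨⇔⟩ ⌊⌋-sound ⟨⇔⟩ ⇔-reflexive (cong (_≡ toℕ i)
      (trans (sym (*d+-% {{Fin.nonZeroIndex i}} δ∣d (length W) (length r)))
        (cong (λ l → _%_ l δ {{Fin.nonZeroIndex i}}) (sym length-image))))

    private instance
      d≢0 : NonZero d
      d≢0 = >-nonZero 1≤d

    interprets : Interprets interpretation (ModuliDivide d) W (image W)
    interprets = record
      { Encodes      = λ l → Encodes′ (Fin.splitAt d l)
      ; decode       = λ {_} {_} {_} {l} p _ _ → decode (Fin.splitAt d l) p
      ; encode       = encode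
      ; sat-equality = λ {_} {_} {l} {_} {k} → sat-equality′ (Fin.splitAt d l) (Fin.splitAt d k)
      ; sat-labelled = λ {_} {_} {a} {l} {_} {p} e → sat-letter′ a 0 (Fin.splitAt d l) e ⟨⇔⟩ ⇔-reflexive
        (cong (image W has a at_) (+-identityʳ p))
      ; sat-numeric  = λ P _ → sat-numeric′ P
      }
      where
      decode : ∀ l (p : Fin (length W)) → Σ[ p′ ∈ Fin (length (image W)) ] Encodes′ l (toℕ p) (toℕ p′)
      decode (inj₁ o) p = fromℕ< p< , toℕ<n p , toℕ-fromℕ< p<
        where
        p< : toℕ p * d + toℕ o < length (image W)
        p< = subst (toℕ p * d + toℕ o <_) (sym length-image) (block-<-block o (toℕ<n p))
      decode (inj₂ o) p = fromℕ< p< , toℕ-fromℕ< p<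
        where
        p< : length W * d + toℕ o < length (image W)
        p< = subst (length W * d + toℕ o <_) (sym length-image) (+-monoʳ-< (length W * d) (toℕ<n o))
      encode : (p′ : Fin (length (image W))) → Σ[ l ∈ Fin (d + length r) ] Σ[ p ∈ Fin (length W) ]
               Encodes′ (Fin.splitAt d l) (toℕ p) (toℕ p′) × (∀ {v} {ρ : Vector ℕ v} {x : Fin v} → ρ x ≡ toℕ p → ⊤)
      encode p′ with toℕ p′ <? length W * d
      ... | yes p′< = o Fin.↑ˡ length r , fromℕ< quotient< ,
        subst (λ l → Encodes′ l (toℕ (fromℕ< quotient<)) (toℕ p′)) (sym (Fin.splitAt-↑ˡ d o (length r)))
          (subst (_< length W) (sym (toℕ-fromℕ< quotient<)) quotient< ,
           trans (m≡m%n+[m/n]*n (toℕ p′) d) (trans (+-comm _ (toℕ p′ / d * d))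
             (cong₂ (λ q o → q * d + o) (sym (toℕ-fromℕ< quotient<)) (sym (toℕ-fromℕ< _))))) , _
        where
        o = fromℕ< (m%n<n (toℕ p′) d)
        quotient< : toℕ p′ / d < length W
        quotient< = m<n*o⇒m/o<n p′<
      ... | no p′≮ = d Fin.↑ʳ fromℕ< remainder< , p₀ , subst (λ l → Encodes′ l (toℕ p₀) (toℕ p′))
        (sym (Fin.splitAt-↑ʳ d (length r) (fromℕ< remainder<)))
          (trans (sym (m+[n∸m]≡n (≮⇒≥ p′≮))) (cong (length W * d +_) (sym (toℕ-fromℕ< remainder<)))) , _
        where
        remainder< : toℕ p′ ∸ length W * d < length r
        remainder< = +-cancelˡ-< (length W * d) _ _ (subst₂ _<_ (sym (m+[n∸m]≡n (≮⇒≥ p′≮))) length-image (toℕ<n p′))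

local∈Reg : Reg local
local∈Reg = inj₂ (inj₁ refl)

order∈Reg : Reg order
order∈Reg = inj₁ refl

modular∈Reg : ∀ d → Reg (modular d)
modular∈Reg d = inj₂ (inj₂ (d , refl))

-- The word W interpreted in concatMap block W ++ r: position p of W is
-- encoded by the first position p * s of its block.
module Blocks {N n s : ℕ} (block : Fin N → Word n) (uniform : ∀ b → length (block b) ≡ s)
              (block-injective : ∀ {b b′} → block b ≡ block b′ → b ≡ b′) (zero′ : Fin s) (zero′≡0 : toℕ zero′ ≡ 0)
              (r : Word n) (r<s : length r < s) where

  private instance
    s≢0 : NonZero s
    s≢0 = Fin.nonZeroIndex zero′

  -- A multiple of s at which fewer than s letters are left begins the remainder r and not a block.
  guard′ : Fin v → Formula Reg n v
  guard′ x = pred (MOD- s zero′) (modular∈Reg s) (x ∷ []) ∧ lookFrom local∈Reg x s λ u → ⌊ length u ≟ s ⌋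

  begins : Fin N → ℕ → Word n → Bool
  begins b j u = ⌊ take s (drop (j * s) u) ≟ʷ block b ⌋

  ends : Fin N → ℕ → Word n → Bool
  ends b j u = ⌊ take s (drop (length r + j * s) u) ≟ʷ reverse (block b) ⌋

  numeric′ : ∀ {k} (P : Predicate N k) → [<,+1] (class P) → Vec (Fin v) k → Formula Reg n v
  numeric′ less              _ xs       = pred less order∈Reg xs
  numeric′ (letter-x+ b j)   _ (x ∷ []) = lookFrom local∈Reg x (j * s + s) (begins b j)
  numeric′ (letter-min+ b j) _ []       = lookMin local∈Reg (j * s + s) (begins b j)
  numeric′ (letter-max- b j) _ []       = lookMax local∈Reg (length r + j * s + s) (ends b j)
  numeric′ (MOD- _ _)        (inj₁ ())
  numeric′ (MOD- _ _)        (inj₂ ())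
  numeric′ (D- _ _)          (inj₁ ())
  numeric′ (D- _ _)          (inj₂ ())

  elementary-numeric′ : ∀ {V : Pred (Fin v) 0ℓ} {k} (P : Predicate N k) P∈ {xs : Vec (Fin v) k} →
                        VecAll.All V xs → Elementary V (numeric′ P P∈ xs)
  elementary-numeric′ less              _ Vxs       = elementary-pred less order∈Reg Vxs
  elementary-numeric′ (letter-x+ b j)   _ (Vx ∷ []) = lookFrom-elementary _ _ _ Vx
  elementary-numeric′ (letter-min+ b j) _ []        = lookMin-elementary _ _ _
  elementary-numeric′ (letter-max- b j) _ []        = lookMax-elementary _ _ _
  elementary-numeric′ (MOD- _ _)        (inj₁ ())
  elementary-numeric′ (MOD- _ _)        (inj₂ ())
  elementary-numeric′ (D- _ _)          (inj₁ ())
  elementary-numeric′ (D- _ _)          (inj₂ ())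

  interpretation : Interpretation [<,+1] Reg N n 1
  interpretation = record
    { guard    = λ _ → guard′
    ; equality = λ (_ , x) (_ , y) → x ≐ y
    ; labelled = λ b (_ , x) → lookFrom local∈Reg x s (begins b 0)
    ; numeric  = λ P P∈ xs → numeric′ P P∈ (Vec.map proj₂ xs)
    ; guard-elementary    = λ _ Vx → elementary-∧ (elementary-pred (MOD- s zero′) (modular∈Reg s) (Vx ∷ []))
      (lookFrom-elementary _ _ _ Vx)
    ; equality-elementary = elementary-≐
    ; labelled-elementary = λ b Vx → lookFrom-elementary _ _ _ Vx
    ; numeric-elementary  = λ P P∈ Vxs → elementary-numeric′ P P∈ (VecAll.map⁺ Vxs)
    }

  module _ (W : Word N) where

    w : Word n
    w = concatMap block W ++ r

    length-w : length w ≡ length W * s + length r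
    length-w = trans (length-++ (concatMap block W)) (cong (_+ length r) (length-expand block uniform W))

    Encodes′ : ℕ → ℕ → Set
    Encodes′ p p′ = p ≡ p′ * s × p′ < length W

    sat-begins : ∀ b j K {p p′} → K ≡ j * s + s → Encodes′ p p′ → T (begins b j (take K (drop p w)))
      ⇔ W has b at (p′ + j)
    sat-begins b j K {p} {p′} refl (refl , p′<W) = ⌊⌋-sound ⟨⇔⟩ ⇔-reflexive (cong (_≡ block b) (begin
      take s (drop (j * s) (take (j * s + s) (drop (p′ * s) w))) ≡⟨ take-drop-take s (j * s) _ ⟩
      take s (drop (j * s) (drop (p′ * s) w))                    ≡⟨ cong (take s ∘ drop (j * s))
        (drop-expand block uniform p′ W (<⇒≤ p′<W)) ⟩
      take s (drop (j * s) (concatMap block (drop p′ W) ++ r))   ∎))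
      ⟨⇔⟩ read-expand block uniform block-injective r<s (drop p′ W) j b ⟨⇔⟩ ⇔-reflexive
        (cong (_≡ just b) (!!-drop p′ W j))
      where open ≡-Reasoning

    sat-min : ∀ b j → T (begins b j (take (j * s + s) w)) ⇔ W has b at j
    sat-min b j = ⌊⌋-sound ⟨⇔⟩ ⇔-reflexive (cong (_≡ block b) (take-drop-take s (j * s) w)) ⟨⇔⟩ read-expand block
      uniform block-injective r<s W j b

    sat-max : ∀ b j → T (ends b j (take (length r + j * s + s) (reverse w))) ⇔ reverse W has b at j
    sat-max b j = ⌊⌋-sound ⟨⇔⟩ ⇔-reflexive (cong (_≡ reverse (block b)) (begin
      take s (drop (length r + j * s) (take (length r + j * s + s) (reverse w))) ≡⟨ take-drop-take s
        (length r + j * s) _ ⟩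
      take s (drop (length r + j * s) (reverse w))                              ≡⟨ cong (take s)
        (sym (drop-drop (length r) (j * s) _)) ⟩
      take s (drop (j * s) (drop (length r) (reverse w)))                       ≡⟨ cong
        (λ z → take s (drop (j * s) z)) without-r ⟩
      take s (drop (j * s) (concatMap (reverse ∘ block) (reverse W) ++ []))     ∎))
      ⟨⇔⟩ read-expand (reverse ∘ block) (λ b → trans (length-reverse (block b)) (uniform b))
        (block-injective ∘ List.reverse-injective)
            (>-nonZero⁻¹ s) (reverse W) j b
      where
      open ≡-Reasoning
      without-r : drop (length r) (reverse w) ≡ concatMap (reverse ∘ block) (reverse W) ++ []
      without-r = begin
        drop (length r) (reverse w)                                         ≡⟨ cong (drop (length r))
          (reverse-++ (concatMap block W) r) ⟩
        drop (length r) (reverse r ++ reverse (concatMap block W))          ≡⟨ cong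
          (λ l → drop l (reverse r ++ reverse (concatMap block W))) (sym (length-reverse r)) ⟩
        drop (length (reverse r)) (reverse r ++ reverse (concatMap block W)) ≡⟨ drop-++ (reverse r) ⟩
        reverse (concatMap block W)                                         ≡⟨ reverse-expand block uniform W ⟩
        concatMap (reverse ∘ block) (reverse W)                             ≡⟨ sym (++-identityʳ _) ⟩
        concatMap (reverse ∘ block) (reverse W) ++ []                       ∎

    sat-numeric′ : ∀ {ρ : Vector ℕ v} {k} (P : Predicate N k) P∈ {xs ps} →
                   Pointwise (λ (l , x) → Encodes′ (ρ x)) xs ps →
                     Sat w ρ (numeric′ P P∈ (Vec.map (proj₂ {A = Fin 1}) xs)) ⇔ Holds W P ps
    sat-numeric′ less              _ ((e , _) ∷ (e′ , _) ∷ []) = ⇔-reflexive (cong₂ _<_ e e′)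
      ⟨⇔⟩ mk⇔ (*-cancelʳ-< s _ _) (*-monoˡ-< s)
    sat-numeric′ (letter-x+ b j)   _ (e ∷ []) = sat-lookFrom local∈Reg _ _ _ ⟨⇔⟩ sat-begins b j _ refl e
    sat-numeric′ (letter-min+ b j) _ [] = sat-lookMin local∈Reg _ _ ⟨⇔⟩ sat-min b j
    sat-numeric′ (letter-max- b j) _ [] = sat-lookMax local∈Reg _ _ ⟨⇔⟩ sat-max b j
    sat-numeric′ (MOD- _ _)        (inj₁ ())
    sat-numeric′ (MOD- _ _)        (inj₂ ())
    sat-numeric′ (D- _ _)          (inj₁ ())
    sat-numeric′ (D- _ _)          (inj₂ ())

    private
      fits : ∀ {p} → p < length W → p * s + s ≤ length w
      fits {p} p<W = ≤-trans (≤-reflexive (+-comm (p * s) s))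
        (≤-trans (*-monoˡ-≤ s p<W) (≤-trans (m≤m+n _ _) (≤-reflexive (sym length-w))))

      -- Since r is shorter than s, a full block starting at a multiple of s cannot reach beyond the
      -- image of W unless it starts inside it.
      fits⁻¹ : ∀ {p} → p * s + s ≤ length w → p < length W
      fits⁻¹ {p} h = ≤-pred (*-cancelʳ-< s (suc p) (suc (length W)) (begin-strict
        suc p * s               ≡⟨ +-comm s (p * s) ⟩
        p * s + s               ≤⟨ h ⟩
        length w                ≡⟨ length-w ⟩
        length W * s + length r <⟨ +-monoʳ-< (length W * s) r<s ⟩
        length W * s + s        ≡⟨ +-comm (length W * s) s ⟩
        suc (length W) * s      ∎))
        where open ≤-Reasoning

      full : ∀ p → T ⌊ length (take s (drop p w)) ≟ s ⌋ ⇔ (s ≤ length w ∸ p)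
      full p = ⌊⌋-sound ⟨⇔⟩ ⇔-reflexive (cong (_≡ s)
        (trans (List.length-take s (drop p w)) (cong (s ⊓_) (List.length-drop p w))))
        ⟨⇔⟩ mk⇔ (λ e → ≤-trans (≤-reflexive (sym e)) (m⊓n≤n s _)) m≤n⇒m⊓n≡m

    interprets : Interprets interpretation (λ _ → ⊤) w W
    interprets = record
      { Encodes      = λ _ → Encodes′
      ; decode       = λ {_} {_} {_} {l} → decode {l = l}
      ; encode       = encode
      ; sat-equality = λ { (e , _) (e′ , _) → ⇔-reflexive (cong₂ _≡_ e e′) ⟨⇔⟩ mk⇔ (*-cancelʳ-≡ _ _ s) (cong (_* s)) }
      ; sat-labelled = λ {_} {_} {b} {_} {_} {p} e → sat-lookFrom local∈Reg _ _ _ ⟨⇔⟩ sat-begins b 0 s refl e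
        ⟨⇔⟩ ⇔-reflexive (cong (W has b at_) (+-identityʳ p))
      ; sat-numeric  = λ P P∈ _ → sat-numeric′ P P∈
      }
      where
      decode : ∀ {v} {ρ : Vector ℕ v} {x : Fin v} {l : Fin 1} (p : Fin (length w)) → ρ x ≡ toℕ p →
        Sat w ρ (guard′ x) →
               Σ[ p′ ∈ Fin (length W) ] Encodes′ (toℕ p) (toℕ p′)
      decode {ρ = ρ} {x} p ρx≡p (p%s≡0 , block-full) = fromℕ< q< , trans p≡ (cong (_* s) (sym (toℕ-fromℕ< q<))) ,
        toℕ<n (fromℕ< q<)
        where
        p≡ : toℕ p ≡ toℕ p / s * s
        p≡ = trans (m≡m%n+[m/n]*n (toℕ p) s) (cong (_+ toℕ p / s * s)
          (trans (cong (_% s) (sym ρx≡p)) (trans p%s≡0 zero′≡0)))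
        s≤ : s ≤ length w ∸ toℕ p
        s≤ = subst (λ p → s ≤ length w ∸ p) ρx≡p (to (full (ρ x)) (to (sat-lookFrom local∈Reg x s _) block-full))
        q< : toℕ p / s < length W
        q< = fits⁻¹ (subst (λ p → p + s ≤ length w) p≡
          (≤-trans (+-monoʳ-≤ (toℕ p) s≤) (≤-reflexive (m+[n∸m]≡n (<⇒≤ (toℕ<n p))))))
      encode : (p′ : Fin (length W)) → Σ[ l ∈ Fin 1 ] Σ[ p ∈ Fin (length w) ]
               Encodes′ (toℕ p) (toℕ p′) × (∀ {v} {ρ : Vector ℕ v} {x : Fin v} → ρ x ≡ toℕ p → Sat w ρ (guard′ x))
      encode p′ = zero , fromℕ< p< , (toℕ-fromℕ< p< , toℕ<n p′) , λ {_} {ρ} {x} ρx≡p → let ρx≡ =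
                                                                                             trans ρx≡p (toℕ-fromℕ< p<) in
        trans (trans (cong (_% s) ρx≡) (m*n%n≡0 (toℕ p′) s)) (sym zero′≡0) ,
        from (sat-lookFrom local∈Reg x s _) (from (full (ρ x)) (subst (λ p → s ≤ length w ∸ p) (sym ρx≡)
          (m+n≤o⇒m≤o∸n s (subst (_≤ length w) (+-comm (toℕ p′ * s) s) (fits (toℕ<n p′))))))
        where
        p< : toℕ p′ * s < length w
        p< = ≤-trans (m<m+n (toℕ p′ * s) (>-nonZero⁻¹ s)) (fits (toℕ<n p′))

-- Words of given or bounded length

word : ∀ k → Fin (n ^ k) → Word n
word k i = tabulate (finToFun {n = k} i)

length-word : ∀ k (i : Fin (n ^ k)) → length (word k i) ≡ k
length-word k i = List.length-tabulate (finToFun {n = k} i)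

word-surjective : ∀ k (u : Word n) → length u ≡ k → ∃[ i ] word k i ≡ u
word-surjective _ u refl = funToFin (lookup u) , trans (List.tabulate-cong (Fin.finToFun-funToFin (lookup u)))
  (List.tabulate-lookup u)

funToFin-cong : {f g : Fin m → Fin n} → (∀ x → f x ≡ g x) → funToFin f ≡ funToFin g
funToFin-cong {zero}  e = refl
funToFin-cong {suc m} e = cong₂ Fin.combine (e zero) (funToFin-cong (e ∘ suc))

tabulate-injective : {f g : Fin m → A} → tabulate f ≡ tabulate g → ∀ x → f x ≡ g x
tabulate-injective {m = suc m} e zero    = List.∷-injectiveˡ e
tabulate-injective {m = suc m} e (suc x) = tabulate-injective (List.∷-injectiveʳ e) x

word-injective : ∀ k {i j : Fin (n ^ k)} → word k i ≡ word k j → i ≡ j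
word-injective {n} k {i} {j} e = begin
  i                                 ≡⟨ sym (Fin.funToFin-finToFin {m = k} {n} i) ⟩
  funToFin (finToFun {n} {k} i)     ≡⟨ funToFin-cong (tabulate-injective e) ⟩
  funToFin (finToFun {n} {k} j)     ≡⟨ Fin.funToFin-finToFin {m = k} {n} j ⟩
  j                                 ∎
  where open ≡-Reasoning

shorter : ∀ n → ℕ → List (Word n)
shorter n zero    = []
shorter n (suc k) = [] ∷ cartesianProductWith _∷_ (allFin n) (shorter n k)

∈-shorter⁺ : ∀ {k} {u : Word n} → length u < k → u ∈ shorter n k
∈-shorter⁺ {u = []}    (s≤s _)   = here refl
∈-shorter⁺ {u = a ∷ u} (s≤s u<k) = there (∈-cartesianProductWith⁺ _∷_ (∈-allFin a) (∈-shorter⁺ u<k))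

∈-shorter⁻ : ∀ {k} {u : Word n} → u ∈ shorter n k → length u < k
∈-shorter⁻ {k = suc k} (here refl) = s≤s z≤n
∈-shorter⁻ {n} {k = suc k} (there u∈) with ∈-cartesianProductWith⁻ _∷_ (allFin n) (shorter n k) u∈
... | a , u , _ , u∈ , refl = s≤s (∈-shorter⁻ u∈)

-- Stability

-- The pigeonhole principle gives i and p ≥ 1 with R m (m + p) for all m ≥ i;
-- then s = (1 + i) p will do.
module _ {N : ℕ} (f : ℕ → Fin N) (R : ℕ → ℕ → Set) (f⇒R : ∀ {i j} → f i ≡ f j → R i j)
         (R-refl : ∀ {i} → R i i) (R-trans : ∀ {i j k} → R i j → R j k → R i k) (R-+ : ∀ k {i j} → R i j →
           R (k + i) (k + j)) where

  stable : ∃[ s ] 1 ≤ s × (∀ c → R s (s + s * c))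
  stable with Fin.pigeonhole (n<1+n N) (f ∘ toℕ)
  ... | i′ , j′ , i<j , fi≡fj = suc i * p , ≤-trans (m<n⇒0<n∸m i<j) (m≤m+n p (i * p)) , λ c →
        subst (λ m → R (suc i * p) (suc i * p + m))
          (trans (cong (_* p) (*-comm c (suc i))) (trans (*-assoc (suc i) c p)
          (trans (cong (suc i *_) (*-comm c p)) (sym (*-assoc (suc i) p c)))))
          (periods (c * suc i) (≤-trans (≤-reflexive (sym (*-identityʳ i)))
            (≤-trans (*-monoʳ-≤ i (m<n⇒0<n∸m i<j)) (m≤n+m (i * p) p))))
    where
    i = toℕ i′
    p = toℕ j′ ∸ i
    period : ∀ {m} → i ≤ m → R m (m + p)
    period {m} i≤m = subst₂ R (m∸n+n≡m i≤m) (trans (cong (m ∸ i +_) (sym (m+[n∸m]≡n (<⇒≤ i<j))))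
      (trans (sym (+-assoc (m ∸ i) i p)) (cong (_+ p) (m∸n+n≡m i≤m))))
                 (R-+ (m ∸ i) (f⇒R fi≡fj))
    periods : ∀ c {m} → i ≤ m → R m (m + c * p)
    periods zero    {m} i≤m = subst (R m) (sym (+-identityʳ m)) R-refl
    periods (suc c) {m} i≤m = subst (R m) (+-assoc m p (c * p))
      (R-trans (period i≤m) (periods c (≤-trans i≤m (m≤m+n m p))))

module _ (M : DFA n) where

  open DFA M

  infix 4 _∼_
  _∼_ : Word n → Word n → Set
  u ∼ v = ∀ q → foldl δ q u ≡ foldl δ q v

  ∼-++ : ∀ {u u′ v v′} → u ∼ u′ → v ∼ v′ → u ++ v ∼ u′ ++ v′
  ∼-++ {u} {u′} {v} {v′} e e′ q = trans (List.foldl-++ δ q u v)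
    (trans (cong (λ q → foldl δ q v) (e q)) (trans (e′ _) (sym (List.foldl-++ δ q u′ v′))))

  ∼⇒L : ∀ {u v} → u ∼ v → L M u ⇔ L M v
  ∼⇒L e = ⇔-reflexive (cong (Subset._∈ final) (e start))

  transition : Word n → Fin (states ^ states)
  transition u = funToFin λ q → foldl δ q u

  transition⇒∼ : ∀ {u v} → transition u ≡ transition v → u ∼ v
  transition⇒∼ {u} {v} e q = trans (sym (Fin.finToFun-funToFin _ q))
    (trans (cong (λ t → finToFun t q) e) (Fin.finToFun-funToFin _ q))

  transition-cong : ∀ {u v} → u ∼ v → transition u ≡ transition v
  transition-cong = funToFin-cong

  -- An inclusion between the sets of transformations induced by words of the two lengths. It is a
  -- preorder and is preserved when a common prefix length is added, which is what `stable` asks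
  -- for.
  Represented : ℕ → ℕ → Set
  Represented i j = ∀ u → length u ≡ i → Σ[ v ∈ Word n ] length v ≡ j × u ∼ v

  private
    acts? : ∀ k t → Dec (∃[ i ] transition (word k i) ≡ t)
    acts? k t = any? λ i → transition (word k i) Fin.≟ t

    -- The set of transformations induced by words of length k, as the code of its characteristic
    -- function, so that the pigeonhole principle applies.
    actions : ℕ → Fin (2 ^ (states ^ states))
    actions k = funToFin λ t → if ⌊ acts? k t ⌋ then suc (zero {0}) else zero

    actions⇒Represented : ∀ {i j} → actions i ≡ actions j → Represented i j
    actions⇒Represented {i} {j} e u ∣u∣≡i with acts? j (transition u) | same
      where
      same : (if ⌊ acts? i (transition u) ⌋ then suc (zero {0}) else zero)
        ≡ (if ⌊ acts? j (transition u) ⌋ then suc zero else zero)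
      same = trans (sym (Fin.finToFun-funToFin _ (transition u))) (trans (cong (λ a → finToFun a (transition u)) e)
        (Fin.finToFun-funToFin _ (transition u)))
    ... | yes (v , tv≡tu) | _ = word j v , length-word j v , transition⇒∼ {u} {word j v} (sym tv≡tu)
    ... | no  _           | same with acts? i (transition u) | same
    ... | yes _   | ()
    ... | no ¬act | _ = let v , v≡u = word-surjective i u ∣u∣≡i in contradiction (v , cong transition v≡u) ¬act

    represented-trans : ∀ {i j k} → Represented i j → Represented j k → Represented i k
    represented-trans r r′ u ∣u∣ = let v , ∣v∣ , u∼v = r u ∣u∣ ; w , ∣w∣ , v∼w = r′ v ∣v∣ in w , ∣w∣ ,
      λ q → trans (u∼v q) (v∼w q)

    represented-+ : ∀ k {i j} → Represented i j → Represented (k + i) (k + j)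
    represented-+ k {i} {j} r u ∣u∣ =
      let v , ∣v∣ , e = r (drop k u) (trans (List.length-drop k u) (trans (cong (_∸ k) ∣u∣) (m+n∸m≡n k i)))
      in take k u ++ v ,
         trans (length-++ (take k u)) (cong₂ _+_ (trans (List.length-take k u)
           (m≤n⇒m⊓n≡m (≤-trans (m≤m+n k i) (≤-reflexive (sym ∣u∣))))) ∣v∣) ,
         subst (_∼ (take k u ++ v)) (take++drop≡id k u) (∼-++ {take k u} {take k u} {drop k u} {v} (λ _ → refl) e)

  abstract
    -- Writing the multiples as s + s * c leaves out zero.
    stability : ∃[ s ] 1 ≤ s × (∀ c → Represented s (s + s * c))
    stability = stable actions Represented actions⇒Represented (λ u ∣u∣ → u , ∣u∣ , λ _ → refl)
      represented-trans represented-+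

predicateModulus : ∀ {r} → Predicate n r → ℕ
predicateModulus (MOD- d i) = d
predicateModulus (D- d i)   = d
predicateModulus _          = 1

-- A product serves as common multiple; minimality does not matter.
modulus : Formula σ n v → ℕ
modulus (pred P _ _)  = predicateModulus P
modulus (¬′ φ)        = modulus φ
modulus (φ ∧ ψ)       = modulus φ * modulus ψ
modulus (φ ∨ ψ)       = modulus φ * modulus ψ
modulus (quant _ _ φ) = modulus φ
modulus _             = 1

modulus>0 : (φ : Formula σ n v) → 1 ≤ modulus φ
modulus>0 true          = ≤-refl
modulus>0 false         = ≤-refl
modulus>0 (x ≐ y)       = ≤-refl
modulus>0 (letter a x)  = ≤-refl
modulus>0 (pred less _ _)              = ≤-refl
modulus>0 (pred (letter-x+ _ _) _ _)   = ≤-refl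
modulus>0 (pred (letter-min+ _ _) _ _) = ≤-refl
modulus>0 (pred (letter-max- _ _) _ _) = ≤-refl
modulus>0 (pred (MOD- d i) _ _)        = ≤-<-trans z≤n (toℕ<n i)
modulus>0 (pred (D- d i) _ _)          = ≤-<-trans z≤n (toℕ<n i)
modulus>0 (¬′ φ)        = modulus>0 φ
modulus>0 (φ ∧ ψ)       = *-mono-≤ (modulus>0 φ) (modulus>0 ψ)
modulus>0 (φ ∨ ψ)       = *-mono-≤ (modulus>0 φ) (modulus>0 ψ)
modulus>0 (quant _ _ φ) = modulus>0 φ

moduliDivide : ∀ {d} (φ : Formula σ n v) → modulus φ ∣ d → Predicates (ModuliDivide d) φ
moduliDivide true          _ = tt
moduliDivide false         _ = tt
moduliDivide (x ≐ y)       _ = tt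
moduliDivide (letter a x)  _ = tt
moduliDivide (pred less _ _)              _ = tt
moduliDivide (pred (letter-x+ _ _) _ _)   _ = tt
moduliDivide (pred (letter-min+ _ _) _ _) _ = tt
moduliDivide (pred (letter-max- _ _) _ _) _ = tt
moduliDivide (pred (MOD- δ i) _ _)        δ∣d = δ∣d
moduliDivide (pred (D- δ i) _ _)          δ∣d = δ∣d
moduliDivide (¬′ φ)        h = moduliDivide φ h
moduliDivide (φ ∧ ψ)       h = moduliDivide φ (∣-trans (m∣m*n (modulus ψ)) h) ,
  moduliDivide ψ (∣-trans (n∣m*n (modulus φ)) h)
moduliDivide (φ ∨ ψ)       h = moduliDivide φ (∣-trans (m∣m*n (modulus ψ)) h) ,
  moduliDivide ψ (∣-trans (n∣m*n (modulus φ)) h)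
moduliDivide (quant _ _ φ) h = moduliDivide φ h

predicates-⊤ : (φ : Formula σ n v) → Predicates (λ _ → ⊤) φ
predicates-⊤ true          = tt
predicates-⊤ false         = tt
predicates-⊤ (x ≐ y)       = tt
predicates-⊤ (letter a x)  = tt
predicates-⊤ (pred _ _ _)  = tt
predicates-⊤ (¬′ φ)        = predicates-⊤ φ
predicates-⊤ (φ ∧ ψ)       = predicates-⊤ φ , predicates-⊤ ψ
predicates-⊤ (φ ∨ ψ)       = predicates-⊤ φ , predicates-⊤ ψ
predicates-⊤ (quant _ _ φ) = predicates-⊤ φ

∈-tabulate : {P : Pred (Fin n) 0ℓ} (P? : ∀ x → Dec (P x)) → ∀ x → x Subset.∈ Vec.tabulate (λ x → ⌊ P? x ⌋) ⇔ P x
∈-tabulate P? x = mk⇔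
  (λ x∈ → toWitness (subst T (trans (sym (Vec.[]=⇒lookup x∈)) (Vec.lookup∘tabulate (λ x → ⌊ P? x ⌋) x)) tt))
  (λ Px → Vec.lookup⇒[]= x _ (trans (Vec.lookup∘tabulate (λ x → ⌊ P? x ⌋) x) (to T-≡ (fromWitness Px))))

-- The inverse image under the substitution `block` of the right quotient by r.
quotient : ∀ {N} → DFA n → (Fin N → Word n) → Word n → DFA N
quotient M block r = record
  { states = states
  ; start  = start
  ; δ      = λ q b → foldl δ q (block b)
  ; final  = Vec.tabulate λ q → ⌊ foldl δ q r Subset.∈? final ⌋
  }
  where open DFA M

L-quotient : ∀ {N} (M : DFA n) (block : Fin N → Word n) r W → L (quotient M block r) W ⇔ L M (concatMap block W ++ r)
L-quotient M block r W = ∈-tabulate (λ q → foldl δ q r Subset.∈? final) _ ⟨⇔⟩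
  ⇔-reflexive (cong (Subset._∈ final) (trans (cong (λ q → foldl δ q r) (runs W start))
    (sym (List.foldl-++ δ start (concatMap block W) r))))
  where
  open DFA M
  runs : ∀ W q → foldl (λ q b → foldl δ q (block b)) q W ≡ foldl δ q (concatMap block W)
  runs []      q = refl
  runs (b ∷ W) q = trans (runs W _) (sym (List.foldl-++ δ q (block b) (concatMap block W)))

-- Restrictions on the number of variables; BΣ imposes none, FO² requires 2.
record Joinable (V : Pred ℕ 0ℓ) : Set where
  field
    join : ∀ {c} (f : Fin c → ℕ) → (∀ i → V (f i)) → Σ[ u ∈ ℕ ] V u × (∀ i → f i ≤ u)

Restricted : Pred ℕ 0ℓ → ℕ → (σ : Signature) → Fragment σ
Restricted V k σ {v = v} φ = V v × Alternating k σ φ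

-- The reduction from Reg to [<,+1]

module Reduction {n : ℕ} (V : Pred ℕ 0ℓ) (k : ℕ) (M : DFA n) where

  s : ℕ
  s = proj₁ (stability M)

  1≤s : 1 ≤ s
  1≤s = proj₁ (proj₂ (stability M))

  block : Fin (n ^ s) → Word n
  block = word s

  private
    closed : PrefixClosed (λ qs → alternations qs ≤ k ∸ 1)
    closed = alternating-closed

  quotient-belongs : L M BelongsTo Restricted V k Reg → ∀ r → L (quotient M block r) BelongsTo Restricted V k [<,+1]
  quotient-belongs (v , φ , φ-sentence , (Vv , φ-branches) , L⇔φ) r = v , χ , χ-sentence , (Vv , χ-branches) , correct
    where
    t = modulus φ
    -- This is s t, in the form in which `stability` provides it.
    d = s + s * (t ∸ 1)
    d≡ : d ≡ s * t
    d≡ = trans (cong (_+ s * (t ∸ 1)) (sym (*-identityʳ s)))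
      (trans (sym (*-distribˡ-+ s 1 (t ∸ 1))) (cong (s *_) (m+[n∸m]≡n (modulus>0 φ))))
    stretch : ∀ b → Σ[ u ∈ Word n ] length u ≡ d × _∼_ M (block b) u
    stretch b = proj₂ (proj₂ (stability M)) (t ∸ 1) (block b) (length-word s b)
    g : Fin (n ^ s) → Word n
    g b = proj₁ (stretch b)
    open BlowUp g (λ b → proj₁ (proj₂ (stretch b))) (≤-trans 1≤s (m≤m+n s _)) r
    open Interpretation interpretation using (translate; translate-free; translate-branches)
    0<d+r : 0 < d + length r
    0<d+r = ≤-trans 1≤s (≤-trans (m≤m+n s _) (m≤m+n d _))
    r∈L : Dec (L M r)
    r∈L = foldl (DFA.δ M) (DFA.start M) r Subset.∈? DFA.final M
    ψ : Formula [<,+1] (n ^ s) v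
    -- The initial labels are arbitrary, as φ is a sentence; a label exists because d ≥ 1.
    ψ = translate id (const (fromℕ< 0<d+r)) φ
    χ : Formula [<,+1] (n ^ s) v
    -- An empty W has no position to represent the positions of r, but then the word is r itself and
    -- membership is a constant.
    χ = nonempty local∈ ∧ ψ ∨ (¬′ nonempty local∈) ∧ ⌜ ⌊ r∈L ⌋ ⌝
    full : Elementary (λ _ → ⊥) (Formula [<,+1] (n ^ s) v ∋ nonempty local∈)
    full = nonempty-elementary local∈
    not-full : Elementary (λ _ → ⊥) (Formula [<,+1] (n ^ s) v ∋ ((¬′ nonempty local∈) ∧ ⌜ ⌊ r∈L ⌋ ⌝))
    not-full = elementary-∧ (elementary-¬ full) (elementary-⌜⌝ ⌊ r∈L ⌋)
    χ-sentence : Sentence χ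
    χ-sentence = closed⇒sentence (free-∨ (free-∧ (proj₂ full) (translate-free id _ φ (λ x∈ → φ-sentence (_ , x∈))))
      (proj₂ not-full))
    χ-branches : Alternating k [<,+1] χ
    χ-branches = (branches-quantifierFree z≤n pos (proj₁ full) , translate-branches id pos _ closed φ φ-branches) ,
                 branches-quantifierFree z≤n pos (proj₁ not-full)
    image∼ : ∀ W → _∼_ M (concatMap block W) (concatMap g W)
    image∼ []      = λ _ → refl
    image∼ (b ∷ W) = ∼-++ M {block b} {g b} {concatMap block W} (proj₂ (proj₂ (stretch b))) (image∼ W)
    L[W]⇔ : ∀ W → L (quotient M block r) W ⇔ (image W ⊨ φ)
    L[W]⇔ W = L-quotient M block r W ⟨⇔⟩ ∼⇒L M {concatMap block W ++ r} {image W}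
      (∼-++ M {concatMap block W} {concatMap g W} {r} (image∼ W) (λ _ → refl)) ⟨⇔⟩ L⇔φ (image W)
    correct : ∀ W → L (quotient M block r) W ⇔ (W ⊨ χ)
    correct [] = L-quotient M block r [] ⟨⇔⟩ mk⇔ (λ r∈ → inj₂ (empty , from (sat-⌜⌝ {b = ⌊ r∈L ⌋}) (fromWitness r∈)))
                                                 λ { (inj₁ (t , _)) → ⊥-elim (empty t) ; (inj₂ (_ , t)) →
                                                   toWitness (to (sat-⌜⌝ {b = ⌊ r∈L ⌋}) t) }
      where
      empty : ¬ ([] ⊨ (Formula [<,+1] (n ^ s) v ∋ nonempty local∈))
      empty t with to (sat-nonempty {v = v} local∈ {[]}) t
      ... | ()
    correct (b ∷ W) = L[W]⇔ (b ∷ W) ⟨⇔⟩ ⇔-sym ψ⇔φ ⟨⇔⟩ mk⇔ (λ s → inj₁ (W-nonempty , s))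
      λ { (inj₁ (_ , s)) → s ; (inj₂ (¬t , _)) → contradiction W-nonempty ¬t }
      where
      W-nonempty : (b ∷ W) ⊨ (Formula [<,+1] (n ^ s) v ∋ nonempty local∈)
      W-nonempty = from (sat-nonempty {v = v} local∈ {b ∷ W}) zero
      ψ⇔φ : ((b ∷ W) ⊨ ψ) ⇔ (image (b ∷ W) ⊨ φ)
      ψ⇔φ = Interprets.sat-translate (interprets (b ∷ W) zero) id id _ φ
              (moduliDivide φ (subst (modulus φ ∣_) (sym d≡) (n∣m*n s))) (λ x∈ → ⊥-elim (φ-sentence (_ , x∈)))

  private instance
    s≢0 : NonZero s
    s≢0 = >-nonZero 1≤s

  remainders : List (Word n)
  remainders = shorter n s

  R : ℕ
  R = length remainders

  remainder : Fin R → Word n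
  remainder = lookup remainders

  remainder< : ∀ i → length (remainder i) < s
  remainder< i = ∈-shorter⁻ (∈-lookup {xs = remainders} i)

  divide : ∀ l (u : Word n) → length u ≡ l * s → ∃[ W ] concatMap block W ≡ u
  divide zero    []      _   = [] , refl
  divide zero    (_ ∷ _) ()
  divide (suc l) u ∣u∣ with word-surjective s (take s u)
    (trans (List.length-take s u) (m≤n⇒m⊓n≡m (≤-trans (m≤m+n s (l * s)) (≤-reflexive (sym ∣u∣)))))
                        | divide l (drop s u) (trans (List.length-drop s u)
                          (trans (cong (_∸ s) ∣u∣) (m+n∸m≡n s (l * s))))
  ... | b , b≡ | W , W≡ = b ∷ W , trans (cong₂ _++_ b≡ W≡) (take++drop≡id s u)

  -- w ends with r, and the rest can be cut into blocks.
  Decomposes : Word n → Word n → Set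
  Decomposes w r = length w % s ≡ length r × take (length r) (reverse w) ≡ reverse r

  decomposes⇒blocks : ∀ w r → Decomposes w r → ∃[ W ] concatMap block W ++ r ≡ w
  decomposes⇒blocks w r (∣w∣ , w-ends) =
    let W , W≡u = divide (length w / s) u ∣u∣ in W , trans (cong (_++ r) W≡u) (sym w≡)
    where
    u = reverse (drop (length r) (reverse w))
    w≡ : w ≡ u ++ r
    w≡ = begin
      w                                                                            ≡⟨ sym (reverse-involutive w) ⟩
      reverse (reverse w)                                                          ≡⟨ cong reverse
        (sym (take++drop≡id (length r) (reverse w))) ⟩
      reverse (take (length r) (reverse w) ++ drop (length r) (reverse w))         ≡⟨ reverse-++
        (take (length r) (reverse w)) _ ⟩
      u ++ reverse (take (length r) (reverse w))                                   ≡⟨ cong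
        (λ z → u ++ reverse z) w-ends ⟩
      u ++ reverse (reverse r)                                                     ≡⟨ cong (u ++_)
        (reverse-involutive r) ⟩
      u ++ r                                                                       ∎
      where open ≡-Reasoning
    ∣u∣ : length u ≡ length w / s * s
    ∣u∣ = +-cancelʳ-≡ (length r) _ _ (begin
      length u + length r             ≡⟨ sym (length-++ u) ⟩
      length (u ++ r)                 ≡⟨ cong length (sym w≡) ⟩
      length w                        ≡⟨ m≡m%n+[m/n]*n (length w) s ⟩
      length w % s + length w / s * s ≡⟨ +-comm (length w % s) _ ⟩
      length w / s * s + length w % s ≡⟨ cong (length w / s * s +_) ∣w∣ ⟩
      length w / s * s + length r     ∎)
      where open ≡-Reasoning

  decomposes : ∀ w → ∃[ i ] Decomposes w (remainder i)
  decomposes w = index r∈ , trans (sym ∣r∣) (cong length r≡) ,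
    trans (cong (λ r → take (length r) (reverse w)) (sym r≡)) (trans ends (cong reverse r≡))
    where
    r = reverse (take (length w % s) (reverse w))
    ∣r∣ : length r ≡ length w % s
    ∣r∣ = trans (length-reverse (take (length w % s) (reverse w)))
      (trans (List.length-take (length w % s) (reverse w))
            (m≤n⇒m⊓n≡m (≤-trans (m%n≤m (length w) s) (≤-reflexive (sym (length-reverse w))))))
    ends : take (length r) (reverse w) ≡ reverse r
    ends = trans (cong (λ l → take l (reverse w)) ∣r∣) (sym (reverse-involutive _))
    r∈ : r ∈ remainders
    r∈ = ∈-shorter⁺ (subst (_< s) (sym ∣r∣) (m%n<n (length w) s))
    r≡ : r ≡ remainder (index r∈)
    r≡ = Any.lookup-index r∈

  -- The remainder of a word is recognised without quantifiers, by the length modulo s and the last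
  -- letters. Hence the disjunction over all remainders only adds empty branches to the translated
  -- formulas.
  quotients-belong : Joinable V → (∀ i → L (quotient M block (remainder i)) BelongsTo Restricted V k [<,+1]) →
    L M BelongsTo Restricted V k Reg
  quotients-belong V-joinable belongs = u , χ , χ-sentence , (Vu , χ-branches) , correct
    where
    vars : Fin R → ℕ
    vars i = proj₁ (belongs i)
    φ : ∀ i → Formula [<,+1] (n ^ s) (vars i)
    φ i = proj₁ (proj₂ (belongs i))
    φ-sentence : ∀ i → Sentence (φ i)
    φ-sentence i = proj₁ (proj₂ (proj₂ (belongs i)))
    φ-branches : ∀ i → Alternating k [<,+1] (φ i)
    φ-branches i = proj₂ (proj₁ (proj₂ (proj₂ (proj₂ (belongs i)))))
    L⇔φ : ∀ i W → L (quotient M block (remainder i)) W ⇔ (W ⊨ φ i)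
    L⇔φ i = proj₂ (proj₂ (proj₂ (proj₂ (belongs i))))
    joined = Joinable.join V-joinable vars (λ i → proj₁ (proj₁ (proj₂ (proj₂ (proj₂ (belongs i))))))
    u = proj₁ joined
    Vu = proj₁ (proj₂ joined)
    ι : ∀ i → Fin (vars i) → Fin u
    ι i x = Fin.inject≤ x (proj₂ (proj₂ joined) i)
    module I i = Blocks block (length-word s) (word-injective s) (fromℕ< 1≤s) (toℕ-fromℕ< 1≤s)
      (remainder i) (remainder< i)
    ends : Fin R → Word n → Bool
    ends i z = ⌊ z ≟ʷ reverse (remainder i) ⌋
    decomposition : Fin R → Formula Reg n u
    decomposition i = pred (D- s (fromℕ< (remainder< i))) (modular∈Reg s) [] ∧ lookMax local∈Reg
      (length (remainder i)) (ends i)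
    sat-decomposition : ∀ i {w ρ} → Sat w ρ (decomposition i) ⇔ Decomposes w (remainder i)
    sat-decomposition i {w} = mk⇔ (λ (e , t) → trans e (toℕ-fromℕ< (remainder< i)) ,
      toWitness (to (sat-lookMax local∈Reg _ (ends i)) t))
                                  (λ (e , t) → trans e (sym (toℕ-fromℕ< (remainder< i))) ,
                                    from (sat-lookMax local∈Reg _ (ends i)) (fromWitness t))
    ψ : Fin R → Formula Reg n u
    ψ i = Interpretation.translate (I.interpretation i) (ι i) (const zero) (φ i)
    sat-ψ : ∀ i W → ((concatMap block W ++ remainder i) ⊨ ψ i) ⇔ (W ⊨ φ i)
    sat-ψ i W = Interprets.sat-translate (I.interprets i W) (ι i) (Fin.inject≤-injective _ _ _ _) (const zero) (φ i)
      (predicates-⊤ (φ i)) (λ x∈ → ⊥-elim (φ-sentence i (_ , x∈)))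
    χ : Formula Reg n u
    χ = ⋁ R λ i → decomposition i ∧ ψ i
    decomposition-elementary : ∀ i → Elementary (λ _ → ⊥) (decomposition i)
    decomposition-elementary i = elementary-∧ (elementary-pred (D- s (fromℕ< (remainder< i))) (modular∈Reg s) [])
      (lookMax-elementary local∈Reg _ (ends i))
    χ-sentence : Sentence χ
    χ-sentence = closed⇒sentence (free-⋁ R λ i → free-∧ (proj₂ (decomposition-elementary i))
      (Interpretation.translate-free (I.interpretation i) (ι i) (const zero) (φ i) (λ x∈ → φ-sentence i (_ , x∈))))
    χ-branches : Alternating k Reg χ
    χ-branches = branches-⋁ z≤n pos R {f = λ i → decomposition i ∧ ψ i} λ i → branches-quantifierFree z≤n pos
      (proj₁ (decomposition-elementary i)) ,
      Interpretation.translate-branches (I.interpretation i) (ι i) pos (const zero) closed (φ i) (φ-branches i)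
    summand : ∀ i w → Decomposes w (remainder i) → L M w ⇔ (w ⊨ ψ i)
    summand i w d with decomposes⇒blocks w (remainder i) d
    ... | W , refl = ⇔-sym (L-quotient M block (remainder i) W) ⟨⇔⟩ L⇔φ i W ⟨⇔⟩ ⇔-sym (sat-ψ i W)
    correct : ∀ w → L M w ⇔ (w ⊨ χ)
    correct w = mk⇔
      (λ w∈L → let i , d = decomposes w in from (sat-⋁ R) (i , from (sat-decomposition i) d , to (summand i w d) w∈L))
      (λ t → let i , t′ , t″ = to (sat-⋁ R {λ i → decomposition i ∧ ψ i}) t in
        from (summand i w (to (sat-decomposition i {ρ = const 0}) t′)) t″)

decidable-Reg : ∀ {V} k → Joinable V → Decidable (Restricted V k [<,+1]) → Decidable (Restricted V k Reg)
decidable-Reg {V} k V-joinable dec M =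
  Dec.map′ (quotients-belong V-joinable) (λ belongs i → quotient-belongs belongs (remainder i))
    (all? λ i → dec (quotient M block (remainder i)))
  where open Reduction V k M

unrestricted : Joinable (λ _ → ⊤)
unrestricted = record { join = λ f _ → bound f , tt , ≤bound f }
  where
  bound : ∀ {c} → (Fin c → ℕ) → ℕ
  bound {zero}  f = 0
  bound {suc c} f = f zero ⊔ bound (f ∘ suc)
  ≤bound : ∀ {c} (f : Fin c → ℕ) i → f i ≤ bound f
  ≤bound f zero    = m≤m⊔n (f zero) _
  ≤bound f (suc i) = ≤-trans (≤bound (f ∘ suc) i) (m≤n⊔m (f zero) _)

two : Joinable (_≡ 2)
two = record { join = λ f f≡2 → 2 , refl , λ i → ≤-reflexive (f≡2 i) }

FO²⇔Alternating : ∀ k {K : Language n} → K BelongsTo FO²[ k ] σ ⇔ K BelongsTo Restricted (_≡ 2) k σ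
FO²⇔Alternating k = mk⇔
  (λ (v , φ , s , (v≡2 , a) , e) → v , φ , s , (v≡2 , to (branches⇔ pos φ) a) , e)
  (λ (v , φ , s , (v≡2 , a) , e) → v , φ , s , (v≡2 , from (branches⇔ pos φ) a) , e)

FO²-Reg : ∀ k → Decidable (FO²[ k ] [<,+1]) → Decidable (FO²[ k ] Reg)
FO²-Reg k dec M = Dec.map (⇔-sym (FO²⇔Alternating k))
  (decidable-Reg k two (λ M → Dec.map (FO²⇔Alternating k) (dec M)) M)

BΣ⇔Alternating : σ local → ∀ k {K : Language n} →
  K BelongsTo BΣ (suc k) σ ⇔ K BelongsTo Restricted (λ _ → ⊤) (suc k) σ
BΣ⇔Alternating +1∈σ k = mk⇔
  (λ b → let v , φ , s , a , e = BΣ⇒Alternating k b in v , φ , s , (tt , a) , e)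
  (λ (v , φ , s , (_ , a) , e) → Alternating⇒BΣ k +1∈σ (v , φ , s , a , e))

BΣ-Reg : ∀ k → 1 ≤ k → Decidable (BΣ k [<,+1]) → Decidable (BΣ k Reg)
BΣ-Reg (suc k) _ dec M = Dec.map (⇔-sym (BΣ⇔Alternating local∈Reg k))
  (decidable-Reg (suc k) unrestricted (λ M → Dec.map (BΣ⇔Alternating local∈ k) (dec M)) M)

-- Languages defined by unambiguous factorisations

data Side : Set where
  first last : Side

-- A cut at c factorises a word at its first (or last) letter outside E, which
-- has to be c; the factor on that side is in e, the other one is in f.
data Expression (G : ℕ) : Set where
  none    : Expression G
  only    : Subset G → Expression G
  _∪_ _∩_ : Expression G → Expression G → Expression G
  cut     : Side → (E : Subset G) {c : Fin G} → c Subset.∉ E → (e f : Expression G) → Expression G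

glue : Side → List A → A → List A → List A
glue first u c w = u ++ c ∷ w
glue last  u c w = w ++ c ∷ u

⟪_⟫ᴸ : Expression G → List (Fin G) → Set
⟪ none ⟫ᴸ              u = ⊥
⟪ only E ⟫ᴸ            u = All (Subset._∈ E) u
⟪ e ∪ f ⟫ᴸ             u = ⟪ e ⟫ᴸ u ⊎ ⟪ f ⟫ᴸ u
⟪ e ∩ f ⟫ᴸ             u = ⟪ e ⟫ᴸ u × ⟪ f ⟫ᴸ u
⟪ cut d E {c} _ e f ⟫ᴸ u = ∃[ u₀ ] ∃[ u₁ ] u ≡ glue d u₀ c u₁ × All (Subset._∈ E) u₀ × ⟪ e ⟫ᴸ u₀ × ⟪ f ⟫ᴸ u₁

flip : Side → Side
flip first = last
flip last  = first

mirror : Expression G → Expression G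
mirror none              = none
mirror (only E)          = only E
mirror (e ∪ f)           = mirror e ∪ mirror f
mirror (e ∩ f)           = mirror e ∩ mirror f
mirror (cut d E c∉E e f) = cut (flip d) E c∉E (mirror e) (mirror f)

reverse-glue : ∀ d (u : List A) {c w} → reverse (glue d u c w) ≡ glue (flip d) (reverse u) c (reverse w)
reverse-glue first u {c} {w} = trans (reverse-++ u (c ∷ w)) (trans (cong (_++ reverse u) (unfold-reverse c w))
  (++-assoc (reverse w) _ _))
reverse-glue last  u {c} {w} = trans (reverse-++ w (c ∷ u)) (trans (cong (_++ reverse w) (unfold-reverse c u))
  (++-assoc (reverse u) _ _))

All-reverse⁺ : {P : Pred A 0ℓ} {u : List A} → All P u → All P (reverse u)
All-reverse⁺ Pu = All.tabulate (All.lookup Pu ∘ Any.reverse⁻)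

mirror⁺ : ∀ (e : Expression G) {u} → ⟪ e ⟫ᴸ u → ⟪ mirror e ⟫ᴸ (reverse u)
mirror⁺ (only E) s        = All-reverse⁺ s
mirror⁺ (e ∪ f)  (inj₁ s) = inj₁ (mirror⁺ e s)
mirror⁺ (e ∪ f)  (inj₂ s) = inj₂ (mirror⁺ f s)
mirror⁺ (e ∩ f)  (s , t)  = mirror⁺ e s , mirror⁺ f t
mirror⁺ (cut d E _ e f) (u₀ , u₁ , refl , u₀∈E , s , t) =
  reverse u₀ , reverse u₁ , reverse-glue d u₀ , All-reverse⁺ u₀∈E , mirror⁺ e s , mirror⁺ f t

flip-involutive : ∀ d → flip (flip d) ≡ d
flip-involutive first = refl
flip-involutive last  = refl

mirror-involutive : ∀ (e : Expression G) → mirror (mirror e) ≡ e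
mirror-involutive none     = refl
mirror-involutive (only E) = refl
mirror-involutive (e ∪ f)  = cong₂ _∪_ (mirror-involutive e) (mirror-involutive f)
mirror-involutive (e ∩ f)  = cong₂ _∩_ (mirror-involutive e) (mirror-involutive f)
mirror-involutive (cut d E c∉E e f)
  rewrite flip-involutive d | mirror-involutive e | mirror-involutive f = refl

sem-mirror : ∀ (e : Expression G) u → ⟪ mirror e ⟫ᴸ (reverse u) ⇔ ⟪ e ⟫ᴸ u
sem-mirror e u = mk⇔ (λ s → subst₂ ⟪_⟫ᴸ (mirror-involutive e) (reverse-involutive u)
  (mirror⁺ (mirror e) s)) (mirror⁺ e)

-- The labels stand for residues of positions. They are a parameter because factors and reversals of
-- a word see the residues renumbered.
enrich : ∀ {s} → (ℕ → Fin s) → Word n → List (Fin (n * s))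
enrich label []      = []
enrich label (a ∷ w) = Fin.combine a (label 0) ∷ enrich (label ∘ suc) w

length-enrich : ∀ {s} (label : ℕ → Fin s) (w : Word n) → length (enrich label w) ≡ length w
length-enrich label []      = refl
length-enrich label (a ∷ w) = cong suc (length-enrich (label ∘ suc) w)

enrich-!! : ∀ {s} (label : ℕ → Fin s) (w : Word n) p c →
            enrich label w !! p ≡ just c ⇔ (w !! p ≡ just (proj₁ (Fin.remQuot {n} s c)) × label p
              ≡ proj₂ (Fin.remQuot {n} s c))
enrich-!! label []      zero    c = mk⇔ (λ ()) (λ ())
enrich-!! label []      (suc p) c = mk⇔ (λ ()) (λ ())
enrich-!! {n} {s} label (a ∷ w) zero c = mk⇔
  (λ { refl → cong (just ∘ proj₁) (sym (Fin.remQuot-combine {n} a (label 0))) ,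
    cong proj₂ (sym (Fin.remQuot-combine {n} a (label 0))) })
  (λ (e , e′) → cong just (trans (cong₂ Fin.combine (Maybe.just-injective e) e′) (Fin.combine-remQuot {n} s c)))
enrich-!! label (a ∷ w) (suc p) c = enrich-!! (label ∘ suc) w p c

!!-just⇒< : ∀ (w : List A) p {a} → w !! p ≡ just a → p < length w
!!-just⇒< (_ ∷ w) zero    _ = s≤s z≤n
!!-just⇒< (_ ∷ w) (suc p) e = s≤s (!!-just⇒< w p e)

<⇒!!-just : ∀ (w : List A) p → p < length w → ∃[ a ] w !! p ≡ just a
<⇒!!-just (a ∷ w) zero    _         = a , refl
<⇒!!-just (_ ∷ w) (suc p) (s≤s p<w) = <⇒!!-just w p p<w

All⇔!! : ∀ {P : Pred A 0ℓ} (u : List A) → All P u ⇔ (∀ p {a} → u !! p ≡ just a → P a)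
All⇔!! []      = mk⇔ (λ _ → λ { zero () ; (suc p) () }) (λ _ → [])
All⇔!! (a ∷ u) = mk⇔ (λ { (Pa ∷ Pu) → λ { zero refl → Pa ; (suc p) e → to (All⇔!! u) Pu p e } })
                     (λ h → h 0 refl ∷ from (All⇔!! u) (h ∘ suc))

other : Fin 2 → Fin 2
other zero       = suc zero
other (suc zero) = zero

z≢other : ∀ z → z ≢ other z
z≢other zero       ()
z≢other (suc zero) ()

≢other⇒≡ : ∀ {y} z → y ≢ other z → y ≡ z
≢other⇒≡ {zero}     zero       _ = refl
≢other⇒≡ {suc zero} zero       h = contradiction refl h
≢other⇒≡ {zero}     (suc zero) h = contradiction refl h
≢other⇒≡ {suc zero} (suc zero) _ = refl

before : Side → ℕ → ℕ → Set
before first p q = p < q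
before last  p q = q < p

before-irrefl : ∀ d {p} → ¬ before d p p
before-irrefl first = <-irrefl refl
before-irrefl last  = <-irrefl refl

before-trans : ∀ d {p q r} → before d p q → before d q r → before d p r
before-trans first p<q q<r = <-trans p<q q<r
before-trans last  q<p r<q = <-trans r<q q<p

before-compare : ∀ d p q → before d p q ⊎ p ≡ q ⊎ before d q p
before-compare d p q with d | <-cmp p q
... | first | tri< p<q _ _ = inj₁ p<q
... | last  | tri< p<q _ _ = inj₂ (inj₂ p<q)
... | _     | tri≈ _ p≡q _ = inj₂ (inj₁ p≡q)
... | first | tri> _ _ q<p = inj₂ (inj₂ q<p)
... | last  | tri> _ _ q<p = inj₁ q<p

module FO²-Expressions {n s : ℕ} {{_ : NonZero s}} where

  F : Set
  F = Formula [<,MOD] n 2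

  has : Fin (n * s) → Fin 2 → F
  has c z = letter (proj₁ (Fin.remQuot {n} s c)) z ∧ pred (MOD- s (proj₂ (Fin.remQuot {n} s c)))
    (inj₂ (s , refl)) (z ∷ [])

  inside′ : Subset (n * s) → Fin 2 → F
  inside′ E z = ⋁ (n * s) λ c → ⌜ ⌊ c Subset.∈? E ⌋ ⌝ ∧ has c z

  precedes : Side → Fin 2 → Fin 2 → F
  precedes first y z = pred less (inj₁ refl) (y ∷ z ∷ [])
  precedes last  y z = pred less (inj₁ refl) (z ∷ y ∷ [])

  -- No letter outside E lies strictly between z and the end of the region on side d. The quantifier
  -- reuses the other variable, which is why regions must be given for both.
  clear : Side → Subset (n * s) → (Fin 2 → F) → Fin 2 → F
  clear d E I z = quant ∀′ (other z) (¬′ (I (other z) ∧ precedes d (other z) z) ∨ inside′ E (other z))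

  -- The two sides of the cut. The position of the cut is clear but carries a letter outside E, so
  -- it falls into neither.
  near far : Side → Subset (n * s) → (Fin 2 → F) → Fin 2 → F
  near d E I z = I z ∧ clear d E I z ∧ inside′ E z
  far  d E I z = I z ∧ ¬′ clear d E I z

  -- e relativised to the region I, a formula with one free variable which is
  -- given for both variables
  formula : Expression (n * s) → (Fin 2 → F) → F
  formula none                I = false
  formula (only E)            I = quant ∀′ zero (¬′ I zero ∨ inside′ E zero)
  formula (e ∪ f)             I = formula e I ∨ formula f I
  formula (e ∩ f)             I = formula e I ∧ formula f I
  formula (cut d E {c} _ e f) I = quant ∃′ zero (I zero ∧ has c zero ∧ clear d E I zero) ∧ formula e (near d E I) ∧
    formula f (far d E I)

  private
    Scoped : (Fin 2 → F) → Set₁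
    Scoped I = ∀ z {V : Pred (Fin 2) 0ℓ} → V z → I z FreeIn V

  has-free : ∀ c → Scoped (has c)
  has-free c z Vz = free-∧ (free-letter Vz) (free-pred (Vz ∷ []))

  inside-free : ∀ E → Scoped (inside′ E)
  inside-free E z Vz = free-⋁ (n * s) λ c → free-∧ (free-⌜⌝ ⌊ c Subset.∈? E ⌋) (has-free c z Vz)

  precedes-free : ∀ d {y z} {V : Pred (Fin 2) 0ℓ} → V y → V z → precedes d y z FreeIn V
  precedes-free first Vy Vz = free-pred (Vy ∷ Vz ∷ [])
  precedes-free last  Vy Vz = free-pred (Vz ∷ Vy ∷ [])

  clear-free : ∀ d E {I} → Scoped I → Scoped (clear d E I)
  clear-free d E {I} I-scoped z Vz = free-quant (free-∨
    (free-¬ (free-∧ (I-scoped (other z) (λ z≢z → contradiction refl z≢z))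
      (precedes-free d (λ z≢z → contradiction refl z≢z) (λ _ → Vz))))
    (inside-free E (other z) (λ z≢z → contradiction refl z≢z)))

  near-free : ∀ d E {I} → Scoped I → Scoped (near d E I)
  near-free d E I-scoped z Vz = free-∧ (I-scoped z Vz) (free-∧ (clear-free d E I-scoped z Vz) (inside-free E z Vz))

  far-free : ∀ d E {I} → Scoped I → Scoped (far d E I)
  far-free d E I-scoped z Vz = free-∧ (I-scoped z Vz) (free-¬ (clear-free d E I-scoped z Vz))

  formula-closed : ∀ e {I} → Scoped I → Closed (formula e I)
  formula-closed none     I-scoped = free-false
  formula-closed (only E) I-scoped = free-quant (free-∨ (free-¬ (I-scoped zero (λ z≢z → z≢z refl)))
    (inside-free E zero (λ z≢z → z≢z refl)))
  formula-closed (e ∪ f)  I-scoped = free-∨ (formula-closed e I-scoped) (formula-closed f I-scoped)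
  formula-closed (e ∩ f)  I-scoped = free-∧ (formula-closed e I-scoped) (formula-closed f I-scoped)
  formula-closed (cut d E {c} _ e f) I-scoped = free-∧
    (free-quant (free-∧ (I-scoped zero (λ z≢z → z≢z refl)) (free-∧ (has-free c zero (λ z≢z → z≢z refl))
      (clear-free d E I-scoped zero (λ z≢z → z≢z refl)))))
    (free-∧ (formula-closed e (near-free d E I-scoped)) (formula-closed f (far-free d E I-scoped)))

  residues : ℕ → Fin s
  residues p = p mod s

  module _ (w : Word n) where

    ŵ : List (Fin (n * s))
    ŵ = enrich residues w

    sat-has : ∀ c z {ρ} → Sat w ρ (has c z) ⇔ ŵ !! ρ z ≡ just c
    sat-has c z {ρ} = (⇔-id _ ×-⇔ mk⇔
        (λ e → Fin.toℕ-injective (trans (toℕ-fromℕ< _) (trans (irrelevant (ρ z)) e)))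
        (λ e → trans (sym (irrelevant (ρ z))) (trans (sym (toℕ-fromℕ< _)) (cong toℕ e))))
      ⟨⇔⟩ ⇔-sym (enrich-!! residues w (ρ z) c)
      where
      irrelevant : ∀ p → p % s ≡ _%_ p s {{Fin.nonZeroIndex (proj₂ (Fin.remQuot {n} s c))}}
      irrelevant p = refl

    Inside : Subset (n * s) → ℕ → Set
    Inside E p = ∃[ c ] c Subset.∈ E × ŵ !! p ≡ just c

    sat-inside : ∀ E z {ρ} → Sat w ρ (inside′ E z) ⇔ Inside E (ρ z)
    sat-inside E z {ρ} = sat-⋁ (n * s) ⟨⇔⟩ ∃-cong λ c → (sat-⌜⌝ {b = ⌊ c Subset.∈? E ⌋} ⟨⇔⟩ ⌊⌋-sound)
      ×-⇔ sat-has c z {ρ}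

    sat-precedes : ∀ d y z {ρ} → Sat w ρ (precedes d y z) ⇔ before d (ρ y) (ρ z)
    sat-precedes first y z = ⇔-id _
    sat-precedes last  y z = ⇔-id _

    Region : (Fin 2 → F) → List (Fin (n * s)) → List (Fin (n * s)) → Set
    Region I x u = ∀ z {ρ} → Sat w ρ (I z) ⇔ (length x ≤ ρ z × ρ z < length x + length u)

    length-ŵ : length ŵ ≡ length w
    length-ŵ = length-enrich residues w

    factor-!! : ∀ x u {y} → ŵ ≡ x ++ u ++ y → ∀ {p} → p < length u → ŵ !! (length x + p) ≡ u !! p
    factor-!! x u e {p} p<u = trans (cong (_!! (length x + p)) e) (trans (!!-++ʳ x p) (!!-++ˡ u p<u))

    factor-< : ∀ x u {y} → ŵ ≡ x ++ u ++ y → ∀ {p} → p < length x + length u → p < length w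
    factor-< x u {y} e p< = ≤-trans p<
      (≤-trans (+-monoʳ-≤ (length x) (≤-trans (m≤m+n (length u) (length y)) (≤-reflexive (sym (length-++ u)))))
      (≤-reflexive (trans (sym (length-++ x)) (trans (cong length (sym e)) length-ŵ))))

    within : ∀ {x u : List (Fin (n * s))} {p} → length x ≤ p → p < length x + length u →
      ∃[ i ] i < length u × p ≡ length x + i
    within {x} {u} {p} x≤p p< = p ∸ length x ,
      +-cancelˡ-< (length x) _ _ (subst (_< length x + length u) (sym (m+[n∸m]≡n x≤p)) p<) , sym (m+[n∸m]≡n x≤p)

    All⇔Inside : ∀ E x u {y} → ŵ ≡ x ++ u ++ y →
      All (Subset._∈ E) u ⇔ (∀ p → length x ≤ p → p < length x + length u → Inside E p)
    All⇔Inside E x u e = All⇔!! u ⟨⇔⟩ mk⇔ forth back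
      where
      forth : (∀ p {a} → u !! p ≡ just a → a Subset.∈ E) → ∀ p → length x ≤ p → p < length x + length u → Inside E p
      forth h p x≤p p< with within {x} {u} x≤p p<
      ... | i , i<u , refl with <⇒!!-just u i i<u
      ... | c , u!!i = c , h i u!!i , trans (factor-!! x u e i<u) u!!i
      back : (∀ p → length x ≤ p → p < length x + length u → Inside E p) → ∀ p {a} → u !! p ≡ just a → a Subset.∈ E
      back h i {a} u!!i with h (length x + i) (m≤m+n _ i) (+-monoʳ-< (length x) (!!-just⇒< u i u!!i))
      ... | c , c∈E , ŵ!!p = subst (Subset._∈ E)
        (Maybe.just-injective (trans (sym ŵ!!p) (trans (factor-!! x u e (!!-just⇒< u i u!!i)) u!!i))) c∈E

    sat-only : ∀ E x u {y} {I ρ} → ŵ ≡ x ++ u ++ y → Region I x u →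
      Sat w ρ (quant ∀′ zero (¬′ I zero ∨ inside′ E zero)) ⇔ All (Subset._∈ E) u
    sat-only E x u {I = I} {ρ} e region = mk⇔
      (λ h p x≤p p< → case h (fromℕ< (p<w p<)) of λ
        { (inj₁ ¬I) → contradiction (from (region zero) (subst (length x ≤_) (sym (at p<)) x≤p ,
          subst (_< length x + length u) (sym (at p<)) p<)) ¬I
        ; (inj₂ i) → subst (Inside E) (at p<)
          (to (sat-inside E zero {updateAt ρ zero (const (toℕ (fromℕ< (p<w p<))))}) i) })
      (λ h p → case sat? w (updateAt ρ zero (const (toℕ p))) (I zero) of λ
        { (no ¬i) → inj₁ ¬i
        ; (yes i) → let x≤p , p< = to (region zero) i in
          inj₂ (from (sat-inside E zero {updateAt ρ zero (const (toℕ p))}) (h _ x≤p p<)) })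
      ⟨⇔⟩ ⇔-sym (All⇔Inside E x u e)
      where
      p<w : ∀ {p} → p < length x + length u → p < length w
      p<w = factor-< x u e
      at : ∀ {p} (p< : p < length x + length u) → toℕ (fromℕ< (p<w p<)) ≡ p
      at p< = toℕ-fromℕ< (p<w p<)

    sat-clear : ∀ d E x u I {y} → ŵ ≡ x ++ u ++ y → Region I x u → ∀ z {ρ} →
                Sat w ρ (clear d E I z) ⇔ (∀ p → length x ≤ p → p < length x + length u →
                  before d p (ρ z) → Inside E p)
    sat-clear d E x u I e region z {ρ} = mk⇔
      (λ h p x≤p p< p◁z → let at = trans (updateAt-updates (other z) ρ) (toℕ-fromℕ< (factor-< x u e p<)) in
        case h (fromℕ< (factor-< x u e p<)) of λ
        { (inj₁ ¬I) → contradiction (from (region (other z)) (subst (length x ≤_) (sym at) x≤p ,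
          subst (_< length x + length u) (sym at) p<) ,
            from (sat-precedes d (other z) z {updateAt ρ (other z) (const (toℕ (fromℕ< (factor-< x u e p<))))})
              (subst₂ (before d) (sym at) (sym (updateAt-minimal z (other z) ρ (z≢other z))) p◁z)) ¬I
        ; (inj₂ i) → subst (Inside E) at
          (to (sat-inside E (other z) {updateAt ρ (other z) (const (toℕ (fromℕ< (factor-< x u e p<))))}) i) })
      (λ h p → case sat? w (updateAt ρ (other z) (const (toℕ p))) (I (other z) ∧ precedes d (other z) z) of λ
        { (no ¬i) → inj₁ ¬i
        ; (yes (i , i′)) → let x≤p , p< = to (region (other z)) i in
          inj₂ (from (sat-inside E (other z) {updateAt ρ (other z) (const (toℕ p))})
            (h _ x≤p p< (subst (before d _) (updateAt-minimal z (other z) ρ (z≢other z))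
              (to (sat-precedes d (other z) z {updateAt ρ (other z) (const (toℕ p))}) i′)))) })

    nearStart farStart : Side → (x u₀ : List A) → A → List A → List A
    nearStart first x u₀ c u₁ = x
    nearStart last  x u₀ c u₁ = x ++ u₁ List.∷ʳ c
    farStart  first x u₀ c u₁ = x ++ u₀ List.∷ʳ c
    farStart  last  x u₀ c u₁ = x

    cutPosition : Side → (x u₀ u₁ : List A) → ℕ
    cutPosition first x u₀ u₁ = length x + length u₀
    cutPosition last  x u₀ u₁ = length x + length u₁

    private
      In : List A → List A → ℕ → Set
      In x u p = length x ≤ p × p < length x + length u

      length-start : ∀ (x u : List A) c → length (x ++ u List.∷ʳ c) ≡ suc (length x + length u)
      length-start x u c = trans (length-++ x) (trans (cong (length x +_) (trans (length-++ u) (+-comm (length u) 1)))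
        (+-suc (length x) (length u)))

      left : ∀ (x u : List A) c w q → (In x (u ++ c ∷ w) q × q < length x + length u) ⇔ In x u q
      left x u c w q = mk⇔ (λ ((x≤q , _) , q<) → x≤q , q<)
        (λ (x≤q , q<) → (x≤q , ≤-trans q< (+-monoʳ-≤ (length x)
          (≤-trans (m≤m+n (length u) _) (≤-reflexive (sym (length-++ u)))))) , q<)

      right : ∀ (x u : List A) c w q → (In x (u ++ c ∷ w) q × length x + length u < q) ⇔ In (x ++ u List.∷ʳ c) w q
      right x u c w q = mk⇔
        (λ ((_ , q<) , <q) → ≤-trans (≤-reflexive (length-start x u c)) <q , ≤-trans q< (≤-reflexive end))
        (λ (≤q , q<) → let <q = ≤-trans (≤-reflexive (sym (length-start x u c))) ≤q in
          (≤-trans (≤-trans (m≤m+n (length x) (length u)) (n≤1+n _)) <q , ≤-trans q< (≤-reflexive (sym end))) , <q)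
        where
        end : length x + length (u ++ c ∷ w) ≡ length (x ++ u List.∷ʳ c) + length w
        end = trans (cong (length x +_) (trans (length-++ u) (+-suc (length u) (length w))))
                (trans (+-suc (length x) _) (trans (cong suc (sym (+-assoc (length x) (length u) (length w))))
                  (cong (_+ length w) (sym (length-start x u c)))))

      middle : ∀ (x u : List A) c w → In x (u ++ c ∷ w) (length x + length u)
      middle x u c w = m≤m+n (length x) (length u) ,
        +-monoʳ-< (length x) (≤-trans (m<m+n (length u) (s≤s z≤n)) (≤-reflexive (sym (length-++ u))))

      middle-!! : ∀ (x u : List A) c w {y} → (x ++ (u ++ c ∷ w) ++ y) !! (length x + length u) ≡ just c
      middle-!! x u c w {y} = trans (!!-++ʳ x (length u))
        (trans (!!-++ˡ (u ++ c ∷ w) (≤-trans (m<m+n (length u) (s≤s z≤n)) (≤-reflexive (sym (length-++ u)))))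
        (trans (cong ((u ++ c ∷ w) !!_) (sym (+-identityʳ (length u)))) (!!-++ʳ u 0)))

      reassociate : ∀ (x u : List A) c w y → x ++ (u ++ c ∷ w) ++ y ≡ (x ++ u List.∷ʳ c) ++ w ++ y
      reassociate x u c w y = begin
        x ++ (u ++ c ∷ w) ++ y         ≡⟨ cong (x ++_) (++-assoc u (c ∷ w) y) ⟩
        x ++ u ++ c ∷ w ++ y           ≡⟨ cong (x ++_) (sym (++-assoc u (c ∷ []) (w ++ y))) ⟩
        x ++ (u List.∷ʳ c) ++ w ++ y   ≡⟨ sym (++-assoc x (u List.∷ʳ c) (w ++ y)) ⟩
        (x ++ u List.∷ʳ c) ++ w ++ y   ∎
        where open ≡-Reasoning

    cut-near : ∀ d (x u₀ u₁ : List A) c q → (In x (glue d u₀ c u₁) q × before d q (cutPosition d x u₀ u₁))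
      ⇔ In (nearStart d x u₀ c u₁) u₀ q
    cut-near first x u₀ u₁ c q = left x u₀ c u₁ q
    cut-near last  x u₀ u₁ c q = right x u₁ c u₀ q

    cut-far : ∀ d (x u₀ u₁ : List A) c q → (In x (glue d u₀ c u₁) q × before d (cutPosition d x u₀ u₁) q)
      ⇔ In (farStart d x u₀ c u₁) u₁ q
    cut-far first x u₀ u₁ c q = right x u₀ c u₁ q
    cut-far last  x u₀ u₁ c q = left x u₁ c u₀ q

    cut-in : ∀ d (x u₀ u₁ : List A) c → In x (glue d u₀ c u₁) (cutPosition d x u₀ u₁)
    cut-in first x u₀ u₁ c = middle x u₀ c u₁
    cut-in last  x u₀ u₁ c = middle x u₁ c u₀

    cut-!! : ∀ d (x u₀ u₁ : List A) c {y} → (x ++ glue d u₀ c u₁ ++ y) !! cutPosition d x u₀ u₁ ≡ just c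
    cut-!! first x u₀ u₁ c = middle-!! x u₀ c u₁
    cut-!! last  x u₀ u₁ c = middle-!! x u₁ c u₀

    near-factor : ∀ d (x u₀ u₁ : List A) c y → ∃[ y′ ] x ++ glue d u₀ c u₁ ++ y ≡ nearStart d x u₀ c u₁ ++ u₀ ++ y′
    near-factor first x u₀ u₁ c y = c ∷ u₁ ++ y , cong (x ++_) (++-assoc u₀ (c ∷ u₁) y)
    near-factor last  x u₀ u₁ c y = y , reassociate x u₁ c u₀ y

    far-factor : ∀ d (x u₀ u₁ : List A) c y → ∃[ y′ ] x ++ glue d u₀ c u₁ ++ y ≡ farStart d x u₀ c u₁ ++ u₁ ++ y′
    far-factor first x u₀ u₁ c y = y , reassociate x u₀ c u₁ y
    far-factor last  x u₀ u₁ c y = c ∷ u₀ ++ y , cong (x ++_) (++-assoc u₁ (c ∷ u₀) y)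

    split-at : ∀ (u : List A) i {c} → u !! i ≡ just c → u ≡ take i u ++ c ∷ drop (suc i) u × length (take i u) ≡ i
    split-at (a ∷ u) zero    refl = refl , refl
    split-at (a ∷ u) (suc i) e    = let e₁ , e₂ = split-at u i e in cong (a ∷_) e₁ , cong suc e₂

    split-glue : ∀ d (x u : List A) {y p c} → In x u p → (x ++ u ++ y) !! p ≡ just c →
                 ∃[ u₀ ] ∃[ u₁ ] u ≡ glue d u₀ c u₁ × p ≡ cutPosition d x u₀ u₁
    split-glue d x u {y} {p} {c} (x≤p , p<) e with split-at u (p ∸ length x) u!!
      where
      i<u : p ∸ length x < length u
      i<u = +-cancelˡ-< (length x) _ _ (subst (_< length x + length u) (sym (m+[n∸m]≡n x≤p)) p<)
      u!! : u !! (p ∸ length x) ≡ just c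
      u!! = trans (sym (!!-++ˡ u i<u)) (trans (sym (!!-++ʳ x (p ∸ length x)))
        (trans (cong ((x ++ u ++ y) !!_) (m+[n∸m]≡n x≤p)) e))
    split-glue first x u (x≤p , _) e | e₁ , e₂ = _ , _ , e₁ ,
      trans (sym (m+[n∸m]≡n x≤p)) (cong (length x +_) (sym e₂))
    split-glue last  x u (x≤p , _) e | e₁ , e₂ = _ , _ , e₁ ,
      trans (sym (m+[n∸m]≡n x≤p)) (cong (length x +_) (sym e₂))

    module _ (d : Side) (E : Subset (n * s)) {c : Fin (n * s)} (c∉E : c Subset.∉ E) (x u₀ u₁ : List (Fin (n * s)))
      {y : List (Fin (n * s))} {I : Fin 2 → F}
             (e : ŵ ≡ x ++ glue d u₀ c u₁ ++ y) (region : Region I x (glue d u₀ c u₁)) where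

      private
        P : ℕ
        P = cutPosition d x u₀ u₁

        ¬InsideP : ¬ Inside E P
        ¬InsideP (b , b∈E , e′) = c∉E (subst (Subset._∈ E)
          (Maybe.just-injective (trans (sym e′) (trans (cong (_!! P) e) (cut-!! d x u₀ u₁ c)))) b∈E)

      module _ (near⊆E : ∀ p → In x (glue d u₀ c u₁) p → before d p P → Inside E p) where

        private
          Clear : ℕ → Set
          Clear q = ∀ p → length x ≤ p → p < length x + length (glue d u₀ c u₁) → before d p q → Inside E p

          -- The letter at the cut P is outside E, so nothing beyond P is clear; conversely,
          -- everything up to P is clear because the near factor is over E.
          clear⇒ : ∀ {q} → Clear q → ¬ before d P q
          clear⇒ h P◁q = ¬InsideP (h P (proj₁ (cut-in d x u₀ u₁ c)) (proj₂ (cut-in d x u₀ u₁ c)) P◁q)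

          ⇒clear : ∀ {q} → ¬ before d P q → Clear q
          ⇒clear {q} ¬P◁q p x≤p p< p◁q with before-compare d P q
          ... | inj₁ P◁q        = contradiction P◁q ¬P◁q
          ... | inj₂ (inj₁ refl) = near⊆E p (x≤p , p<) p◁q
          ... | inj₂ (inj₂ q◁P) = near⊆E p (x≤p , p<) (before-trans d p◁q q◁P)

        near-region : Region (near d E I) (nearStart d x u₀ c u₁) u₀
        near-region z {ρ} = (region z ×-⇔ (sat-clear d E x (glue d u₀ c u₁) I e region z {ρ} ×-⇔ sat-inside E z {ρ}))
          ⟨⇔⟩ mk⇔ forth back ⟨⇔⟩ cut-near d x u₀ u₁ c (ρ z)
          where
          forth : In x (glue d u₀ c u₁) (ρ z) × Clear (ρ z) × Inside E (ρ z) →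
            In x (glue d u₀ c u₁) (ρ z) × before d (ρ z) P
          forth (i , cl , ins) with before-compare d (ρ z) P
          ... | inj₁ z◁P        = i , z◁P
          ... | inj₂ (inj₁ z≡P) = contradiction (subst (Inside E) z≡P ins) ¬InsideP
          ... | inj₂ (inj₂ P◁z) = contradiction P◁z (clear⇒ cl)
          back : In x (glue d u₀ c u₁) (ρ z) × before d (ρ z) P →
            In x (glue d u₀ c u₁) (ρ z) × Clear (ρ z) × Inside E (ρ z)
          back (i , z◁P) = i , ⇒clear (λ P◁z → before-irrefl d (before-trans d P◁z z◁P)) , near⊆E (ρ z) i z◁P

        far-region : Region (far d E I) (farStart d x u₀ c u₁) u₁
        far-region z {ρ} = (region z ×-⇔ ¬-cong-⇔ (sat-clear d E x (glue d u₀ c u₁) I e region z {ρ}))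
          ⟨⇔⟩ mk⇔ forth back ⟨⇔⟩ cut-far d x u₀ u₁ c (ρ z)
          where
          forth : In x (glue d u₀ c u₁) (ρ z) × ¬ Clear (ρ z) → In x (glue d u₀ c u₁) (ρ z) × before d P (ρ z)
          forth (i , ¬cl) with before-compare d P (ρ z)
          ... | inj₁ P◁z        = i , P◁z
          ... | inj₂ (inj₁ P≡z) = contradiction (⇒clear (λ P◁z → before-irrefl d (subst (before d P) (sym P≡z) P◁z)))
            ¬cl
          ... | inj₂ (inj₂ z◁P) = contradiction (⇒clear (λ P◁z → before-irrefl d (before-trans d P◁z z◁P))) ¬cl
          back : In x (glue d u₀ c u₁) (ρ z) × before d P (ρ z) → In x (glue d u₀ c u₁) (ρ z) × ¬ Clear (ρ z)
          back (i , P◁z) = i , λ cl → clear⇒ cl P◁z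

    sat-formula : ∀ e x u {y I ρ} → ŵ ≡ x ++ u ++ y → Region I x u → Sat w ρ (formula e I) ⇔ ⟪ e ⟫ᴸ u
    sat-formula none     x u e region = ⇔-id _
    sat-formula (only E) x u {y} {I} e region = sat-only E x u {y} {I} e region
    sat-formula (f ∪ g)  x u {y} {I} e region = sat-formula f x u {y} {I} e region ⊎-⇔ sat-formula g x
      u {y} {I} e region
    sat-formula (f ∩ g)  x u {y} {I} e region = sat-formula f x u {y} {I} e region ×-⇔ sat-formula g x
      u {y} {I} e region
    sat-formula (cut d E {c} c∉E f g) x u {y} {I} {ρ} e region = mk⇔ forth back
      where
      factors : ∀ u₀ u₁ → u ≡ glue d u₀ c u₁ →
        (∀ p → In x (glue d u₀ c u₁) p → before d p (cutPosition d x u₀ u₁) → Inside E p) →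
                (Sat w ρ (formula f (near d E I)) ⇔ ⟪ f ⟫ᴸ u₀) × (Sat w ρ (formula g (far d E I)) ⇔ ⟪ g ⟫ᴸ u₁)
      factors u₀ u₁ refl h =
        sat-formula f (nearStart d x u₀ c u₁) u₀ (trans e (proj₂ (near-factor d x u₀ u₁ c y)))
          (near-region d E c∉E x u₀ u₁ {y} {I} e region h) ,
        sat-formula g (farStart d x u₀ c u₁) u₁ (trans e (proj₂ (far-factor d x u₀ u₁ c y)))
          (far-region d E c∉E x u₀ u₁ {y} {I} e region h)
      all⇔ : ∀ u₀ u₁ → u ≡ glue d u₀ c u₁ → All (Subset._∈ E) u₀ ⇔ (∀ p → In x (glue d u₀ c u₁) p →
        before d p (cutPosition d x u₀ u₁) → Inside E p)
      all⇔ u₀ u₁ refl = All⇔Inside E (nearStart d x u₀ c u₁) u₀ (trans e (proj₂ (near-factor d x u₀ u₁ c y))) ⟨⇔⟩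
        mk⇔ (λ h p i p◁P → let ≤p , p< = to (cut-near d x u₀ u₁ c p) (i , p◁P) in h p ≤p p<)
            (λ h p ≤p p< → let i , p◁P = from (cut-near d x u₀ u₁ c p) (≤p , p<) in h p i p◁P)
      forth : Sat w ρ (formula (cut d E c∉E f g) I) → ⟪ cut d E c∉E f g ⟫ᴸ u
      forth ((p , i , h , cl) , s , t) with split-glue d x u {y} (to (region zero) i)
        (trans (cong (_!! toℕ p) (sym e)) (to (sat-has c zero {updateAt ρ zero (const (toℕ p))}) h))
      ... | u₀ , u₁ , refl , p≡ = u₀ , u₁ , refl , from (all⇔ u₀ u₁ refl) near⊆E ,
        to (proj₁ (factors u₀ u₁ refl near⊆E)) s , to (proj₂ (factors u₀ u₁ refl near⊆E)) t
        where
        near⊆E : ∀ q → In x (glue d u₀ c u₁) q → before d q (cutPosition d x u₀ u₁) → Inside E q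
        near⊆E q (x≤q , q<) q◁P = to (sat-clear d E x u I e region zero {updateAt ρ zero (const (toℕ p))}) cl q x≤q q<
          (subst (before d q) (sym p≡) q◁P)
      back : ⟪ cut d E c∉E f g ⟫ᴸ u → Sat w ρ (formula (cut d E c∉E f g) I)
      back (u₀ , u₁ , refl , u₀∈E , s , t) = (fromℕ< P<w ,
        from (region zero) (subst (In x u) (sym at) (cut-in d x u₀ u₁ c)) ,
          from (sat-has c zero {updateAt ρ zero (const (toℕ (fromℕ< P<w)))})
            (trans (cong (ŵ !!_) at) (trans (cong (_!! cutPosition d x u₀ u₁) e) (cut-!! d x u₀ u₁ c))) ,
          from (sat-clear d E x u I e region zero {updateAt ρ zero (const (toℕ (fromℕ< P<w)))}) (λ q x≤q q< q◁P →
            near⊆E q (x≤q , q<) (subst (before d q) at q◁P))) ,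
          from (proj₁ (factors u₀ u₁ refl near⊆E)) s , from (proj₂ (factors u₀ u₁ refl near⊆E)) t
        where
        near⊆E = to (all⇔ u₀ u₁ refl) u₀∈E
        P<w : cutPosition d x u₀ u₁ < length w
        P<w = factor-< x u e (proj₂ (cut-in d x u₀ u₁ c))
        at : toℕ (fromℕ< P<w) ≡ cutPosition d x u₀ u₁
        at = toℕ-fromℕ< P<w

    -- Every position carries some enriched letter, so `inside′ Subset.⊤` defines the whole word as
    -- a region.
    sat-expression : ∀ e → (w ⊨ formula e (inside′ Subset.⊤)) ⇔ ⟪ e ⟫ᴸ ŵ
    sat-expression e = sat-formula e [] ŵ {y = []} (sym (++-identityʳ ŵ)) λ z {ρ} → sat-inside Subset.⊤ z {ρ} ⟨⇔⟩
      mk⇔ (λ (c , _ , e) → z≤n , !!-just⇒< ŵ (ρ z) e) (λ (_ , p<) → let c , e = <⇒!!-just ŵ (ρ z) p< in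
        c , Subset.∈⊤ , e)

  expression-closed : ∀ e → Closed (formula e (inside′ Subset.⊤))
  expression-closed e = formula-closed e (inside-free Subset.⊤)

-- Residues and reversal

infix 4 _≋_[mod_]
record _≋_[mod_] (p q s : ℕ) {{_ : NonZero s}} : Set where
  constructor residue
  field
    sameResidue : p % s ≡ q % s

open _≋_[mod_]

module _ {s : ℕ} {{_ : NonZero s}} where

  mod-reflexive : ∀ {p q} → p ≡ q → p ≋ q [mod s ]
  mod-reflexive e = residue (cong (_% s) e)

  mod-sym : ∀ {p q} → p ≋ q [mod s ] → q ≋ p [mod s ]
  mod-sym (residue e) = residue (sym e)

  mod-trans : ∀ {p q r} → p ≋ q [mod s ] → q ≋ r [mod s ] → p ≋ r [mod s ]
  mod-trans (residue e) (residue e′) = residue (trans e e′)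

  mod-+ : ∀ {p p′ q q′} → p ≋ p′ [mod s ] → q ≋ q′ [mod s ] → p + q ≋ p′ + q′ [mod s ]
  mod-+ {p} {p′} {q} {q′} (residue e) (residue e′) =
    residue (trans (%-distribˡ-+ p q s) (trans (cong₂ (λ a b → (a + b) % s) e e′) (sym (%-distribˡ-+ p′ q′ s))))

  mod-+ˡ : ∀ k {p q} → p ≋ q [mod s ] → k + p ≋ k + q [mod s ]
  mod-+ˡ k = mod-+ (mod-reflexive {k} refl)

  mod-+* : ∀ p k → p + k * s ≋ p [mod s ]
  mod-+* p k = residue ([m+kn]%n≡m%n p k s)

  suc[s-1] : suc (s ∸ 1) ≡ s
  suc[s-1] = m+[n∸m]≡n (>-nonZero⁻¹ s)

  -- s ∸ 1 stands for −1.
  mod-inverse : ∀ p k → p + (s ∸ 1) * k + k ≋ p [mod s ]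
  mod-inverse p k = mod-trans (mod-reflexive (trans (rearrange p (s ∸ 1) k) (cong (λ t → p + k * t) suc[s-1])))
    (mod-+* p k)
    where
    rearrange : ∀ p t k → p + t * k + k ≡ p + k * suc t
    rearrange = solve-∀

  mod-cancelˡ : ∀ k {p q} → k + p ≋ k + q [mod s ] → p ≋ q [mod s ]
  mod-cancelˡ k {p} {q} e = mod-trans (mod-sym (shift p)) (mod-trans (mod-+ˡ ((s ∸ 1) * k) e) (shift q))
    where
    rearrange : ∀ p t k → t * k + (k + p) ≡ p + t * k + k
    rearrange = solve-∀
    shift : ∀ p → (s ∸ 1) * k + (k + p) ≋ p [mod s ]
    shift p = mod-trans (mod-reflexive (rearrange p (s ∸ 1) k)) (mod-inverse p k)

  mod-cancelʳ : ∀ k {p q} → p + k ≋ q + k [mod s ] → p ≋ q [mod s ]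
  mod-cancelʳ k {p} {q} e = mod-cancelˡ k (mod-trans (mod-reflexive (+-comm k p))
    (mod-trans e (mod-reflexive (+-comm q k))))

  -- An arbitrary numbering of the residues. Passing to a suffix or to the reversal leads from one
  -- such labelling to another, so inductions have to range over all of them.
  Faithful : (ℕ → Fin s) → Set
  Faithful label = ∀ {p q} → label p ≡ label q ⇔ p ≋ q [mod s ]

  shift-faithful : ∀ {label} k → Faithful label → Faithful (label ∘ (k +_))
  shift-faithful k faithful = faithful ⟨⇔⟩ mk⇔ (mod-cancelˡ k) (mod-+ˡ k)

-- Residues of the positions of the reversal of a word of length l
backwards : ∀ {s} {{_ : NonZero s}} → ℕ → (ℕ → Fin s) → ℕ → Fin s
backwards {s} l label p = label (l + (s ∸ 1) * suc p)

module _ {s : ℕ} {{_ : NonZero s}} where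

  backwards-faithful : ∀ {label : ℕ → Fin s} l → Faithful label → Faithful (backwards l label)
  backwards-faithful l faithful {p} {q} = faithful ⟨⇔⟩ mk⇔
    (λ e → mod-sym (mod-cancelˡ 1 (mod-cancelˡ l
      (mod-trans (mod-sym (add p q)) (mod-trans (mod-+ e (mod-reflexive (+-comm (suc p) (suc q)))) (add q p))))))
    (λ e → mod-cancelʳ (suc p + suc q) (mod-trans (add p q) (mod-trans (mod-+ˡ l (mod-+ˡ 1 (mod-sym e)))
      (mod-trans (mod-sym (add q p)) (mod-reflexive (cong (l + (s ∸ 1) * suc q +_) (+-comm (suc q) (suc p))))))))
    where
    rearrange : ∀ l t x y → l + t * x + (x + y) ≡ l + y + t * x + x
    rearrange = solve-∀
    add : ∀ p q → l + (s ∸ 1) * suc p + (suc p + suc q) ≋ l + suc q [mod s ]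
    add p q = mod-trans (mod-reflexive (rearrange l (s ∸ 1) (suc p) (suc q))) (mod-inverse (l + suc q) (suc p))

  enrich-cong : ∀ {label label′ : ℕ → Fin s} (u : Word n) → (∀ p → p < length u → label p ≡ label′ p) →
    enrich label u ≡ enrich label′ u
  enrich-cong []      h = refl
  enrich-cong (a ∷ u) h = cong₂ _∷_ (cong (Fin.combine a) (h 0 (s≤s z≤n))) (enrich-cong u λ p p<u →
    h (suc p) (s≤s p<u))

  enrich-++ : ∀ (label : ℕ → Fin s) (u w : Word n) →
    enrich label (u ++ w) ≡ enrich label u ++ enrich (label ∘ (length u +_)) w
  enrich-++ label []      w = refl
  enrich-++ label (a ∷ u) w = cong (Fin.combine a (label 0) ∷_) (enrich-++ (label ∘ suc) u w)

  -- Position p of the reversal is position l - 1 - p of u, and its label depends on l modulo s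
  -- only. One relabelling thus serves all words whose lengths share a residue.
  reverse-enrich : ∀ {label : ℕ → Fin s} → Faithful label → ∀ l (u : Word n) → length u ≋ l [mod s ] →
                   reverse (enrich label u) ≡ enrich (backwards l label) (reverse u)
  reverse-enrich {label = label} faithful l [] e = refl
  reverse-enrich {n} {label = label} faithful l (a ∷ u) e = begin
    reverse (Fin.combine a (label 0) ∷ enrich (label ∘ suc) u)                 ≡⟨ unfold-reverse
      (Fin.combine a (label 0)) (enrich (label ∘ suc) u) ⟩
    reverse (enrich (label ∘ suc) u) ++ Fin.combine a (label 0) ∷ []           ≡⟨ cong₂
      (λ v c → v ++ Fin.combine a c ∷ []) tail head′ ⟩
    enrich (backwards l label) (reverse u) ++ enrich (backwards l label ∘ (length (reverse u) +_)) (a ∷ []) ≡⟨ sym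
      (enrich-++ (backwards l label) (reverse u) (a ∷ [])) ⟩
    enrich (backwards l label) (reverse u List.∷ʳ a)                           ≡⟨ cong (enrich (backwards l label))
      (sym (unfold-reverse a u)) ⟩
    enrich (backwards l label) (reverse (a ∷ u))                               ∎
    where
    open ≡-Reasoning
    -- This is l - 1 modulo s, the length of the tail; the tail's labels are shifted by one, which
    -- compensates for it.
    l′ = l + (s ∸ 1)
    rearrange : ∀ l t x → suc (l + t + x) ≡ l + x + 1 * suc t
    rearrange = solve-∀
    rearrange′ : ∀ l t → l + 1 * suc t ≡ suc l + t
    rearrange′ = solve-∀
    e′ : length u ≋ l′ [mod s ]
    e′ = mod-trans (mod-sym (mod-+* (length u) 1))
      (mod-trans (mod-reflexive (trans (cong (λ t → length u + 1 * t) (sym suc[s-1]))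
      (rearrange′ (length u) (s ∸ 1))))
           (mod-+ e (mod-reflexive refl)))
    tail : reverse (enrich (label ∘ suc) u) ≡ enrich (backwards l label) (reverse u)
    tail = trans (reverse-enrich (shift-faithful 1 faithful) l′ u e′) (enrich-cong (reverse u) λ p _ → from faithful
      (mod-trans (mod-reflexive (trans (rearrange l (s ∸ 1) ((s ∸ 1) * suc p))
        (cong (λ t → l + (s ∸ 1) * suc p + 1 * t) suc[s-1]))) (mod-+* _ 1)))
    head′ : label 0 ≡ backwards l label (length (reverse u) + 0)
    head′ = from faithful (mod-sym (mod-cancelʳ (suc (length u)) (mod-trans
      (mod-trans (mod-reflexive (cong (λ t → l + (s ∸ 1) * suc t + suc (length u))
        (trans (+-identityʳ _) (length-reverse u)))) (mod-inverse l (suc (length u))))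
      (mod-sym e))))

-- Powers, short representatives and finite unions

power : ℕ → List A → List A
power zero    u = []
power (suc k) u = u ++ power k u

power-+ : ∀ j k (u : List A) → power (j + k) u ≡ power j u ++ power k u
power-+ zero    k u = refl
power-+ (suc j) k u = trans (cong (u ++_) (power-+ j k u)) (sym (++-assoc u (power j u) (power k u)))

power-comm : ∀ k (u : List A) → power k u ++ u ≡ u ++ power k u
power-comm zero    u = sym (++-identityʳ u)
power-comm (suc k) u = trans (++-assoc u (power k u) u) (cong (u ++_) (power-comm k u))

reverse-power : ∀ k (u : List A) → reverse (power k u) ≡ power k (reverse u)
reverse-power zero    u = refl
reverse-power (suc k) u = trans (reverse-++ u (power k u)) (trans (cong (_++ reverse u) (reverse-power k u))
  (power-comm k (reverse u)))

-- Among the prefixes of lengths 0 to N of a longer word, two have the same value, and the factor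
-- between them can be cut out.
shorten : ∀ {N} (κ : Word n → Fin N) → (∀ {u u′} v → κ u ≡ κ u′ → κ (u ++ v) ≡ κ (u′ ++ v)) →
          ∀ u → Σ[ v ∈ Word n ] length v < N × κ v ≡ κ u
shorten {N = N} κ compatible u = <-rec (λ l → ∀ u → length u ≡ l → Σ[ v ∈ Word _ ] length v < N × κ v ≡ κ u) step
  (length u) u refl
  where
  step : ∀ l → (∀ {k} → k < l → ∀ u → length u ≡ k → Σ[ v ∈ Word _ ] length v < N × κ v ≡ κ u) →
         ∀ u → length u ≡ l → Σ[ v ∈ Word _ ] length v < N × κ v ≡ κ u
  step l rec u refl with length u <? N
  ... | yes u<N = u , u<N , refl
  ... | no  u≮N with Fin.pigeonhole (n<1+n N) (λ i → κ (take (toℕ i) u))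
  ... | i , j , i<j , e =
    let v , v<N , κv = rec shorter′ u′ refl
    in v , v<N , trans κv (trans (compatible (drop (toℕ j) u) e) (cong κ (take++drop≡id (toℕ j) u)))
    where
    j≤u : toℕ j ≤ length u
    j≤u = ≤-trans (≤-pred (toℕ<n j)) (≮⇒≥ u≮N)
    u′ = take (toℕ i) u ++ drop (toℕ j) u
    shorter′ : length u′ < length u
    shorter′ = begin-strict
      length u′                                  ≡⟨ length-++ (take (toℕ i) u) ⟩
      length (take (toℕ i) u) + length (drop (toℕ j) u) ≤⟨ +-monoˡ-≤ _
        (≤-trans (≤-reflexive (List.length-take (toℕ i) u)) (m⊓n≤m (toℕ i) _)) ⟩
      toℕ i + length (drop (toℕ j) u)            <⟨ +-monoˡ-< _ i<j ⟩
      toℕ j + length (drop (toℕ j) u)            ≡⟨ cong (toℕ j +_) (List.length-drop (toℕ j) u) ⟩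
      toℕ j + (length u ∸ toℕ j)                 ≡⟨ m+[n∸m]≡n j≤u ⟩
      length u                                   ∎
      where open ≤-Reasoning

anyWord? : ∀ k {P : Pred (Word n) 0ℓ} → (∀ u → Dec (P u)) → Dec (∃[ u ] length u < k × P u)
anyWord? {n} k {P} P? = Dec.map′
  (λ (i , p) → lookup (shorter n k) i , ∈-shorter⁻ (∈-lookup {xs = shorter n k} i) , p)
  (λ (u , u<k , p) → let u∈ = ∈-shorter⁺ {u = u} u<k in index u∈ , subst P (Any.lookup-index u∈) p)
  (any? λ i → P? (lookup (shorter n k) i))

⋃ : ∀ c → (Fin c → Expression G) → Expression G
⋃ zero    f = none
⋃ (suc c) f = f zero ∪ ⋃ c (f ∘ suc)

sem-⋃ : ∀ c (f : Fin c → Expression G) {u} → ⟪ ⋃ c f ⟫ᴸ u ⇔ (∃[ i ] ⟪ f i ⟫ᴸ u)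
sem-⋃ zero    f = mk⇔ (λ ()) (λ ())
sem-⋃ (suc c) f = mk⇔ [ (zero ,_) , (λ s → let i , t = to (sem-⋃ c (f ∘ suc)) s in suc i , t) ]′
  λ { (zero , s) → inj₁ s ; (suc i , s) → inj₂ (from (sem-⋃ c (f ∘ suc)) (i , s)) }

when : Dec A → (A → Expression G) → Expression G
when (yes a) f = f a
when (no  _) f = none

sem-when⁻ : (A? : Dec A) (f : A → Expression G) {u : List (Fin G)} → ⟪ when A? f ⟫ᴸ u → Σ[ a ∈ A ] ⟪ f a ⟫ᴸ u
sem-when⁻ (yes a) f s = a , s

sem-when⁺ : (A? : Dec A) (f : A → Expression G) {u : List (Fin G)} → A → (∀ a → ⟪ f a ⟫ᴸ u) → ⟪ when A? f ⟫ᴸ u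
sem-when⁺ (yes a) f _ s = s a
sem-when⁺ (no ¬a) f a s = contradiction a ¬a

-- The values of words under a congruence of finite index satisfying, on words
-- of lengths divisible by s, the identities (xy)^ω y (xy)^ω = (xy)^ω =
-- (xy)^ω x (xy)^ω of the variety DA.
record DA (n s : ℕ) {{s≢0 : NonZero s}} {N : ℕ} (κ : Word n → Fin N) : Set where
  field
    ++-cong : ∀ {u u′ v v′} → κ u ≡ κ u′ → κ v ≡ κ v′ → κ (u ++ v) ≡ κ (u′ ++ v′)
    length-cong : ∀ {u v} → κ u ≡ κ v → length u ≋ length v [mod s ]
    identity : ∀ X Y → length X ≋ 0 [mod s ] → length Y ≋ 0 [mod s ] → ∃[ ω ]
      (let e = power ω (X ++ Y) in κ (e ++ e) ≡ κ e × κ (e ++ Y ++ e) ≡ κ e × κ (e ++ X ++ e) ≡ κ e)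

module _ {n s N : ℕ} {{_ : NonZero s}} {κ : Word n → Fin N} where

  -- Reversal exchanges the two sandwich identities, with x and y swapped. So whatever is proved for
  -- 𝓡-classes applies to 𝓛-classes.
  reverse-DA : DA n s κ → DA n s (κ ∘ reverse)
  reverse-DA da = record
    { ++-cong = λ {u} {u′} {v} {v′} e e′ → trans (cong κ (reverse-++ u v))
      (trans (++-cong {reverse v} {reverse v′} e′ e) (cong κ (sym (reverse-++ u′ v′))))
    ; length-cong = λ {u} {v} e → mod-trans (mod-reflexive (sym (length-reverse u)))
      (mod-trans (length-cong e) (mod-reflexive (length-reverse v)))
    ; identity = λ X Y X≋0 Y≋0 →
        let ω , ee , eYe , eXe = identity (reverse Y) (reverse X) (mod-trans (mod-reflexive (length-reverse Y)) Y≋0)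
              (mod-trans (mod-reflexive (length-reverse X)) X≋0)
            e = power ω (X ++ Y)
            e≡ = trans (reverse-power ω (X ++ Y)) (cong (power ω) (reverse-++ X Y))
            sandwich : ∀ u → reverse (e ++ u ++ e) ≡ power ω (reverse Y ++ reverse X) ++ reverse u ++ power ω
              (reverse Y ++ reverse X)
            sandwich u = trans (reverse-++ e (u ++ e))
              (trans (cong₂ _++_ (trans (reverse-++ u e) (cong (_++ reverse u) e≡)) e≡)
              (++-assoc (power ω (reverse Y ++ reverse X)) (reverse u) (power ω (reverse Y ++ reverse X))))
        in ω , trans (cong κ (trans (reverse-++ e e) (cong₂ _++_ e≡ e≡))) (trans ee (cong κ (sym e≡))) ,
           trans (cong κ (sandwich Y)) (trans eXe (cong κ (sym e≡))) ,
             trans (cong κ (sandwich X)) (trans eYe (cong κ (sym e≡)))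
    }
    where open DA da

-- Green's relation 𝓡 and the letters that stay in a class

module Reach {n s N : ℕ} {{_ : NonZero s}} {κ : Word n → Fin N} (da : DA n s κ) where

  open DA da

  infix 4 _≈_ _⊒_ _𝓡_
  _≈_ : Word n → Word n → Set
  u ≈ v = κ u ≡ κ v

  ++-congˡ : ∀ u {v v′} → v ≈ v′ → u ++ v ≈ u ++ v′
  ++-congˡ u e = ++-cong {u} refl e

  ++-congʳ : ∀ {u u′} v → u ≈ u′ → u ++ v ≈ u′ ++ v
  ++-congʳ v e = ++-cong e refl

  assoc : ∀ u v w → (u ++ v) ++ w ≈ u ++ (v ++ w)
  assoc u v w = cong κ (++-assoc u v w)

  short : ∀ u → Σ[ v ∈ Word n ] length v < N × v ≈ u
  short = shorten κ ++-congʳ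

  -- An invariant property needs to be tested only on the finitely many words shorter than N, which
  -- represent all values.
  ∃? : ∀ {P : Pred (Word n) 0ℓ} → (∀ {u v} → u ≈ v → P u → P v) → (∀ u → Dec (P u)) → Dec (∃ P)
  ∃? resp-≈ P? = Dec.map′ (λ (u , _ , p) → u , p) (λ (u , p) → let v , v<N , e = short u in v , v<N ,
    resp-≈ (sym e) p) (anyWord? N P?)

  -- The preorder of right divisibility, and Green's relation 𝓡
  _⊒_ _𝓡_ : Word n → Word n → Set
  u ⊒ v = ∃[ z ] u ++ z ≈ v
  u 𝓡 v = u ⊒ v × v ⊒ u

  ⊒-refl : ∀ {u} → u ⊒ u
  ⊒-refl {u} = [] , cong κ (++-identityʳ u)

  ⊒-trans : ∀ {u v w} → u ⊒ v → v ⊒ w → u ⊒ w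
  ⊒-trans {u} (z , e) (z′ , e′) = z ++ z′ , trans (sym (assoc u z z′)) (trans (++-congʳ z′ e) e′)

  ⊒-++ : ∀ u z → u ⊒ u ++ z
  ⊒-++ u z = z , refl

  ≈⇒⊒ : ∀ {u v} → u ≈ v → u ⊒ v
  ≈⇒⊒ {u} e = [] , trans (cong κ (++-identityʳ u)) e

  _⊒?_ : ∀ u v → Dec (u ⊒ v)
  u ⊒? v = ∃? (λ e p → trans (++-congˡ u (sym e)) p) (λ z → κ (u ++ z) Fin.≟ κ v)

  𝓡-refl : ∀ {u} → u 𝓡 u
  𝓡-refl = ⊒-refl , ⊒-refl

  𝓡-sym : ∀ {u v} → u 𝓡 v → v 𝓡 u
  𝓡-sym (r , r′) = r′ , r

  𝓡-trans : ∀ {u v w} → u 𝓡 v → v 𝓡 w → u 𝓡 w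
  𝓡-trans (r , r′) (t , t′) = ⊒-trans r t , ⊒-trans t′ r′

  ≈⇒𝓡 : ∀ {u v} → u ≈ v → u 𝓡 v
  ≈⇒𝓡 e = ≈⇒⊒ e , ≈⇒⊒ (sym e)

  _𝓡?_ : ∀ u v → Dec (u 𝓡 v)
  u 𝓡? v = (u ⊒? v) ×-dec (v ⊒? u)

  -- If W P Q ≈ W, where P and Q have lengths divisible by s, then W Q can
  -- still be continued to W, since W = W e = W e Q e for e = (PQ)^ω.
  loop : ∀ W P Q → length P ≋ 0 [mod s ] → length Q ≋ 0 [mod s ] → W ++ (P ++ Q) ≈ W → W ++ Q ⊒ W
  loop W P Q P≋0 Q≋0 W-loop with identity P Q P≋0 Q≋0
  ... | ω , _ , eQe , _ = e , (begin
    κ ((W ++ Q) ++ e)        ≡⟨ assoc W Q e ⟩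
    κ (W ++ (Q ++ e))        ≡⟨ ++-congʳ (Q ++ e) (sym (W-power ω)) ⟩
    κ ((W ++ e) ++ (Q ++ e)) ≡⟨ assoc W e (Q ++ e) ⟩
    κ (W ++ (e ++ Q ++ e))   ≡⟨ ++-congˡ W eQe ⟩
    κ (W ++ e)               ≡⟨ W-power ω ⟩
    κ W                      ∎)
    where
    open ≡-Reasoning
    e = power ω (P ++ Q)
    W-power : ∀ k → W ++ power k (P ++ Q) ≈ W
    W-power zero    = cong κ (++-identityʳ W)
    W-power (suc k) = trans (sym (assoc W (P ++ Q) (power k (P ++ Q))))
      (trans (++-congʳ (power k (P ++ Q)) W-loop) (W-power k))

  -- The strict order of 𝓡-classes, lower ones being smaller. It is stated on values and not on
  -- words, because a strict order on a finite set is well founded.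
  _⊏_ : Fin N → Fin N → Set
  i ⊏ j = ∃[ v ] ∃[ u ] κ v ≡ i × κ u ≡ j × u ⊒ v × ¬ (v ⊒ u)

  ⊏-wellFounded : ∀ i → Acc _⊏_ i
  ⊏-wellFounded = spo-wellFounded record
    { isEquivalence = isEquivalence
    ; irrefl        = λ { refl (v , u , κv , κu , _ , v⋣u) → v⋣u (≈⇒⊒ (trans κv (sym κu))) }
    ; trans         = λ (v , u , κv , κu , u⊒v , v⋣u) (v′ , u′ , κv′ , κu′ , u′⊒v′ , v′⋣u′) →
        v , u′ , κv , κu′ , ⊒-trans u′⊒v′ (⊒-trans (≈⇒⊒ (trans κv′ (sym κu))) u⊒v) ,
        λ v⊒u′ → v⋣u (⊒-trans v⊒u′ (⊒-trans u′⊒v′ (≈⇒⊒ (trans κv′ (sym κu)))))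
    ; <-resp-≈      = subst (_ ⊏_) , subst (_⊏ _)
    }

  module Letters (label : ℕ → Fin s) (faithful : Faithful label) where

    letterAfter : Word n → Fin n → Fin (n * s)
    letterAfter u a = Fin.combine a (label (length u))

    letterAfter-injective : ∀ {u v a b} → letterAfter u a ≡ letterAfter v b → a ≡ b × length u ≋ length v [mod s ]
    letterAfter-injective {a = a} {b} e = cong proj₁ pairs , to faithful (cong proj₂ pairs)
      where pairs = trans (sym (Fin.remQuot-combine {n} a _))
              (trans (cong (Fin.remQuot {n} s) e) (Fin.remQuot-combine {n} b _))

    letterAfter-cong : ∀ {u v} a → length u ≋ length v [mod s ] → letterAfter u a ≡ letterAfter v a
    letterAfter-cong a e = cong (Fin.combine a) (from faithful e)

    -- c can be appended to some word of the 𝓡-class of x, at the right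
    -- residue, without leaving the class.
    Stay : Word n → Fin (n * s) → Set
    Stay x c = ∃[ W ] x 𝓡 W × ∃[ a ] letterAfter W a ≡ c × x 𝓡 W List.∷ʳ a

    stay? : ∀ x c → Dec (Stay x c)
    stay? x c = ∃? (λ {W} {W′} W≈W′ (r , a , e , r′) →
        𝓡-trans r (≈⇒𝓡 W≈W′) , a , trans (letterAfter-cong {W′} {W} a (length-cong (sym W≈W′))) e ,
          𝓡-trans r′ (≈⇒𝓡 (++-congʳ (a ∷ []) W≈W′)))
      λ W → (x 𝓡? W) ×-dec any? λ a → (letterAfter W a Fin.≟ c) ×-dec (x 𝓡? (W List.∷ʳ a))

    -- Whether a letter leaves the class depends only on the letter.
    stays : ∀ x W a → x 𝓡 W → Stay x (letterAfter W a) → x 𝓡 W List.∷ʳ a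
    stays x W a (x⊒W , (z₁ , Wz₁≈x)) (W′ , ((y′ , xy′≈W′) , _) , a′ , same , (_ , (z , W′a′z≈x)))
      with letterAfter-injective {W′} {W} {a′} {a} same | x⊒W
    ... | refl , W′≋W | y , xy≈W =
      ⊒-trans x⊒W (⊒-++ W (a ∷ [])) , ⊒-trans (extend (loop W P Q P≋0 Q≋0 W-loop)) (z₁ , Wz₁≈x)
      where
      -- P leads from W through x to W′, and Q, which begins with a, from W′ through x back to W.
      -- Their lengths vanish modulo s because W and W′ have the same length modulo s. So `loop`
      -- allows Q, and hence a, to be read directly after W.
      P = z₁ ++ y′
      Q = a ∷ z ++ y
      WP≈W′ : W ++ P ≈ W′
      WP≈W′ = trans (sym (assoc W z₁ y′)) (trans (++-congʳ y′ Wz₁≈x) xy′≈W′)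
      W-loop : W ++ (P ++ Q) ≈ W
      W-loop = begin
        κ (W ++ (P ++ Q))                  ≡⟨ sym (assoc W P Q) ⟩
        κ ((W ++ P) ++ Q)                  ≡⟨ ++-congʳ Q WP≈W′ ⟩
        κ (W′ ++ a ∷ z ++ y)               ≡⟨ sym (assoc W′ (a ∷ []) (z ++ y)) ⟩
        κ ((W′ List.∷ʳ a) ++ z ++ y)       ≡⟨ sym (assoc (W′ List.∷ʳ a) z y) ⟩
        κ (((W′ List.∷ʳ a) ++ z) ++ y)     ≡⟨ ++-congʳ y W′a′z≈x ⟩
        κ (x ++ y)                         ≡⟨ xy≈W ⟩
        κ W                                ∎
        where open ≡-Reasoning
      P≋0 : length P ≋ 0 [mod s ]
      P≋0 = mod-cancelˡ (length W) (mod-trans (mod-reflexive (sym (length-++ W))) (mod-trans (length-cong WP≈W′)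
              (mod-trans W′≋W (mod-reflexive (sym (+-identityʳ (length W)))))))
      Q≋0 : length Q ≋ 0 [mod s ]
      Q≋0 = mod-cancelˡ (length P) (mod-trans (mod-cancelˡ (length W)
        (mod-trans (mod-reflexive (trans (cong (length W +_) (sym (length-++ P))) (sym (length-++ W))))
              (mod-trans (length-cong W-loop) (mod-reflexive (sym (+-identityʳ (length W)))))))
                (mod-sym (mod-trans (mod-reflexive (+-identityʳ (length P))) P≋0)))
      extend : W ++ Q ⊒ W → W List.∷ʳ a ⊒ W
      extend (t , e) = (z ++ y) ++ t , trans (cong κ (sym (++-assoc (W List.∷ʳ a) (z ++ y) t)))
        (trans (cong (λ u → κ (u ++ t)) (++-assoc W (a ∷ []) (z ++ y))) e)

    labelsFrom : Word n → ℕ → Fin s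
    labelsFrom W = label ∘ (length W +_)

    labelsFrom-cong : ∀ {W W′} (u : Word n) → length W ≋ length W′ [mod s ] →
      enrich (labelsFrom W) u ≡ enrich (labelsFrom W′) u
    labelsFrom-cong u e = enrich-cong u λ p _ → from faithful (mod-+ e (mod-reflexive refl))

    enrich-∷ : ∀ W a u → enrich (labelsFrom W) (a ∷ u) ≡ letterAfter W a ∷ enrich (labelsFrom (W List.∷ʳ a)) u
    enrich-∷ W a u = cong₂ _∷_ (cong (Fin.combine a ∘ label) (+-identityʳ (length W)))
      (enrich-cong u λ p _ → cong label (trans (+-suc (length W) p)
        (cong (_+ p) (sym (trans (length-++ W) (+-comm (length W) 1))))))

    all-stay : ∀ x W u → x 𝓡 W → All (Stay x) (enrich (labelsFrom W) u) → x 𝓡 W ++ u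
    all-stay x W []      r _ = subst (x 𝓡_) (sym (++-identityʳ W)) r
    all-stay x W (a ∷ u) r h with subst (All (Stay x)) (enrich-∷ W a u) h
    ... | stay ∷ h′ = subst (x 𝓡_) (++-assoc W (a ∷ []) u) (all-stay x (W List.∷ʳ a) u (stays x W a r stay) h′)

    enrich-split : ∀ W u {v₀ c v₁} → enrich (labelsFrom W) u ≡ v₀ ++ c ∷ v₁ →
                   ∃[ u₀ ] ∃[ a ] ∃[ u₁ ] u ≡ u₀ ++ a ∷ u₁ × v₀ ≡ enrich (labelsFrom W) u₀ ×
                   c ≡ letterAfter (W ++ u₀) a × v₁ ≡ enrich (labelsFrom ((W ++ u₀) List.∷ʳ a)) u₁
    enrich-split W (a ∷ u) {[]} e with trans (sym (enrich-∷ W a u)) e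
    ... | refl = [] , a , u , refl , refl , cong (λ W → letterAfter W a) (sym (++-identityʳ W)) ,
                 cong (λ W → enrich (labelsFrom (W List.∷ʳ a)) u) (sym (++-identityʳ W))
    enrich-split W (a ∷ u) {b ∷ v₀} e with trans (sym (enrich-∷ W a u)) e
    ... | e′ with enrich-split (W List.∷ʳ a) u {v₀} (List.∷-injectiveʳ e′)
    ... | u₀ , b′ , u₁ , refl , e₀ , e₁ , e₂ = a ∷ u₀ , b′ , u₁ , refl ,
      trans (cong₂ _∷_ (sym (List.∷-injectiveˡ e′)) e₀) (sym (enrich-∷ W a u₀)) ,
      trans e₁ (cong (λ W → letterAfter W b′) (++-assoc W (a ∷ []) u₀)) ,
      trans e₂ (cong (λ W → enrich (labelsFrom (W List.∷ʳ b′)) u₁) (++-assoc W (a ∷ []) u₀))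

-- Expressions for 𝓡-classes and for values

Recognises : ∀ {N s} {{_ : NonZero s}} → (Word n → Fin N) → Subset (n * s) → (ℕ → Fin s) → Word n →
  Expression (n * s) → Set
Recognises {s = s} κ C label m e =
  ∀ u → All (Subset._∈ C) (enrich label u) → length u ≋ length m [mod s ] → ⟪ e ⟫ᴸ (enrich label u) ⇔ κ u ≡ κ m

first-outside : {P : Pred A 0ℓ} → (∀ a → Dec (P a)) → ∀ v →
  All P v ⊎ (∃[ v₀ ] ∃[ a ] ∃[ v₁ ] v ≡ v₀ ++ a ∷ v₁ × All P v₀ × ¬ P a)
first-outside P? []      = inj₁ []
first-outside P? (a ∷ v) with P? a | first-outside P? v
... | no ¬p | _ = inj₂ ([] , a , v , refl , [] , ¬p)
... | yes p | inj₁ ps = inj₁ (p ∷ ps)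
... | yes p | inj₂ (v₀ , b , v₁ , refl , ps , ¬p) = inj₂ (a ∷ v₀ , b , v₁ , refl , p ∷ ps , ¬p)

module 𝓡-Class {n s N : ℕ} {{_ : NonZero s}} {κ : Word n → Fin N} (da : DA n s κ) (label : ℕ → Fin s)
  (faithful : Faithful label) (C : Subset (n * s))
               (smaller : ∀ {D : Subset (n * s)} → D Subset.⊂ C → ∀ label → Faithful label → ∀ m →
                 Σ (Expression (n * s)) (Recognises κ D label m)) where

  open DA da
  open Reach da
  open Letters label faithful

  Reaches : Word n → Word n → Expression (n * s) → Set
  Reaches m x e = ∀ u → All (Subset._∈ C) (enrich (labelsFrom x) u) → ⟪ e ⟫ᴸ (enrich (labelsFrom x) u) ⇔ x ++ u 𝓡 m

  module _ (x : Word n) where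

    E D : Subset (n * s)
    E = Vec.tabulate λ c → ⌊ stay? x c ⌋
    D = C Subset.∩ E

    ∈E : ∀ c → c Subset.∈ E ⇔ Stay x c
    ∈E = ∈-tabulate (stay? x)

    Exit : Word n → Fin n → Set
    Exit u a = letterAfter (x ++ u) a Subset.∈ C × ¬ Stay x (letterAfter (x ++ u) a) × x 𝓡 x ++ u

    exit? : ∀ u a → Dec (Exit u a)
    exit? u a = (letterAfter (x ++ u) a Subset.∈? C) ×-dec ¬? (stay? x (letterAfter (x ++ u) a)) ×-dec (x 𝓡? (x ++ u))

    after : Word n → Fin n → Word n
    after u a = (x ++ u) List.∷ʳ a

    exit∉D : ∀ u a → Exit u a → letterAfter (x ++ u) a Subset.∉ D
    exit∉D u a (_ , ¬stay , _) c∈D = ¬stay (to (∈E _) (proj₂ (Subset.x∈p∩q⁻ C E c∈D)))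

    D⊂C : ∀ u a → Exit u a → D Subset.⊂ C
    D⊂C u a exit = Subset.p∩q⊆p C E , letterAfter (x ++ u) a , proj₁ exit , exit∉D u a exit

    below : ∀ u a → Exit u a → κ (after u a) ⊏ κ x
    below u a (_ , ¬stay , r) = after u a , x , refl , refl , x⊒ , λ ⊒x → ¬stay (x ++ u , r , a , refl , x⊒ , ⊒x)
      where
      x⊒ : x ⊒ after u a
      x⊒ = ⊒-trans (proj₁ r) (⊒-++ (x ++ u) (a ∷ []))

    staying : ∀ u → All (Subset._∈ D) (enrich (labelsFrom x) u) → x 𝓡 x ++ u
    staying u u∈D = all-stay x x u 𝓡-refl (All.map (to (∈E _) ∘ proj₂ ∘ Subset.x∈p∩q⁻ C E) u∈D)

    in-D : ∀ {v} → All (Subset._∈ C) v → All (Stay x) v → All (Subset._∈ D) v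
    in-D v∈C stay = All.zipWith (λ (c∈C , st) → Subset.x∈p∩q⁺ (c∈C , from (∈E _) st)) (v∈C , stay)

    middle : ∀ u₀ a u₁ {u} → u₀ ≈ u → x ++ u₀ ++ a ∷ u₁ ≈ after u a ++ u₁
    middle u₀ a u₁ {u} u₀≈u = begin
      κ (x ++ u₀ ++ a ∷ u₁)                ≡⟨ sym (assoc x u₀ (a ∷ u₁)) ⟩
      κ ((x ++ u₀) ++ a ∷ u₁)              ≡⟨ ++-congʳ (a ∷ u₁) (++-congˡ x u₀≈u) ⟩
      κ ((x ++ u) ++ a ∷ u₁)               ≡⟨ sym (assoc (x ++ u) (a ∷ []) u₁) ⟩
      κ (((x ++ u) List.∷ʳ a) ++ u₁)       ∎
      where open ≡-Reasoning

    length-after : ∀ {u₀ u : Word n} {a} → length u₀ ≋ length u [mod s ] →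
      length (after u₀ a) ≋ length (after u a) [mod s ]
    length-after {u₀} {u} {a} h = mod-trans (mod-reflexive (trans (length-++ (x ++ u₀)) (cong (_+ 1) (length-++ x))))
      (mod-trans (mod-+ (mod-+ˡ (length x) h) (mod-reflexive {p = 1} refl))
        (mod-reflexive (sym (trans (length-++ (x ++ u)) (cong (_+ 1) (length-++ x))))))

    length-cancel : ∀ {u₀ u : Word n} → length (x ++ u₀) ≋ length (x ++ u) [mod s ] → length u₀ ≋ length u [mod s ]
    length-cancel {u₀} {u} h = mod-cancelˡ (length x) (mod-trans (mod-reflexive (sym (length-++ x)))
      (mod-trans h (mod-reflexive (length-++ x))))

    length-extend : ∀ {u₀ u : Word n} → length u₀ ≋ length u [mod s ] → length (x ++ u₀) ≋ length (x ++ u) [mod s ]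
    length-extend {u₀} {u} h = mod-trans (mod-reflexive (length-++ x))
      (mod-trans (mod-+ˡ (length x) h) (mod-reflexive (sym (length-++ x))))

    module _ (m : Word n) (before-exit : ∀ u a → Exit u a → Σ (Expression (n * s)) (Recognises κ D (labelsFrom x) u))
             (after-exit : ∀ u a → Exit u a → Σ (Expression (n * s)) (Reaches m (after u a))) where

      exiting : ∀ u a → Exit u a → Expression (n * s)
      exiting u a exit = cut first D (exit∉D u a exit) (proj₁ (before-exit u a exit)) (proj₁ (after-exit u a exit))

      sound-exit : ∀ w u a (exit : Exit u a) → All (Subset._∈ C) (enrich (labelsFrom x) w) →
        ⟪ exiting u a exit ⟫ᴸ (enrich (labelsFrom x) w) → x ++ w 𝓡 m
      sound-exit w u a exit w∈C (v₀ , v₁ , split , v₀∈D , s₀ , s₁) = go (enrich-split x w split)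
        where
        go : _ → x ++ w 𝓡 m
        go (w₀ , a′ , w₁ , w≡ , v₀≡ , same , v₁≡) = subst (λ w → x ++ w 𝓡 m) (sym w≡)
            (𝓡-trans (≈⇒𝓡 (trans (middle w₀ a′ w₁ w₀≈u) (cong (λ a → κ (after u a ++ w₁)) (sym (proj₁ letters)))))
                     (to (proj₂ (after-exit u a exit) w₁ (subst (All (Subset._∈ C)) labels v₁∈C))
                       (subst ⟪ proj₁ (after-exit u a exit) ⟫ᴸ labels s₁)))
          where
          letters = letterAfter-injective {x ++ u} {x ++ w₀} {a} {a′} same
          -- The residue attached to the exit letter yields the length modulo s that `before-exit`
          -- presupposes; only then does the expression give the value of w₀.
          w₀≋u : length w₀ ≋ length u [mod s ]
          w₀≋u = length-cancel {w₀} {u} (mod-sym (proj₂ letters))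
          w₀≈u : w₀ ≈ u
          w₀≈u = to (proj₂ (before-exit u a exit) w₀ (subst (All (Subset._∈ D)) v₀≡ v₀∈D) w₀≋u)
            (subst ⟪ proj₁ (before-exit u a exit) ⟫ᴸ v₀≡ s₀)
          labels : v₁ ≡ enrich (labelsFrom (after u a)) w₁
          labels = trans v₁≡ (trans (labelsFrom-cong {after w₀ a′} {after u a′} w₁ (length-after {w₀} {u} w₀≋u))
            (cong (λ a → enrich (labelsFrom (after u a)) w₁) (sym (proj₁ letters))))
          v₁∈C : All (Subset._∈ C) v₁
          v₁∈C = All.tail (All.++⁻ʳ v₀ (subst (All (Subset._∈ C)) split w∈C))

      K : ℕ
      K = length (shorter n N)

      -- The factor before the exit matters only through its value, so a union over short
      -- representatives is enough.
      candidate : Fin K → Word n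
      candidate = lookup (shorter n N)

      exits : Fin K → Fin n → Expression (n * s)
      exits i a = when (exit? (candidate i) a) (exiting (candidate i) a)

      expression : Expression (n * s)
      expression = when (x 𝓡? m) (λ _ → only D) ∪ ⋃ K λ i → ⋃ n (exits i)

      sound : ∀ w → All (Subset._∈ C) (enrich (labelsFrom x) w) →
        ⟪ expression ⟫ᴸ (enrich (labelsFrom x) w) → x ++ w 𝓡 m
      sound w w∈C (inj₁ sem) = let x𝓡m , w∈D = sem-when⁻ (x 𝓡? m) (λ _ → only D) sem in
        𝓡-trans (𝓡-sym (staying w w∈D)) x𝓡m
      sound w w∈C (inj₂ sem) =
        let i , sem₁ = to (sem-⋃ K (λ i → ⋃ n (exits i))) sem
            a , sem₂ = to (sem-⋃ n (exits i)) sem₁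
            exit , sem₃ = sem-when⁻ (exit? (candidate i) a) (exiting (candidate i) a) sem₂
        in sound-exit w (candidate i) a exit w∈C sem₃

      complete-exit : ∀ w u a w₀ w₁ (exit : Exit u a) → w ≡ w₀ ++ a ∷ w₁ → u ≈ w₀ →
        All (Stay x) (enrich (labelsFrom x) w₀) →
                      enrich (labelsFrom x) w ≡ enrich (labelsFrom x) w₀ ++ letterAfter (x ++ w₀) a ∷ enrich
                        (labelsFrom (after w₀ a)) w₁ →
                      All (Subset._∈ C) (enrich (labelsFrom x) w) → x ++ w 𝓡 m →
                        ⟪ exiting u a exit ⟫ᴸ (enrich (labelsFrom x) w)
      complete-exit w u a w₀ w₁ exit w≡ u≈w₀ w₀-stays split w∈C xw𝓡m =
        enrich (labelsFrom x) w₀ , enrich (labelsFrom (after w₀ a)) w₁ ,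
        trans split (cong (λ c → enrich (labelsFrom x) w₀ ++ c ∷ enrich (labelsFrom (after w₀ a)) w₁)
          (letterAfter-cong {x ++ w₀} {x ++ u} a (length-extend {w₀} {u} w₀≋u))) ,
        w₀∈D ,
        from (proj₂ (before-exit u a exit) w₀ w₀∈D w₀≋u) (sym u≈w₀) ,
        subst ⟪ proj₁ (after-exit u a exit) ⟫ᴸ (sym labels)
          (from (proj₂ (after-exit u a exit) w₁ (subst (All (Subset._∈ C)) labels w₁∈C))
          (𝓡-trans (≈⇒𝓡 (sym (middle w₀ a w₁ (sym u≈w₀)))) (subst (λ w → x ++ w 𝓡 m) w≡ xw𝓡m)))
        where
        w₀≋u : length w₀ ≋ length u [mod s ]
        w₀≋u = length-cong (sym u≈w₀)
        parts : All (Subset._∈ C) (enrich (labelsFrom x) w₀ ++ letterAfter (x ++ w₀) a ∷ enrich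
          (labelsFrom (after w₀ a)) w₁)
        parts = subst (All (Subset._∈ C)) split w∈C
        w₀∈D : All (Subset._∈ D) (enrich (labelsFrom x) w₀)
        w₀∈D = in-D (All.++⁻ˡ (enrich (labelsFrom x) w₀) parts) w₀-stays
        w₁∈C : All (Subset._∈ C) (enrich (labelsFrom (after w₀ a)) w₁)
        w₁∈C = All.tail (All.++⁻ʳ (enrich (labelsFrom x) w₀) parts)
        labels : enrich (labelsFrom (after w₀ a)) w₁ ≡ enrich (labelsFrom (after u a)) w₁
        labels = labelsFrom-cong {after w₀ a} {after u a} w₁ (length-after {w₀} {u} w₀≋u)

      complete : ∀ w → All (Subset._∈ C) (enrich (labelsFrom x) w) → x ++ w 𝓡 m →
        ⟪ expression ⟫ᴸ (enrich (labelsFrom x) w)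
      complete w w∈C xw𝓡m = [ stay , leave ]′ (first-outside (stay? x) (enrich (labelsFrom x) w))
        where
        stay : All (Stay x) (enrich (labelsFrom x) w) → ⟪ expression ⟫ᴸ (enrich (labelsFrom x) w)
        stay w-stays = inj₁ (sem-when⁺ (x 𝓡? m) (λ _ → only D) (𝓡-trans (all-stay x x w 𝓡-refl w-stays) xw𝓡m)
          (λ _ → in-D w∈C w-stays))
        leave : _ → ⟪ expression ⟫ᴸ (enrich (labelsFrom x) w)
        leave (v₀ , c , v₁ , split , v₀-stays , ¬stay) = go (enrich-split x w split)
          where
          go : _ → ⟪ expression ⟫ᴸ (enrich (labelsFrom x) w)
          go (w₀ , a , w₁ , w≡ , v₀≡ , c≡ , v₁≡) =
            inj₂ (from (sem-⋃ K (λ i → ⋃ n (exits i)))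
              (i , from (sem-⋃ n (exits i)) (a , sem-when⁺ (exit? u a) (exiting u a) exit λ exit →
              complete-exit w u a w₀ w₁ exit w≡ u≈w₀ w₀-stays split′ w∈C xw𝓡m)))
            where
            u′ = short w₀
            u′∈ : proj₁ u′ ∈ shorter n N
            u′∈ = ∈-shorter⁺ {u = proj₁ u′} (proj₁ (proj₂ u′))
            i = index u′∈
            u = candidate i
            u≈w₀ : u ≈ w₀
            u≈w₀ = trans (cong κ (sym (Any.lookup-index u′∈))) (proj₂ (proj₂ u′))
            w₀-stays : All (Stay x) (enrich (labelsFrom x) w₀)
            w₀-stays = subst (All (Stay x)) v₀≡ v₀-stays
            split′ : enrich (labelsFrom x) w ≡ enrich (labelsFrom x) w₀ ++ letterAfter (x ++ w₀) a ∷ enrich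
              (labelsFrom (after w₀ a)) w₁
            split′ = trans split (cong₂ _++_ v₀≡ (cong₂ _∷_ c≡ v₁≡))
            c≡′ : c ≡ letterAfter (x ++ u) a
            c≡′ = trans c≡ (letterAfter-cong {x ++ w₀} {x ++ u} a (length-extend {w₀} {u} (length-cong (sym u≈w₀))))
            exit : Exit u a
            exit = subst (Subset._∈ C) c≡′ (All.head (All.++⁻ʳ v₀ (subst (All (Subset._∈ C)) split w∈C))) ,
              (¬stay ∘ subst (Stay x) (sym c≡′)) ,
              𝓡-trans (all-stay x x w₀ 𝓡-refl w₀-stays) (≈⇒𝓡 (++-congˡ x (sym u≈w₀)))

      step : Σ (Expression (n * s)) (Reaches m x)
      step = expression , λ u u∈C → mk⇔ (sound u u∈C) (complete u u∈C)

  reach : ∀ m x → Acc _⊏_ (κ x) → Σ (Expression (n * s)) (Reaches m x)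
  reach m x (acc rec) = step x m (λ u a exit → smaller (D⊂C x u a exit) (labelsFrom x)
    (shift-faithful (length x) faithful) u)
    (λ u a exit → reach m (after x u a) (rec (below x u a exit)))

module _ {n s N : ℕ} {{_ : NonZero s}} {κ : Word n → Fin N} (da : DA n s κ) where

  open DA da
  open Reach da

  -- 𝓗-classes are trivial, for words of the same length modulo s: if
  -- u z = m and y′ m = u, then y′ cancels a factor z after u, and z^ω z = z^ω.
  𝓗-trivial : ∀ {u m} → length u ≋ length m [mod s ] → u ⊒ m → (∃[ y′ ] y′ ++ m ≈ u) → u ≈ m
  𝓗-trivial {u} {m} u≋m (z , uz≈m) (y′ , y′m≈u) = trans (sym (cancel-all (ω + ω) uzᵏz≈uzᵏ)) uz≈m
    where
    open ≡-Reasoning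
    z≋0 : length z ≋ 0 [mod s ]
    z≋0 = mod-cancelˡ (length u) (mod-trans (mod-reflexive (sym (length-++ u)))
      (mod-trans (length-cong uz≈m) (mod-trans (mod-sym u≋m) (mod-reflexive (sym (+-identityʳ (length u)))))))
    -- With X empty, the identities express aperiodicity: z^ω z z^ω = z^ω, where z^ω is idempotent.
    aperiodic = identity [] z (mod-reflexive refl) z≋0
    ω = proj₁ aperiodic
    e = power ω z
    cancel : ∀ t → y′ ++ (u ++ (z ++ t)) ≈ u ++ t
    cancel t = begin
      κ (y′ ++ (u ++ (z ++ t)))   ≡⟨ ++-congˡ y′ (sym (assoc u z t)) ⟩
      κ (y′ ++ ((u ++ z) ++ t))   ≡⟨ ++-congˡ y′ (++-congʳ t uz≈m) ⟩
      κ (y′ ++ (m ++ t))          ≡⟨ sym (assoc y′ m t) ⟩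
      κ ((y′ ++ m) ++ t)          ≡⟨ ++-congʳ t y′m≈u ⟩
      κ (u ++ t)                  ∎
    cancel-all : ∀ k → u ++ (power k z ++ z) ≈ u ++ power k z → u ++ z ≈ u
    cancel-all zero    h = trans h (cong κ (++-identityʳ u))
    cancel-all (suc k) h = cancel-all k (begin
      κ (u ++ (power k z ++ z))             ≡⟨ sym (cancel (power k z ++ z)) ⟩
      κ (y′ ++ (u ++ (z ++ power k z ++ z))) ≡⟨ ++-congˡ y′
        (cong (λ v → κ (u ++ v)) (sym (++-assoc z (power k z) z))) ⟩
      κ (y′ ++ (u ++ (power (suc k) z ++ z))) ≡⟨ ++-congˡ y′ h ⟩
      κ (y′ ++ (u ++ (z ++ power k z)))     ≡⟨ cancel (power k z) ⟩
      κ (u ++ power k z)                    ∎)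
    uzᵏz≈uzᵏ : u ++ (power (ω + ω) z ++ z) ≈ u ++ power (ω + ω) z
    uzᵏz≈uzᵏ = ++-congˡ u (begin
      κ (power (ω + ω) z ++ z)   ≡⟨ cong (λ t → κ (t ++ z)) (power-+ ω ω z) ⟩
      κ ((e ++ e) ++ z)          ≡⟨ assoc e e z ⟩
      κ (e ++ (e ++ z))          ≡⟨ cong (λ t → κ (e ++ t)) (power-comm ω z) ⟩
      κ (e ++ (z ++ e))          ≡⟨ proj₁ (proj₂ (proj₂ aperiodic)) ⟩
      κ e                        ≡⟨ sym (proj₁ (proj₂ aperiodic)) ⟩
      κ (e ++ e)                 ≡⟨ cong κ (sym (power-+ ω ω z)) ⟩
      κ (power (ω + ω) z)        ∎)

  -- The value of m is determined by its 𝓡-class and its 𝓛-class.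
  recognise : ∀ (C : Subset (n * s)) → Acc Subset._⊂_ C → ∀ label → Faithful label → ∀ m →
    Σ (Expression (n * s)) (Recognises κ C label m)
  recognise C (acc rec) label faithful m = proj₁ right ∩ mirror (proj₁ left) , correct
    where
    smaller : ∀ {D} → D Subset.⊂ C → ∀ label → Faithful label → ∀ m → Σ (Expression (n * s)) (Recognises κ D label m)
    smaller D⊂C = recognise _ (rec D⊂C)
    -- The dual induction hypothesis comes from the same one: a word and its reversal use the same
    -- enriched letters once the reversal is labelled backwards.
    smaller′ : ∀ {D} → D Subset.⊂ C → ∀ label → Faithful label → ∀ m →
      Σ (Expression (n * s)) (Recognises (κ ∘ reverse) D label m)
    smaller′ {D} D⊂C label faithful m =
      let e , e-recognises = smaller D⊂C (backwards (length m) label)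
            (backwards-faithful (length m) faithful) (reverse m)
      in mirror e , λ u u∈D u≋m →
        let reversed = reverse-enrich faithful (length m) u u≋m in
        ⇔-reflexive (cong ⟪ mirror e ⟫ᴸ (trans (sym (reverse-involutive (enrich label u))) (cong reverse reversed)))
        ⟨⇔⟩ sem-mirror e (enrich (backwards (length m) label) (reverse u))
        ⟨⇔⟩ e-recognises (reverse u) (subst (All (Subset._∈ D)) reversed (All-reverse⁺ u∈D))
              (mod-trans (mod-reflexive (length-reverse u)) (mod-trans u≋m (mod-reflexive (sym (length-reverse m)))))
    right = 𝓡-Class.reach da label faithful C smaller m [] (⊏-wellFounded (κ []))
    left = 𝓡-Class.reach (reverse-DA da) (backwards (length m) label)
      (backwards-faithful (length m) faithful) C smaller′
             (reverse m) [] (Reach.⊏-wellFounded (reverse-DA da) (κ (reverse [])))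
    correct : Recognises κ C label m (proj₁ right ∩ mirror (proj₁ left))
    correct u u∈C u≋m = (proj₂ right u u∈C ×-⇔ left-correct) ⟨⇔⟩ mk⇔
      (λ ((u⊒m , _) , (_ , (y , e))) → 𝓗-trivial u≋m u⊒m (reverse y , trans (sym (reversed-++ m y))
        (trans e (cong κ (reverse-involutive u)))))
      (λ u≈m → ≈⇒𝓡 u≈m , Reach.≈⇒𝓡 (reverse-DA da) {reverse u} {reverse m}
        (trans (cong κ (reverse-involutive u)) (trans u≈m (cong κ (sym (reverse-involutive m))))))
      where
      reversed = reverse-enrich faithful (length m) u u≋m
      reversed-++ : ∀ m y → κ (reverse (reverse m ++ y)) ≡ κ (reverse y ++ m)
      reversed-++ m y = cong κ (trans (reverse-++ (reverse m) y) (cong (reverse y ++_) (reverse-involutive m)))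
      left-correct : ⟪ mirror (proj₁ left) ⟫ᴸ (enrich label u) ⇔ Reach._𝓡_ (reverse-DA da) (reverse u) (reverse m)
      left-correct = ⇔-reflexive (cong ⟪ mirror (proj₁ left) ⟫ᴸ (trans (sym (reverse-involutive (enrich label u)))
        (cong reverse reversed)))
        ⟨⇔⟩ sem-mirror (proj₁ left) (enrich (backwards (length m) label) (reverse u))
        ⟨⇔⟩ proj₂ left (reverse u) (subst (All (Subset._∈ C)) reversed (All-reverse⁺ u∈C))

-- Two-pebble games

rank : Formula σ n v → ℕ
rank (¬′ φ)        = rank φ
rank (φ ∧ ψ)       = rank φ ⊔ rank ψ
rank (φ ∨ ψ)       = rank φ ⊔ rank ψ
rank (quant _ _ φ) = suc (rank φ)
rank _             = 0

SameOrder : ℕ → ℕ → ℕ → ℕ → Set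
SameOrder p q p′ q′ = (p < q ⇔ p′ < q′) × (q < p ⇔ q′ < p′)

sameOrder-< : ∀ {p q p′ q′} → p < q → p′ < q′ → SameOrder p q p′ q′
sameOrder-< p<q p′<q′ = mk⇔ (λ _ → p′<q′) (λ _ → p<q) , mk⇔ (contradiction p<q ∘ <-asym)
  (contradiction p′<q′ ∘ <-asym)

sameOrder-> : ∀ {p q p′ q′} → q < p → q′ < p′ → SameOrder p q p′ q′
sameOrder-> q<p q′<p′ = mk⇔ (contradiction q<p ∘ <-asym) (contradiction q′<p′ ∘ <-asym) ,
  mk⇔ (λ _ → q′<p′) (λ _ → q<p)

sameOrder-≡ : ∀ {p p′} → SameOrder p p p′ p′
sameOrder-≡ = mk⇔ (⊥-elim ∘ <-irrefl refl) (⊥-elim ∘ <-irrefl refl) , mk⇔ (⊥-elim ∘ <-irrefl refl)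
  (⊥-elim ∘ <-irrefl refl)

sameOrder-swap : ∀ {p q p′ q′} → SameOrder p q p′ q′ → SameOrder q p q′ p′
sameOrder-swap (e , e′) = e′ , e

sameOrder-sym : ∀ {p q p′ q′} → SameOrder p q p′ q′ → SameOrder p′ q′ p q
sameOrder-sym (e , e′) = ⇔-sym e , ⇔-sym e′

sameOrder⇒≡ : ∀ {p q p′ q′} → SameOrder p q p′ q′ → p ≡ q → p′ ≡ q′
sameOrder⇒≡ {p′ = p′} {q′} (e , e′) refl with <-cmp p′ q′
... | tri< p′<q′ _ _ = contradiction (from e p′<q′) (<-irrefl refl)
... | tri≈ _ p′≡q′ _ = p′≡q′
... | tri> _ _ q′<p′ = contradiction (from e′ q′<p′) (<-irrefl refl)

-- Duplicator's winning positions: with k rounds to go, she may answer any move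
-- of one pebble looking only at the other one.
record Game (d : ℕ) {{_ : NonZero d}} (K : ℕ) (w w′ : Word n) : Set₁ where
  field
    Related : ℕ → ℕ → ℕ → Set
    related-letter  : ∀ {k p p′} → k ≤ K → Related k p p′ → w !! p ≡ w′ !! p′
    related-residue : ∀ {k p p′} → k ≤ K → Related k p p′ → p ≋ p′ [mod d ]
    related-pred    : ∀ {k p p′} → k < K → Related (suc k) p p′ → Related k p p′
    forth : ∀ {k p p′} → k < K → Related (suc k) p p′ → (q : Fin (length w)) →
            Σ[ q′ ∈ Fin (length w′) ] Related k (toℕ q) (toℕ q′) × SameOrder p (toℕ q) p′ (toℕ q′)
    back  : ∀ {k p p′} → k < K → Related (suc k) p p′ → (q′ : Fin (length w′)) →
            Σ[ q ∈ Fin (length w) ] Related k (toℕ q) (toℕ q′) × SameOrder p (toℕ q) p′ (toℕ q′)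
    same-length : length w ≋ length w′ [mod d ]

  Position : ℕ → Vector ℕ 2 → Vector ℕ 2 → Set
  Position k ρ ρ′ = (∀ x → Related k (ρ x) (ρ′ x)) × (∀ x y → SameOrder (ρ x) (ρ y) (ρ′ x) (ρ′ y))

  move : ∀ {k ρ ρ′ q q′} x → k < K → Position (suc k) ρ ρ′ → Related k q q′ →
    SameOrder (ρ (other x)) q (ρ′ (other x)) q′ →
         Position k (updateAt ρ x (const q)) (updateAt ρ′ x (const q′))
  move {k} {ρ} {ρ′} {q} {q′} x k<K (related , _) r o = related′ , order′
    where
    at : ∀ ρ q → updateAt ρ x (const q) x ≡ q
    at ρ q = updateAt-updates x ρ
    off : ∀ ρ q → updateAt ρ x (const q) (other x) ≡ ρ (other x)
    off ρ q = updateAt-minimal (other x) x ρ (z≢other x ∘ sym)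
    cases : ∀ y → y ≡ x ⊎ y ≡ other x
    cases y with y Fin.≟ other x
    ... | yes e = inj₂ e
    ... | no  e = inj₁ (≢other⇒≡ x e)
    related′ : ∀ y → Related k (updateAt ρ x (const q) y) (updateAt ρ′ x (const q′) y)
    related′ y with cases y
    ... | inj₁ refl = subst₂ (Related k) (sym (at ρ q)) (sym (at ρ′ q′)) r
    ... | inj₂ refl = subst₂ (Related k) (sym (off ρ q)) (sym (off ρ′ q′)) (related-pred k<K (related (other x)))
    order′ : ∀ y z → SameOrder (updateAt ρ x (const q) y) (updateAt ρ x (const q) z) (updateAt ρ′ x (const q′) y)
      (updateAt ρ′ x (const q′) z)
    order′ y z with cases y | cases z
    ... | inj₁ refl | inj₁ refl = sameOrder-≡
    ... | inj₂ refl | inj₂ refl = sameOrder-≡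
    ... | inj₁ refl | inj₂ refl rewrite at ρ q | at ρ′ q′ | off ρ q | off ρ′ q′ = sameOrder-swap o
    ... | inj₂ refl | inj₁ refl rewrite at ρ q | at ρ′ q′ | off ρ q | off ρ′ q′ = o

  private
    reduce : ∀ {p p′} δ (i : Fin δ) → δ ∣ d → p ≋ p′ [mod d ] → congruent δ i p ⇔ congruent δ i p′
    reduce {p} {p′} δ i (divides e refl) (residue h) =
      ⇔-reflexive (cong (_≡ toℕ i) (trans (sym (finer p)) (trans (cong (_% δ) h) (finer p′))))
      where
      instance
        δ≢0 : NonZero δ
        δ≢0 = Fin.nonZeroIndex i
      finer : ∀ p → p % (e * δ) % δ ≡ p % δ
      finer p = sym (trans (cong (_% δ) (trans (m≡m%n+[m/n]*n p (e * δ))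
        (cong (p % (e * δ) +_) (sym (*-assoc (p / (e * δ)) e δ)))))
                           ([m+kn]%n≡m%n (p % (e * δ)) (p / (e * δ) * e) δ))

  game-sound : ∀ {k ρ ρ′} (φ : Formula [<,MOD] n 2) → Predicates (ModuliDivide d) φ → rank φ ≤ k → k ≤ K →
    Position k ρ ρ′ → Sat w ρ φ ⇔ Sat w′ ρ′ φ
  game-sound true            _ _ _ _ = ⇔-id _
  game-sound false           _ _ _ _ = ⇔-id _
  game-sound (x ≐ y)         _ _ _ (_ , ordered) = mk⇔ (sameOrder⇒≡ (ordered x y))
    (sameOrder⇒≡ (sameOrder-sym (ordered x y)))
  game-sound (letter a x)    _ _ k≤K (related , _) = ⇔-reflexive (cong (_≡ just a) (related-letter k≤K (related x)))
  game-sound (pred less _ (x ∷ y ∷ [])) _ _ _ (_ , ordered) = proj₁ (ordered x y)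
  game-sound (pred (letter-x+ a j) (inj₁ ()) _)
  game-sound (pred (letter-x+ a j) (inj₂ (_ , ())) _)
  game-sound (pred (letter-min+ a j) (inj₁ ()) _)
  game-sound (pred (letter-min+ a j) (inj₂ (_ , ())) _)
  game-sound (pred (letter-max- a j) (inj₁ ()) _)
  game-sound (pred (letter-max- a j) (inj₂ (_ , ())) _)
  game-sound (pred (MOD- δ i) _ (x ∷ [])) δ∣d _ k≤K (related , _) = reduce δ i δ∣d (related-residue k≤K (related x))
  game-sound (pred (D- δ i) _ []) δ∣d _ _ _ = reduce δ i δ∣d same-length
  game-sound (¬′ φ)          g r k≤K position = ¬-cong-⇔ (game-sound φ g r k≤K position)
  game-sound (φ ∧ ψ) (g , g′) r k≤K position = game-sound φ g (≤-trans (m≤m⊔n (rank φ) (rank ψ)) r) k≤K position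
    ×-⇔ game-sound ψ g′ (≤-trans (m≤n⊔m (rank φ) (rank ψ)) r) k≤K position
  game-sound (φ ∨ ψ) (g , g′) r k≤K position = game-sound φ g (≤-trans (m≤m⊔n (rank φ) (rank ψ)) r) k≤K position
    ⊎-⇔ game-sound ψ g′ (≤-trans (m≤n⊔m (rank φ) (rank ψ)) r) k≤K position
  game-sound {suc k} {ρ} {ρ′} (quant ∃′ x φ) g (s≤s r) k<K position = mk⇔
    (λ (q , s) → let q′ , rel , o = forth k<K (proj₁ position (other x)) q in q′ ,
      to (game-sound φ g r (<⇒≤ k<K) (move x k<K position rel o)) s)
    (λ (q′ , s) → let q , rel , o = back k<K (proj₁ position (other x)) q′ in q ,
      from (game-sound φ g r (<⇒≤ k<K) (move x k<K position rel o)) s)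
  game-sound {suc k} {ρ} {ρ′} (quant ∀′ x φ) g (s≤s r) k<K position = mk⇔
    (λ h q′ → let q , rel , o = back k<K (proj₁ position (other x)) q′ in
      to (game-sound φ g r (<⇒≤ k<K) (move x k<K position rel o)) (h q))
    (λ h q → let q′ , rel , o = forth k<K (proj₁ position (other x)) q in
      from (game-sound φ g r (<⇒≤ k<K) (move x k<K position rel o)) (h q′))

-- Words w₁ Zᴷ U Zᴷ w₂ whose middle factor U only has letters occurring in Z at
-- the same residue
module Pumped {n d : ℕ} {{_ : NonZero d}} (K : ℕ) (w₁ w₂ Z : Word n) {{_ : NonZero (length Z)}}
  (Z≋0 : length Z ≋ 0 [mod d ]) where

  a b z Kz : ℕ
  a = length w₁
  b = length w₂
  z = length Z
  Kz = K * z

  Zᴷ : Word n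
  Zᴷ = power K Z

  length-Zᴷ : length Zᴷ ≡ Kz
  length-Zᴷ = go K
    where
    go : ∀ k → length (power k Z) ≡ k * z
    go zero    = refl
    go (suc k) = trans (length-++ Z) (cong (z +_) (go k))

  multiple≋0 : ∀ k → k * z ≋ 0 [mod d ]
  multiple≋0 zero    = mod-reflexive refl
  multiple≋0 (suc k) = mod-trans (mod-+ Z≋0 (multiple≋0 k)) (mod-reflexive refl)

  Zᴷ-!! : ∀ c j → c < K → j < z → Zᴷ !! (c * z + j) ≡ Z !! j
  Zᴷ-!! c j c<K j<z = go K c c<K
    where
    go : ∀ k c → c < k → power k Z !! (c * z + j) ≡ Z !! j
    go (suc k) zero    _         = !!-++ˡ Z j<z
    go (suc k) (suc c) (s≤s c<k) = trans (cong ((Z ++ power k Z) !!_) (+-assoc z (c * z) j))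
      (trans (!!-++ʳ Z (c * z + j)) (go k c c<k))

  Copied : Word n → Set
  Copied u = ∀ i → i < length u → ∃[ j ] j < z × u !! i ≡ Z !! j × i ≋ j [mod d ]

  copied-Zᴷ : Copied Zᴷ
  copied-Zᴷ i i< = i % z , m%n<n i z , trans (cong (Zᴷ !!_) i≡)
    (Zᴷ-!! (i / z) (i % z) (m<n*o⇒m/o<n (subst (i <_) length-Zᴷ i<)) (m%n<n i z)) ,
    mod-trans (mod-reflexive i≡) (mod-+ (multiple≋0 (i / z)) (mod-reflexive refl))
    where
    i≡ : i ≡ i / z * z + i % z
    i≡ = trans (m≡m%n+[m/n]*n i z) (+-comm (i % z) _)

  module Word (U : Word n) (U≋0 : length U ≋ 0 [mod d ]) (copied : Copied U) where

    w : Word n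
    w = w₁ ++ Zᴷ ++ U ++ Zᴷ ++ w₂

    l u : ℕ
    l = length w
    u = length U

    l≡ : l ≡ (a + Kz) + (u + (Kz + b))
    l≡ = trans (length-++ w₁) (trans (cong (a +_)
      (trans (length-++ Zᴷ) (cong₂ _+_ length-Zᴷ
      (trans (length-++ U) (cong (u +_) (trans (length-++ Zᴷ) (cong (_+ b) length-Zᴷ)))))))
           (sym (+-assoc a Kz _)))

    l≋ : l ≋ a + b [mod d ]
    l≋ = mod-trans (mod-reflexive l≡)
      (mod-trans (mod-+ (mod-+ˡ a (multiple≋0 K)) (mod-+ U≋0 (mod-+ (multiple≋0 K) (mod-reflexive {p = b} refl))))
      (mod-reflexive (cong (_+ b) (+-identityʳ a))))

    l≥ : (a + Kz) + (b + Kz) ≤ l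
    l≥ = ≤-trans (+-monoʳ-≤ (a + Kz) (≤-trans (≤-reflexive (+-comm b Kz)) (m≤n+m (Kz + b) u))) (≤-reflexive (sym l≡))

    prefix-!! : ∀ {p} → p < a + Kz → w !! p ≡ (w₁ ++ Zᴷ) !! p
    prefix-!! {p} p< = trans (cong (_!! p) (sym (++-assoc w₁ Zᴷ (U ++ Zᴷ ++ w₂))))
      (!!-++ˡ (w₁ ++ Zᴷ) (≤-trans p< (≤-reflexive (sym (trans (length-++ w₁) (cong (a +_) length-Zᴷ))))))

    start-!! : ∀ i → w !! (a + i) ≡ (Zᴷ ++ U ++ Zᴷ ++ w₂) !! i
    start-!! i = !!-++ʳ w₁ i

    middle-!! : ∀ i → w !! (a + Kz + i) ≡ (U ++ Zᴷ ++ w₂) !! i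
    middle-!! i = trans (cong (w !!_) (+-assoc a Kz i))
      (trans (start-!! (Kz + i)) (trans (cong (λ t → (Zᴷ ++ U ++ Zᴷ ++ w₂) !! (t + i))
      (sym length-Zᴷ)) (!!-++ʳ Zᴷ i)))

    end-!! : ∀ i → w !! (a + Kz + (u + i)) ≡ (Zᴷ ++ w₂) !! i
    end-!! i = trans (middle-!! (u + i)) (!!-++ʳ U i)

    -- Between w₁ and w₂ every letter occurs in Z at the same residue, relative to the end of w₁:
    -- trivially in the copies of Z, and in U because it is `Copied`.
    middle-color : ∀ {p} → a ≤ p → p + b < l → ∃[ j ] j < z × w !! p ≡ Z !! j × p ≋ a + j [mod d ]
    middle-color {p} a≤p p+b<l with p <? a + Kz
    ... | yes p<a+Kz =
      let i = p ∸ a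
          p≡ = m+[n∸m]≡n a≤p
          i<Kz = +-cancelˡ-< a i Kz (subst (_< a + Kz) (sym p≡) p<a+Kz)
          i<Z = subst (i <_) (sym length-Zᴷ) i<Kz
          j , j<z , e , i≋j = copied-Zᴷ i i<Z
      in j , j<z , trans (cong (w !!_) (sym p≡)) (trans (start-!! i) (trans (!!-++ˡ Zᴷ i<Z) e)) ,
        mod-trans (mod-reflexive (sym p≡)) (mod-+ˡ a i≋j)
    ... | no  p≮a+Kz with p ∸ (a + Kz) | m+[n∸m]≡n (≮⇒≥ p≮a+Kz)
    ... | i | refl with i <? u
    ... | yes i<u =
      let j , j<z , e , i≋j = copied i i<u
      in j , j<z , trans (middle-!! i) (trans (!!-++ˡ U i<u) e) ,
         mod-trans (mod-+ (mod-+ˡ a (multiple≋0 K)) i≋j) (mod-reflexive (cong (_+ j) (+-identityʳ a)))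
    ... | no  i≮u with i ∸ u | m+[n∸m]≡n (≮⇒≥ i≮u)
    ... | i′ | refl =
      let i′<Z = subst (i′ <_) (sym length-Zᴷ)
            (+-cancelʳ-< b i′ Kz (+-cancelˡ-< u _ _ (+-cancelˡ-< (a + Kz) _ _
            (subst₂ _<_ (trans (+-assoc (a + Kz) _ b) (cong (a + Kz +_) (+-assoc u i′ b))) l≡ p+b<l))))
          j , j<z , e , i≋j = copied-Zᴷ i′ i′<Z
      in j , j<z , trans (end-!! i′) (trans (!!-++ˡ Zᴷ i′<Z) e) ,
         mod-trans (mod-+ (mod-+ˡ a (multiple≋0 K)) (mod-+ U≋0 i≋j)) (mod-reflexive (cong (_+ j) (+-identityʳ a)))

    left-copy : ∀ k j → k < K → j < z → w !! (a + (k * z + j)) ≡ Z !! j × a + (k * z + j) ≋ a + j [mod d ]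
    left-copy k j k<K j<z = trans (start-!! (k * z + j))
      (trans (!!-++ˡ Zᴷ (subst (k * z + j <_) (sym length-Zᴷ) kz+j<Kz)) (Zᴷ-!! k j k<K j<z)) ,
      mod-+ˡ a (mod-+ (multiple≋0 k) (mod-reflexive refl))
      where
      kz+j<Kz : k * z + j < Kz
      kz+j<Kz = ≤-trans (+-monoʳ-< (k * z) j<z) (≤-trans (≤-reflexive (+-comm (k * z) z)) (*-monoˡ-≤ z k<K))

    -- Copies in the second power are counted from the right, copy 0 being the one next to w₂.
    rightCopy : ℕ → ℕ → ℕ
    rightCopy k j = a + Kz + (u + ((K ∸ suc k) * z + j))

    rightCopy+ : ∀ k j → k < K → rightCopy k j + (b + suc k * z) ≡ l + j
    rightCopy+ k j k<K = begin
      a + Kz + (u + ((K ∸ suc k) * z + j)) + (b + suc k * z)  ≡⟨ rearrange (a + Kz) u ((K ∸ suc k) * z)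
        j b (suc k * z) ⟩
      a + Kz + (u + ((K ∸ suc k) * z + suc k * z + b)) + j    ≡⟨ cong (λ t → a + Kz + (u + (t + b)) + j)
        (trans (sym (*-distribʳ-+ z (K ∸ suc k) (suc k))) (cong (_* z) (m∸n+n≡m k<K))) ⟩
      a + Kz + (u + (Kz + b)) + j                              ≡⟨ cong (_+ j) (sym l≡) ⟩
      l + j                                                  ∎
      where
      open ≡-Reasoning
      rearrange : ∀ a u x j b y → a + (u + (x + j)) + (b + y) ≡ a + (u + (x + y + b)) + j
      rearrange = solve-∀

    right-copy : ∀ k j → k < K → j < z → w !! rightCopy k j ≡ Z !! j × rightCopy k j ≋ a + j [mod d ]
    right-copy k j k<K j<z = trans (end-!! ((K ∸ suc k) * z + j))
      (trans (!!-++ˡ Zᴷ (subst ((K ∸ suc k) * z + j <_) (sym length-Zᴷ) lt)) (Zᴷ-!! (K ∸ suc k) j K∸<K j<z)) ,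
      mod-trans (mod-+ (mod-+ˡ a (multiple≋0 K)) (mod-+ U≋0 (mod-+ (multiple≋0 (K ∸ suc k)) (mod-reflexive refl))))
        (mod-reflexive (cong (_+ j) (+-identityʳ a)))
      where
      K∸<K : K ∸ suc k < K
      K∸<K = ∸-monoʳ-< {K} {suc k} {0} (s≤s z≤n) k<K
      lt : (K ∸ suc k) * z + j < Kz
      lt = ≤-trans (+-monoʳ-< ((K ∸ suc k) * z) j<z) (≤-trans (≤-reflexive (+-comm _ z)) (*-monoˡ-≤ z K∸<K))

    zone : ∀ k {q} → q < l → (q < a + k * z) ⊎ (∃[ t ] q + t ≡ l × 1 ≤ t × t ≤ b + k * z) ⊎
      (a + k * z ≤ q × q + (b + k * z) < l)
    zone k {q} q<l with q <? a + k * z | q + (b + k * z) <? l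
    ... | yes q< | _      = inj₁ q<
    ... | no  q≮ | yes <l = inj₂ (inj₂ (≮⇒≥ q≮ , <l))
    ... | no  q≮ | no  ≮l = inj₂ (inj₁ (l ∸ q , m+[n∸m]≡n (<⇒≤ q<l) , m<n⇒0<n∸m q<l , m≤n+o⇒m∸n≤o l q (≮⇒≥ ≮l)))

    right-≥ : ∀ {p t} → p + t ≡ l → t ≤ b + Kz → a + Kz ≤ p
    right-≥ {p} {t} e t≤ = +-cancelʳ-≤ (b + Kz) (a + Kz) p
      (≤-trans l≥ (≤-trans (≤-reflexive (sym e)) (+-monoʳ-≤ p t≤)))

    right-!! : ∀ {p t} → p + t ≡ l → 1 ≤ t → t ≤ b + Kz → w !! p ≡ (Zᴷ ++ w₂) !! (Kz + b ∸ t)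
    right-!! {p} {t} e 1≤t t≤ = trans (cong (w !!_) p≡) (end-!! (Kz + b ∸ t))
      where
      p≡ : p ≡ a + Kz + (u + (Kz + b ∸ t))
      p≡ = +-cancelʳ-≡ t _ _ (trans e
        (trans l≡ (sym (trans (+-assoc (a + Kz) _ t)
        (cong (a + Kz +_) (trans (+-assoc u _ t)
        (cong (u +_) (m∸n+n≡m (≤-trans t≤ (≤-reflexive (+-comm b Kz)))))))))))

  module Pair (U U′ : Word n) (U≋0 : length U ≋ 0 [mod d ]) (U′≋0 : length U′ ≋ 0 [mod d ]) (copied : Copied U)
    (copied′ : Copied U′) where

    open Word U U≋0 copied
    open Word U′ U′≋0 copied′ using () renaming
      (w to w′; l to l′; l≡ to l′≡; l≋ to l′≋; l≥ to l′≥; prefix-!! to prefix-!!′; middle-color to middle-color′;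
        left-copy to left-copy′;
       rightCopy to rightCopy′; rightCopy+ to rightCopy+′; right-copy to right-copy′; right-≥ to right-≥′;
         right-!! to right-!!′)

    -- With k rounds to go, positions in the first w₁ Zᵏ and in the last Zᵏ w₂
    -- have to be answered exactly, the others by any position that looks alike.
    data Related (k p p′ : ℕ) : Set where
      left   : p ≡ p′ → p < a + k * z → Related k p p′
      right  : ∀ t → p + t ≡ l → p′ + t ≡ l′ → 1 ≤ t → t ≤ b + k * z → Related k p p′
      middle : a + k * z ≤ p → p + (b + k * z) < l → a + k * z ≤ p′ → p′ + (b + k * z) < l′ →
               w !! p ≡ w′ !! p′ → p ≋ p′ [mod d ] → Related k p p′

    private
      bound : ∀ {k} → k ≤ K → k * z ≤ Kz
      bound k≤K = *-monoˡ-≤ z k≤K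

      left<l : ∀ {k p} → k ≤ K → p < a + k * z → p < a + Kz
      left<l k≤K p< = ≤-trans p< (+-monoʳ-≤ a (bound k≤K))

      clear-of-right : ∀ {k p l} → k < K → (a + Kz) + (b + Kz) ≤ l → p < a + suc k * z → p + (b + k * z) < l
      clear-of-right {k} k<K l≥ p< = ≤-trans (+-monoˡ-≤ (b + k * z) (left<l k<K p<))
        (≤-trans (+-monoʳ-≤ (a + Kz) (+-monoʳ-≤ b (bound (<⇒≤ k<K)))) l≥)

      clear-of-left : ∀ {k p} → k < K → a + Kz ≤ p → a + k * z ≤ p
      clear-of-left k<K ≤p = ≤-trans (+-monoʳ-≤ a (bound (<⇒≤ k<K))) ≤p

      a+sk≤ : ∀ {k p} → a + suc k * z ≤ p → a + k * z ≤ p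
      a+sk≤ {k} = ≤-trans (+-monoʳ-≤ a (m≤n+m (k * z) z))

      b+sk< : ∀ {k p l} → p + (b + suc k * z) < l → p + (b + k * z) < l
      b+sk< {k} {p} = ≤-<-trans (+-monoʳ-≤ p (+-monoʳ-≤ b (m≤n+m (k * z) z)))

    related-letter : ∀ {k p p′} → k ≤ K → Related k p p′ → w !! p ≡ w′ !! p′
    related-letter k≤K (left refl p<) = trans (prefix-!! (left<l k≤K p<)) (sym (prefix-!!′ (left<l k≤K p<)))
    related-letter k≤K (right t e e′ 1≤t t≤) = trans (right-!! e 1≤t t≤′) (sym (right-!!′ e′ 1≤t t≤′))
      where t≤′ = ≤-trans t≤ (+-monoʳ-≤ b (bound k≤K))
    related-letter k≤K (middle _ _ _ _ e _) = e

    related-residue : ∀ {k p p′} → k ≤ K → Related k p p′ → p ≋ p′ [mod d ]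
    related-residue k≤K (left e _) = mod-reflexive e
    related-residue k≤K (right t e e′ _ _) =
      mod-cancelʳ t (mod-trans (mod-reflexive e) (mod-trans l≋ (mod-trans (mod-sym l′≋) (mod-reflexive (sym e′)))))
    related-residue k≤K (middle _ _ _ _ _ e) = e

    related-pred : ∀ {k p p′} → k < K → Related (suc k) p p′ → Related k p p′
    related-pred {k} {p} k<K r@(left refl p<) with p <? a + k * z
    ... | yes p<′ = left refl p<′
    ... | no  p≮  = middle (≮⇒≥ p≮) (clear-of-right k<K l≥ p<) (≮⇒≥ p≮) (clear-of-right k<K l′≥ p<)
      (related-letter k<K r) (related-residue k<K r)
    related-pred {k} {p} {p′} k<K r@(right t e e′ 1≤t t≤) with t ≤? b + k * z
    ... | yes t≤′ = right t e e′ 1≤t t≤′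
    ... | no  t≰  = middle (clear-of-left k<K (right-≥ e t≤K)) (subst (p + (b + k * z) <_) e (+-monoʳ-< p (≰⇒> t≰)))
                           (clear-of-left k<K (right-≥′ e′ t≤K)) (subst (p′ + (b + k * z) <_) e′
                             (+-monoʳ-< p′ (≰⇒> t≰)))
                           (related-letter k<K r) (related-residue k<K r)
      where t≤K = ≤-trans t≤ (+-monoʳ-≤ b (bound k<K))
    related-pred {k} {p} {p′} k<K (middle a≤ <l a≤′ <l′ e e′) = middle (a+sk≤ {k} a≤) (b+sk< {k} {p} <l)
      (a+sk≤ {k} a≤′) (b+sk< {k} {p′} <l′) e e′

    Answer : ℕ → ℕ → ℕ → ℕ → Set
    Answer k p p′ q = ∃[ q′ ] q′ < l′ × Related k q q′ × SameOrder p q p′ q′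

    -- Copy k from the left lies outside the exact zone for k rounds but inside the one for k + 1
    -- rounds. It shows every letter of Z at its residue, so a look-alike of q is found to the left
    -- of any pebble outside the larger zone.
    answer-left-copy : ∀ {k q} → k < K → a + k * z ≤ q → q + (b + k * z) < l →
      ∃[ q′ ] q′ < a + suc k * z × q′ < l′ × Related k q q′
    answer-left-copy {k} {q} k<K a≤q q<l with middle-color (≤-trans (m≤m+n a (k * z)) a≤q)
      (≤-<-trans (+-monoʳ-≤ q (m≤m+n b (k * z))) q<l)
    ... | j , j<z , e , q≋j with left-copy′ k j k<K j<z
    ... | e′ , q′≋j = q′ , q′< , ≤-<-trans (m≤m+n q′ (b + k * z)) q′<l′ ,
      middle a≤q q<l (+-monoʳ-≤ a (m≤m+n (k * z) j)) q′<l′ (trans e (sym e′)) (mod-trans q≋j (mod-sym q′≋j))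
      where
      q′ = a + (k * z + j)
      q′< : q′ < a + suc k * z
      q′< = +-monoʳ-< a (≤-trans (+-monoʳ-< (k * z) j<z) (≤-reflexive (+-comm (k * z) z)))
      q′<l′ : q′ + (b + k * z) < l′
      q′<l′ = clear-of-right k<K l′≥ q′<

    answer-right-copy : ∀ {k q} → k < K → a + k * z ≤ q → q + (b + k * z) < l →
      ∃[ q′ ] l′ ≤ q′ + (b + suc k * z) × q′ < l′ × Related k q q′
    answer-right-copy {k} {q} k<K a≤q q<l with middle-color (≤-trans (m≤m+n a (k * z)) a≤q)
      (≤-<-trans (+-monoʳ-≤ q (m≤m+n b (k * z))) q<l)
    ... | j , j<z , e , q≋j with right-copy′ k j k<K j<z
    ... | e′ , q′≋j = q′ , ≤-trans (m≤m+n l′ j) (≤-reflexive (sym (rightCopy+′ k j k<K))) ,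
      ≤-<-trans (m≤m+n q′ (b + k * z)) q′<l′ ,
      middle a≤q q<l (clear-of-left k<K (m≤m+n (a + Kz) _)) q′<l′ (trans e (sym e′)) (mod-trans q≋j (mod-sym q′≋j))
      where
      q′ = rightCopy′ k j
      rearrange : ∀ q b z x → q + (b + (z + x)) ≡ q + (b + x) + z
      rearrange = solve-∀
      q′<l′ : q′ + (b + k * z) < l′
      q′<l′ = +-cancelʳ-< z _ _ (subst (_< l′ + z) (trans (sym (rightCopy+′ k j k<K)) (rearrange q′ b z (k * z)))
        (+-monoʳ-< l′ j<z))

    -- A move into an end zone is answered exactly. A move into the middle is also answered exactly
    -- if it lies between an end and a pebble in the zone of that end; otherwise it is answered by a
    -- look-alike in copy k, counted from the left if q is before p and from the right if q is after
    -- p.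
    forth : ∀ {k p p′} → k < K → Related (suc k) p p′ → ∀ {q} → q < l → Answer k p p′ q
    forth {k} {p} {p′} k<K r {q} q<l with <-cmp q p
    ... | tri≈ _ refl _ = p′ , p′<l′ r , related-pred k<K r , sameOrder-≡
      where
      p′<l′ : Related (suc k) q p′ → p′ < l′
      p′<l′ (left refl p<) = ≤-trans (left<l k<K p<) (≤-trans (m≤m+n (a + Kz) (b + Kz)) l′≥)
      p′<l′ (right t _ e′ 1≤t _) = ≤-trans (m<m+n p′ 1≤t) (≤-reflexive e′)
      p′<l′ (middle _ _ _ p′< _ _) = ≤-<-trans (m≤m+n p′ _) p′<
    ... | tri< q<p _ _ with zone k q<l
    ... | inj₁ q<left = q , ≤-trans (left<l (<⇒≤ k<K) q<left) (≤-trans (m≤m+n (a + Kz) (b + Kz)) l′≥) ,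
      left refl q<left , sameOrder-> q<p (q<p′ r)
      where
      q<p′ : Related (suc k) p p′ → q < p′
      q<p′ (left refl _) = q<p
      q<p′ (right t _ e′ _ t≤) = ≤-trans (left<l (<⇒≤ k<K) q<left)
        (right-≥′ e′ (≤-trans t≤ (+-monoʳ-≤ b (bound k<K))))
      q<p′ (middle _ _ a≤p′ _ _ _) = ≤-trans q<left (a+sk≤ {k} a≤p′)
    ... | inj₂ (inj₁ (t , q+t≡l , 1≤t , t≤)) = answer r
      where
      t≤K : t ≤ b + Kz
      t≤K = ≤-trans t≤ (+-monoʳ-≤ b (bound (<⇒≤ k<K)))
      q′+t≡l′ : l′ ∸ t + t ≡ l′
      q′+t≡l′ = m∸n+n≡m (≤-trans t≤K (≤-trans (m≤n+m (b + Kz) (a + Kz)) l′≥))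
      q′<l′ : l′ ∸ t < l′
      q′<l′ = ≤-trans (m<m+n (l′ ∸ t) 1≤t) (≤-reflexive q′+t≡l′)
      answer : Related (suc k) p p′ → Answer k p p′ q
      answer (left refl p<) = contradiction (≤-trans (left<l k<K p<) (right-≥ q+t≡l t≤K)) (<-asym q<p)
      answer (middle _ p<l _ _ _ _) = contradiction p<l (≤⇒≯ (begin
        l                       ≡⟨ sym q+t≡l ⟩
        q + t                   ≤⟨ +-mono-≤ (<⇒≤ q<p) (≤-trans t≤ (+-monoʳ-≤ b (m≤n+m (k * z) z))) ⟩
        p + (b + suc k * z)     ∎))
        where open ≤-Reasoning
      answer (right t₂ e₂ e₂′ _ _) = l′ ∸ t , q′<l′ , right t q+t≡l q′+t≡l′ 1≤t t≤ , sameOrder-> q<p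
        (+-cancelʳ-< t₂ _ _ (≤-trans (+-monoʳ-< (l′ ∸ t) t₂<t) (≤-reflexive (trans q′+t≡l′ (sym e₂′)))))
        where
        t₂<t : t₂ < t
        t₂<t = +-cancelˡ-< q _ _ (≤-trans (+-monoˡ-< t₂ q<p) (≤-reflexive (trans e₂ (sym q+t≡l))))
    ... | inj₂ (inj₂ (a≤q , q<right)) = answer r
      where
      copy : a + suc k * z ≤ p′ → Answer k p p′ q
      copy ≤p′ = let q′ , q′< , q′<l′ , rel = answer-left-copy k<K a≤q q<right in q′ , q′<l′ , rel ,
        sameOrder-> q<p (≤-trans q′< ≤p′)
      answer : Related (suc k) p p′ → Answer k p p′ q
      answer (left refl p<) = q , ≤-trans (<-trans q<p (left<l k<K p<)) (≤-trans (m≤m+n (a + Kz) (b + Kz)) l′≥) ,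
        middle a≤q q<right a≤q (clear-of-right k<K l′≥ (<-trans q<p p<))
          (related-letter k<K (left refl (<-trans q<p p<))) (mod-reflexive refl) , sameOrder-> q<p q<p
      answer (right t _ e′ _ t≤) = copy (≤-trans (+-monoʳ-≤ a (bound k<K))
        (right-≥′ e′ (≤-trans t≤ (+-monoʳ-≤ b (bound k<K)))))
      answer (middle _ _ a≤p′ _ _ _) = copy a≤p′
    forth {k} {p} {p′} k<K r {q} q<l | tri> _ _ p<q with zone k q<l
    ... | inj₁ q<left = answer r
      where
      answer : Related (suc k) p p′ → Answer k p p′ q
      answer (left refl _) = q , ≤-trans (left<l (<⇒≤ k<K) q<left) (≤-trans (m≤m+n (a + Kz) (b + Kz)) l′≥) ,
        left refl q<left , sameOrder-< p<q p<q
      answer (right t e _ _ t≤) = contradiction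
        (≤-trans (left<l (<⇒≤ k<K) q<left) (right-≥ e (≤-trans t≤ (+-monoʳ-≤ b (bound k<K))))) (<-asym p<q)
      answer (middle a≤p _ _ _ _ _) = contradiction (≤-trans q<left (a+sk≤ {k} a≤p)) (<-asym p<q)
    ... | inj₂ (inj₁ (t , q+t≡l , 1≤t , t≤)) = l′ ∸ t , q′<l′ , right t q+t≡l q′+t≡l′ 1≤t t≤ ,
      sameOrder-< p<q (p′<q′ r)
      where
      t≤K : t ≤ b + Kz
      t≤K = ≤-trans t≤ (+-monoʳ-≤ b (bound (<⇒≤ k<K)))
      q′+t≡l′ : l′ ∸ t + t ≡ l′
      q′+t≡l′ = m∸n+n≡m (≤-trans t≤K (≤-trans (m≤n+m (b + Kz) (a + Kz)) l′≥))
      q′<l′ : l′ ∸ t < l′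
      q′<l′ = ≤-trans (m<m+n (l′ ∸ t) 1≤t) (≤-reflexive q′+t≡l′)
      p′<q′ : Related (suc k) p p′ → p′ < l′ ∸ t
      p′<q′ (left refl p<) = ≤-trans (left<l k<K p<) (right-≥′ q′+t≡l′ t≤K)
      p′<q′ (right t₂ e₂ e₂′ _ _) = +-cancelʳ-< t _ _
        (≤-trans (+-monoʳ-< p′ t<t₂) (≤-reflexive (trans e₂′ (sym q′+t≡l′))))
        where
        t<t₂ : t < t₂
        t<t₂ = +-cancelˡ-< p _ _ (≤-trans (+-monoˡ-< t p<q) (≤-reflexive (trans q+t≡l (sym e₂))))
      p′<q′ (middle _ _ _ p′<l′ _ _) = +-cancelʳ-< t _ _
        (≤-trans (≤-<-trans (+-monoʳ-≤ p′ (≤-trans t≤ (+-monoʳ-≤ b (m≤n+m (k * z) z)))) p′<l′)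
        (≤-reflexive (sym q′+t≡l′)))
    ... | inj₂ (inj₂ (a≤q , q<right)) = answer r
      where
      copy : p′ + (b + suc k * z) < l′ → Answer k p p′ q
      copy p′<l′ = let q′ , ≤q′ , q′<l′ , rel = answer-right-copy k<K a≤q q<right in q′ , q′<l′ , rel ,
        sameOrder-< p<q (+-cancelʳ-< (b + suc k * z) _ _ (≤-trans p′<l′ ≤q′))
      answer : Related (suc k) p p′ → Answer k p p′ q
      answer (left refl p<) = copy (≤-trans (+-monoˡ-≤ (b + suc k * z) (left<l k<K p<))
        (≤-trans (+-monoʳ-≤ (a + Kz) (+-monoʳ-≤ b (bound k<K))) l′≥))
      answer (middle _ _ _ p′<l′ _ _) = copy p′<l′
      answer (right t₂ e₂ e₂′ _ t₂≤) = q′ , ≤-trans (m<m+n q′ 1≤t) (≤-reflexive q′+t≡l′) ,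
          middle a≤q q<right (clear-of-left k<K (right-≥′ q′+t≡l′ t≤K)) q′<right
            (related-letter k<K (right t q+t≡l q′+t≡l′ 1≤t t≤)) (related-residue k<K (right t q+t≡l q′+t≡l′ 1≤t t≤)) ,
          sameOrder-< p<q (+-cancelʳ-< t _ _ (≤-trans (+-monoʳ-< p′ t<t₂) (≤-reflexive (trans e₂′ (sym q′+t≡l′)))))
        where
        t = l ∸ q
        q′ = l′ ∸ t
        q+t≡l : q + t ≡ l
        q+t≡l = m+[n∸m]≡n (<⇒≤ q<l)
        1≤t : 1 ≤ t
        1≤t = m<n⇒0<n∸m q<l
        t<t₂ : t < t₂
        t<t₂ = +-cancelˡ-< p _ _ (≤-trans (+-monoˡ-< t p<q) (≤-reflexive (trans q+t≡l (sym e₂))))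
        t≤ : t ≤ b + suc k * z
        t≤ = ≤-trans (<⇒≤ t<t₂) t₂≤
        t≤K : t ≤ b + Kz
        t≤K = ≤-trans t≤ (+-monoʳ-≤ b (bound k<K))
        q′+t≡l′ : q′ + t ≡ l′
        q′+t≡l′ = m∸n+n≡m (≤-trans t≤K (≤-trans (m≤n+m (b + Kz) (a + Kz)) l′≥))
        q′<right : q′ + (b + k * z) < l′
        q′<right = subst (q′ + (b + k * z) <_) q′+t≡l′
          (+-monoʳ-< q′ (+-cancelˡ-< q _ _ (≤-trans q<right (≤-reflexive (sym q+t≡l)))))

  module _ (U U′ : Word n) (U≋0 : length U ≋ 0 [mod d ]) (U′≋0 : length U′ ≋ 0 [mod d ]) (copied : Copied U)
    (copied′ : Copied U′) where

    private
      module P = Pair U U′ U≋0 U′≋0 copied copied′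
      module P′ = Pair U′ U U′≋0 U≋0 copied′ copied
      module W = Word U U≋0 copied
      module W′ = Word U′ U′≋0 copied′

      -- The relation is symmetric in the two words, so `back` is `forth` for the exchanged pair.
      swap : ∀ {k p p′} → P.Related k p p′ → P′.Related k p′ p
      swap (P.left refl p<)               = P′.left refl p<
      swap (P.right t e e′ 1≤t t≤)        = P′.right t e′ e 1≤t t≤
      swap (P.middle ≤p p< ≤p′ p′< e res) = P′.middle ≤p′ p′< ≤p p< (sym e) (mod-sym res)

      unswap : ∀ {k p p′} → P′.Related k p′ p → P.Related k p p′
      unswap (P′.left refl p<)               = P.left refl p<
      unswap (P′.right t e e′ 1≤t t≤)        = P.right t e′ e 1≤t t≤
      unswap (P′.middle ≤p p< ≤p′ p′< e res) = P.middle ≤p′ p′< ≤p p< (sym e) (mod-sym res)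

    pumping-game : Game d K W.w W′.w
    pumping-game = record
      { Related         = P.Related
      ; related-letter  = P.related-letter
      ; related-residue = P.related-residue
      ; related-pred    = P.related-pred
      ; forth           = λ {k} k<K r q → let q′ , q′<l′ , rel , o = P.forth k<K r (toℕ<n q) ; e = toℕ-fromℕ< q′<l′
                          in fromℕ< q′<l′ , subst (P.Related k (toℕ q)) (sym e) rel ,
                            subst (SameOrder _ (toℕ q) _) (sym e) o
      ; back            = λ {k} k<K r q′ → let q , q<l , rel , o = P′.forth k<K (swap r) (toℕ<n q′) ;
                                                 e = toℕ-fromℕ< q<l
                          in fromℕ< q<l , subst (λ q → P.Related k q (toℕ q′)) (sym e) (unswap rel) ,
                            subst (λ q → SameOrder _ q _ (toℕ q′)) (sym e) (sameOrder-sym o)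
      ; same-length     = mod-trans W.l≋ (mod-sym W′.l≋)
      }

    pumping : (φ : Formula [<,MOD] n 2) → Predicates (ModuliDivide d) φ → rank φ < K → (W.w ⊨ φ) ⇔ (W′.w ⊨ φ)
    -- Both pebbles start at 0. Keeping one round more than the rank makes the exact left zone
    -- contain 0 even if w₁ is empty and the rank is 0.
    pumping φ moduli rank<K = Game.game-sound pumping-game {k = suc (rank φ)} φ moduli (n≤1+n (rank φ)) rank<K
      ((λ x → P.left refl (≤-trans (>-nonZero⁻¹ z) (≤-trans (m≤m+n z (rank φ * z)) (m≤n+m _ a)))) ,
        λ x y → sameOrder-≡)

-- The syntactic congruence and the decision procedure for FO²[<,MOD]

power-length : ∀ {s} {{_ : NonZero s}} k (u : List A) → length u ≋ 0 [mod s ] → length (power k u) ≋ 0 [mod s ]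
power-length zero    u u≋0 = mod-reflexive refl
power-length (suc k) u u≋0 = mod-trans (mod-reflexive (length-++ u)) (mod-+ u≋0 (power-length k u u≋0))

++-length : ∀ {s} {{_ : NonZero s}} (u w : List A) → length u ≋ 0 [mod s ] → length w ≋ 0 [mod s ] →
  length (u ++ w) ≋ 0 [mod s ]
++-length u w u≋0 w≋0 = mod-trans (mod-reflexive (length-++ u)) (mod-+ u≋0 w≋0)

module Syntactic {n : ℕ} (M : DFA n) where

  open DFA M using (states; start; δ; final)

  s : ℕ
  s = proj₁ (stability M)

  instance
    s≢0 : NonZero s
    s≢0 = >-nonZero (proj₁ (proj₂ (stability M)))

  member? : ∀ w → Dec (L M w)
  member? w = foldl δ start w Subset.∈? final

  infix 4 _∼ᴹ_
  _∼ᴹ_ : Word n → Word n → Set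
  _∼ᴹ_ = _∼_ M

  infix 4 _≃_
  _≃_ : Word n → Word n → Set
  u ≃ v = ∀ x y → L M (x ++ u ++ y) ⇔ L M (x ++ v ++ y)

  ≃-trans : ∀ {u v w} → u ≃ v → v ≃ w → u ≃ w
  ≃-trans e e′ x y = e x y ⟨⇔⟩ e′ x y

  ≃-++ : ∀ {u u′ v v′} → u ≃ u′ → v ≃ v′ → u ++ v ≃ u′ ++ v′
  ≃-++ {u} {u′} {v} {v′} e e′ x y =
    ⇔-reflexive (cong (λ t → L M (x ++ t)) (++-assoc u v y)) ⟨⇔⟩ e x (v ++ y) ⟨⇔⟩
    ⇔-reflexive (cong (L M) (sym (++-assoc x u′ (v ++ y)))) ⟨⇔⟩ e′ (x ++ u′) y ⟨⇔⟩
    ⇔-reflexive (cong (L M) (trans (++-assoc x u′ (v′ ++ y)) (cong (x ++_) (sym (++-assoc u′ v′ y)))))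

  ∼⇒≃ : ∀ {u v} → u ∼ᴹ v → u ≃ v
  ∼⇒≃ {u} {v} e x y = ∼⇒L M {x ++ u ++ y} {x ++ v ++ y} (∼-++ M {x} {x} {u ++ y} {v ++ y} (λ _ → refl)
    (∼-++ M {u} {v} {y} {y} e (λ _ → refl)))

  private
    N₀ C₀ : ℕ
    N₀ = states ^ states
    C₀  = length (shorter n N₀)

    context : Fin C₀ → Word n
    context = lookup (shorter n N₀)

    -- Contexts act through their transformations, and words shorter than the bound `N₀` realise all
    -- of these. So finitely many tests determine a syntactic class.
    represent : ∀ x → ∃[ i ] context i ∼ᴹ x
    represent x =
      let x′ , x′<N₀ , e = shorten (transition M) (λ {u} {u′} w e → transition-cong M {u ++ w} {u′ ++ w}
            (∼-++ M {u} {u′} {w} {w} (transition⇒∼ M {u} {u′} e) (λ _ → refl))) x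
          x′∈ = ∈-shorter⁺ {u = x′} x′<N₀
      in index x′∈ , subst (_∼ᴹ x) (Any.lookup-index x′∈) (transition⇒∼ M {x′} {x} e)

    bit : Word n → Fin 2
    bit w = if ⌊ member? w ⌋ then suc zero else zero

    bit⇒L : ∀ u v → bit u ≡ bit v → L M u ⇔ L M v
    bit⇒L u v e with member? u | member? v
    bit⇒L u v e  | yes u∈ | yes v∈ = mk⇔ (λ _ → v∈) (λ _ → u∈)
    bit⇒L u v () | yes _  | no _
    bit⇒L u v () | no _   | yes _
    bit⇒L u v e  | no u∉  | no v∉  = mk⇔ (⊥-elim ∘ u∉) (⊥-elim ∘ v∉)

    L⇒bit : ∀ u v → L M u ⇔ L M v → bit u ≡ bit v
    L⇒bit u v e with member? u | member? v
    ... | yes _  | yes _  = refl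
    ... | no _   | no _   = refl
    ... | yes u∈ | no v∉  = contradiction (to e u∈) v∉
    ... | no u∉  | yes v∈ = contradiction (from e v∈) u∉

    tested : Word n → Fin (C₀ * C₀) → Fin 2
    tested u i = bit (context (proj₁ (Fin.remQuot {C₀} C₀ i)) ++ u ++ context (proj₂ (Fin.remQuot {C₀} C₀ i)))

  N : ℕ
  N = 2 ^ (C₀ * C₀) * s

  abstract
    -- The syntactic class of a word, with its length modulo s
    κ : Word n → Fin N
    κ u = Fin.combine (funToFin (tested u)) (length u mod s)

    κ⇒≃ : ∀ {u v} → κ u ≡ κ v → u ≃ v
    κ⇒≃ {u} {v} e x y =
      let i , i∼x = represent x
          j , j∼y = represent y
          tests : tested u (Fin.combine i j) ≡ tested v (Fin.combine i j)
          tests = trans (sym (Fin.finToFun-funToFin (tested u) (Fin.combine i j)))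
                    (trans (cong (λ t → finToFun t (Fin.combine i j))
                      (proj₁ (Fin.combine-injective (funToFin (tested u)) (length u mod s) (funToFin (tested v))
                      (length v mod s) e))) (Fin.finToFun-funToFin (tested v) (Fin.combine i j)))
          bits : bit (context i ++ u ++ context j) ≡ bit (context i ++ v ++ context j)
          bits = subst (λ ij → bit (context (proj₁ ij) ++ u ++ context (proj₂ ij))
            ≡ bit (context (proj₁ ij) ++ v ++ context (proj₂ ij))) (Fin.remQuot-combine i j) tests
          replace : ∀ w → context i ++ w ++ context j ∼ᴹ x ++ w ++ y
          replace w = ∼-++ M {context i} {x} {w ++ context j} {w ++ y} i∼x
            (∼-++ M {w} {w} {context j} {y} (λ _ → refl) j∼y)
      in ⇔-sym (∼⇒L M {context i ++ u ++ context j} {x ++ u ++ y} (replace u)) ⟨⇔⟩ bit⇒L (context i ++ u ++ context j)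
        (context i ++ v ++ context j) bits ⟨⇔⟩
         ∼⇒L M {context i ++ v ++ context j} {x ++ v ++ y} (replace v)

    κ⇒length : ∀ {u v} → κ u ≡ κ v → length u ≋ length v [mod s ]
    κ⇒length {u} {v} e = residue (trans (sym (toℕ-fromℕ< _))
      (trans (cong toℕ (proj₂ (Fin.combine-injective (funToFin (tested u)) (length u mod s) (funToFin (tested v))
      (length v mod s) e))) (toℕ-fromℕ< _)))

    ≃⇒κ : ∀ {u v} → u ≃ v → length u ≋ length v [mod s ] → κ u ≡ κ v
    ≃⇒κ {u} {v} e (residue e′) = cong₂ Fin.combine
      (funToFin-cong {f = tested u} {tested v} λ i → let x = context (proj₁ (Fin.remQuot {C₀} C₀ i)) ; y =
                                                           context (proj₂ (Fin.remQuot {C₀} C₀ i)) in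
        L⇒bit (x ++ u ++ y) (x ++ v ++ y) (e x y))
      (Fin.toℕ-injective (trans (toℕ-fromℕ< _) (trans e′ (sym (toℕ-fromℕ< _)))))

  κ-++ : ∀ {u u′ v v′} → κ u ≡ κ u′ → κ v ≡ κ v′ → κ (u ++ v) ≡ κ (u′ ++ v′)
  κ-++ {u} {u′} {v} {v′} e e′ = ≃⇒κ (≃-++ {u} {u′} {v} {v′} (κ⇒≃ e) (κ⇒≃ e′))
    (mod-trans (mod-reflexive (length-++ u)) (mod-trans (mod-+ (κ⇒length e) (κ⇒length e′))
      (mod-reflexive (sym (length-++ u′)))))

  κ-power : ∀ k {u v} → κ u ≡ κ v → κ (power k u) ≡ κ (power k v)
  κ-power zero    e = refl
  κ-power (suc k) {u} {v} e = κ-++ {u} {v} {power k u} {power k v} e (κ-power k e)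

  -- The argument that produced s, applied to the powers of Z. The case c = 1 gives idempotence, and
  -- large c give as many copies of Z as a game requires.
  exponent : ∀ Z → ∃[ ω ] 1 ≤ ω × (∀ c → κ (power ω Z) ≡ κ (power (ω + ω * c) Z))
  exponent Z = stable (λ k → κ (power k Z)) (λ i j → κ (power i Z) ≡ κ (power j Z)) id refl trans
    λ k {i} {j} e → trans (cong κ (power-+ k i Z)) (trans (κ-++ {power k Z} refl e) (cong κ (sym (power-+ k j Z))))

  idempotent : Word n → Word n
  idempotent Z = power (proj₁ (exponent Z)) Z

  idempotent-≡ : ∀ Z → κ (idempotent Z ++ idempotent Z) ≡ κ (idempotent Z)
  idempotent-≡ Z = sym (trans (proj₂ (proj₂ (exponent Z)) 1)
    (cong κ (trans (cong (λ k → power (ω + k) Z) (*-identityʳ ω)) (power-+ ω ω Z))))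
    where ω = proj₁ (exponent Z)

  Identities : Word n → Word n → Set
  Identities X Y = let e = idempotent (X ++ Y) in κ (e ++ Y ++ e) ≡ κ e × κ (e ++ X ++ e) ≡ κ e

  -- Words shorter than N represent all values of κ, and κ determines the length modulo s, so this
  -- finite test amounts to the identities for all words. Idempotence is not tested, as the choice
  -- of the exponent ensures it.
  Condition : Set
  Condition = ∀ i j → length (lookup (shorter n N) i) % s ≡ 0 % s → length (lookup (shorter n N) j) % s ≡ 0 % s →
    Identities (lookup (shorter n N) i) (lookup (shorter n N) j)

  condition? : Dec Condition
  condition? = all? λ i → all? λ j → (_ ≟ _) →-dec ((_ ≟ _) →-dec ((_ Fin.≟ _) ×-dec (_ Fin.≟ _)))

  short : ∀ u → Σ[ i ∈ Fin (length (shorter n N)) ] κ (lookup (shorter n N) i) ≡ κ u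
  short u = let v , v<N , e = shorten κ (λ {u} {u′} w e → κ-++ {u} {u′} {w} {w} e refl) u ; v∈ =
                  ∈-shorter⁺ {u = v} v<N
            in index v∈ , trans (cong κ (sym (Any.lookup-index v∈))) e

  condition⇒DA : Condition → DA n s κ
  condition⇒DA condition = record
    { ++-cong = λ {u} {u′} {v} {v′} → κ-++ {u} {u′} {v} {v′}
    ; length-cong = κ⇒length
    ; identity = identity
    }
    where
    identity : ∀ X Y → length X ≋ 0 [mod s ] → length Y ≋ 0 [mod s ] → ∃[ ω ]
               (let e = power ω (X ++ Y) in κ (e ++ e) ≡ κ e × κ (e ++ Y ++ e) ≡ κ e × κ (e ++ X ++ e) ≡ κ e)
    identity X Y X≋0 Y≋0 = ω , trans (κ-++ {e} {e′} {e} {e′} e≡ e≡) (trans (idempotent-≡ (X′ ++ Y′)) (sym e≡)) ,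
      sandwich Y Y′ κY (proj₁ identities) , sandwich X X′ κX (proj₂ identities)
      where
      i = proj₁ (short X)
      j = proj₁ (short Y)
      X′ = lookup (shorter n N) i
      Y′ = lookup (shorter n N) j
      κX : κ X ≡ κ X′
      κX = sym (proj₂ (short X))
      κY : κ Y ≡ κ Y′
      κY = sym (proj₂ (short Y))
      ω = proj₁ (exponent (X′ ++ Y′))
      e = power ω (X ++ Y)
      e′ = power ω (X′ ++ Y′)
      e≡ : κ e ≡ κ e′
      e≡ = κ-power ω (κ-++ {X} {X′} {Y} {Y′} κX κY)
      identities = condition i j (sameResidue (mod-trans (κ⇒length (sym κX)) X≋0))
        (sameResidue (mod-trans (κ⇒length (sym κY)) Y≋0))
      sandwich : ∀ U U′ → κ U ≡ κ U′ → κ (e′ ++ U′ ++ e′) ≡ κ e′ → κ (e ++ U ++ e) ≡ κ e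
      sandwich U U′ κU h = trans (κ-++ {e} {e′} {U ++ e} {U′ ++ e′} e≡ (κ-++ {U} {U′} {e} {e′} κU e≡))
        (trans h (sym e≡))

  private
    faithful : Faithful (_mod s)
    faithful {p} {q} = mk⇔ (λ e → residue (trans (sym (toℕ-fromℕ< _)) (trans (cong toℕ e) (toℕ-fromℕ< _))))
                           (λ (residue e) → Fin.toℕ-injective (trans (toℕ-fromℕ< _) (trans e (sym (toℕ-fromℕ< _)))))

  condition⇒FO² : Condition → L M BelongsTo FO² [<,MOD]
  condition⇒FO² condition = 2 , χ , closed⇒sentence χ-closed , refl , correct
    where
    open FO²-Expressions {n} {s}
    rep : Fin (length (shorter n N)) → Word n
    rep = lookup (shorter n N)
    defining : ∀ i → Σ (Expression (n * s)) (Recognises κ Subset.⊤ (_mod s) (rep i))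
    defining i = recognise (condition⇒DA condition) Subset.⊤ (⊂-wellFounded Subset.⊤) (_mod s) faithful (rep i)
    class-of : Fin (length (shorter n N)) → Formula [<,MOD] n 2
    -- `Recognises` speaks only of words with the length of the representative modulo s, which the
    -- length predicate checks first.
    class-of i = ⌜ ⌊ member? (rep i) ⌋ ⌝ ∧ pred (D- s (length (rep i) mod s)) (inj₂ (s , refl)) [] ∧ formula
      (proj₁ (defining i)) (inside′ Subset.⊤)
    χ : Formula [<,MOD] n 2
    χ = ⋁ _ class-of
    χ-closed : Closed χ
    χ-closed = free-⋁ _ λ i → free-∧ (free-⌜⌝ ⌊ member? (rep i) ⌋)
      (free-∧ (free-pred []) (expression-closed (proj₁ (defining i))))
    everything : ∀ w → All (Subset._∈ Subset.⊤) (enrich (_mod s) w)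
    everything w = All.tabulate λ _ → Subset.∈⊤
    sat-class : ∀ i w → (w ⊨ class-of i) ⇔ (L M (rep i) × κ w ≡ κ (rep i))
    sat-class i w = mk⇔
      (λ (t , d , f) → toWitness (to (sat-⌜⌝ {b = ⌊ member? (rep i) ⌋}) t) ,
        to (proj₂ (defining i) w (everything w) (residue (trans d (toℕ-fromℕ< _))))
          (to (sat-expression w (proj₁ (defining i))) f))
      (λ (rep∈L , e) → from (sat-⌜⌝ {b = ⌊ member? (rep i) ⌋}) (fromWitness rep∈L) ,
        trans (sameResidue (κ⇒length e)) (sym (toℕ-fromℕ< _)) ,
        from (sat-expression w (proj₁ (defining i))) (from (proj₂ (defining i) w (everything w) (κ⇒length e)) e))
    κ⇒L : ∀ {u v} → κ u ≡ κ v → L M u ⇔ L M v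
    κ⇒L {u} {v} e = ⇔-reflexive (cong (L M) (sym (++-identityʳ u))) ⟨⇔⟩ κ⇒≃ e [] [] ⟨⇔⟩ ⇔-reflexive
      (cong (L M) (++-identityʳ v))
    correct : ∀ w → L M w ⇔ (w ⊨ χ)
    correct w = mk⇔ (λ w∈L → let i , e = short w in
      from (sat-⋁ _) (i , from (sat-class i w) (from (κ⇒L e) w∈L , sym e)))
                    (λ t → let i , t′ = to (sat-⋁ _ {class-of}) t ; m∈L , e = to (sat-class i w) t′ in
                      from (κ⇒L e) m∈L)

  -- By `stability`, block by block. It makes lengths divisible by the moduli of any given formula,
  -- which is why divisibility by s is the right restriction in the identities.
  stretch : ∀ t X → length X ≋ 0 [mod s ] → Σ[ X′ ∈ Word n ] (∃[ l ] length X′ ≡ l * (s + s * t)) × X ∼ᴹ X′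
  stretch t X (residue X≋0) with Reduction.divide (λ _ → ⊤) 0 M (length X / s) X
    (trans (m≡m%n+[m/n]*n (length X) s) (cong (_+ length X / s * s) (trans X≋0 (m*n%n≡0 0 s))))
  ... | W , refl = concatMap g W , (length W , length-expand g (λ b → proj₁ (proj₂ (longer b))) W) , images W
    where
    longer : ∀ b → Σ[ u ∈ Word n ] length u ≡ s + s * t × word s b ∼ᴹ u
    longer b = proj₂ (proj₂ (stability M)) t (word s b) (length-word s b)
    g : Fin (n ^ s) → Word n
    g b = proj₁ (longer b)
    images : ∀ W → concatMap (word s) W ∼ᴹ concatMap g W
    images []      = λ _ → refl
    images (b ∷ W) = ∼-++ M {word s b} {g b} {concatMap (word s) W} {concatMap g W}
      (proj₂ (proj₂ (longer b))) (images W)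

  ∼-power : ∀ k {u v} → u ∼ᴹ v → power k u ∼ᴹ power k v
  ∼-power zero            e = λ _ → refl
  ∼-power (suc k) {u} {v} e = ∼-++ M {u} {v} {power k u} {power k v} e (∼-power k {u} {v} e)

  FO²⇒identities : L M BelongsTo FO² [<,MOD] → ∀ X Y → length X ≋ 0 [mod s ] → length Y ≋ 0 [mod s ] → Identities X Y
  FO²⇒identities (_ , φ , φ-sentence , refl , L⇔φ) X Y X≋0 Y≋0 = omit Y Y≋0 Y′ Y∼Y′ Y′≋0 copied-Y ,
    omit X X≋0 X′ X∼X′ X′≋0 copied-X
    where
    t = modulus φ ∸ 1
    d = s + s * t
    instance
      d≢0 : NonZero d
      d≢0 = >-nonZero (≤-trans (>-nonZero⁻¹ s) (m≤m+n s (s * t)))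
    d≡ : d ≡ s * modulus φ
    d≡ = trans (cong (_+ s * t) (sym (*-identityʳ s)))
      (trans (sym (*-distribˡ-+ s 1 t)) (cong (s *_) (m+[n∸m]≡n (modulus>0 φ))))
    moduli : Predicates (ModuliDivide d) φ
    moduli = moduliDivide φ (divides s d≡)
    divisible : ∀ {u : Word n} → (∃[ l ] length u ≡ l * d) → length u ≋ 0 [mod d ]
    divisible (l , e) = mod-trans (mod-reflexive e) (mod-+* 0 l)
    X′ = proj₁ (stretch t X X≋0)
    Y′ = proj₁ (stretch t Y Y≋0)
    X∼X′ = proj₂ (proj₂ (stretch t X X≋0))
    Y∼Y′ = proj₂ (proj₂ (stretch t Y Y≋0))
    X′≋0 : length X′ ≋ 0 [mod d ]
    X′≋0 = divisible {X′} (proj₁ (proj₂ (stretch t X X≋0)))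
    Y′≋0 : length Y′ ≋ 0 [mod d ]
    Y′≋0 = divisible {Y′} (proj₁ (proj₂ (stretch t Y Y≋0)))
    Z Z′ : Word n
    Z  = X ++ Y
    Z′ = X′ ++ Y′
    Z′≋0 : length Z′ ≋ 0 [mod d ]
    Z′≋0 = ++-length X′ Y′ X′≋0 Y′≋0
    Copy : Word n → Set
    Copy U = ∀ i → i < length U → ∃[ j ] j < length Z′ × U !! i ≡ Z′ !! j × i ≋ j [mod d ]
    copied-X : Copy X′
    copied-X i i< = i , ≤-trans i< (≤-trans (m≤m+n (length X′) (length Y′)) (≤-reflexive (sym (length-++ X′)))) ,
      sym (!!-++ˡ X′ i<) , mod-reflexive refl
    copied-Y : Copy Y′
    copied-Y i i< = length X′ + i , ≤-trans (+-monoʳ-< (length X′) i<) (≤-reflexive (sym (length-++ X′))) ,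
      sym (!!-++ʳ X′ i) ,
      mod-sym (mod-+ X′≋0 (mod-reflexive {p = i} refl))
    ω = proj₁ (exponent Z)
    e = idempotent Z
    -- A multiple of ω, so that the K-th power of Z has the value of e, and larger than the number
    -- of rounds played.
    K = ω + ω * suc (rank φ)
    rank<K : rank φ < K
    rank<K = ≤-trans (≤-reflexive (sym (*-identityˡ (suc (rank φ)))))
      (≤-trans (*-monoˡ-≤ (suc (rank φ)) (proj₁ (proj₂ (exponent Z)))) (m≤n+m _ ω))
    e≡Zᴷ : κ e ≡ κ (power K Z)
    e≡Zᴷ = proj₂ (proj₂ (exponent Z)) (suc (rank φ))
    Z∼Z′ : Z ∼ᴹ Z′
    Z∼Z′ = ∼-++ M {X} {X′} {Y} {Y′} X∼X′ Y∼Y′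
    e≃Z′ᴷ : e ≃ power K Z′
    e≃Z′ᴷ = ≃-trans {e} {power K Z} {power K Z′} (κ⇒≃ e≡Zᴷ) (∼⇒≃ {power K Z} {power K Z′} (∼-power K {Z} {Z′} Z∼Z′))
    e≋0 : length e ≋ 0 [mod s ]
    e≋0 = power-length ω Z (++-length X Y X≋0 Y≋0)
    -- Between two high powers of Z′, the formula cannot tell U′ from the empty word; this is
    -- carried back to U between two copies of e, and e e has the value of e.
    omit : ∀ U → length U ≋ 0 [mod s ] → ∀ U′ → U ∼ᴹ U′ → length U′ ≋ 0 [mod d ] → Copy U′ → κ (e ++ U ++ e) ≡ κ e
    omit U U≋0 U′ U∼U′ U′≋0 copied = trans (≃⇒κ without (mod-trans (++-length e (U ++ e) e≋0 (++-length U e U≋0 e≋0))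
      (mod-sym (++-length e e e≋0 e≋0)))) (idempotent-≡ Z)
      where
      P : Word n
      P = power K Z′
      reassociate : ∀ x u y → x ++ (P ++ u ++ P) ++ y ≡ x ++ P ++ u ++ P ++ y
      reassociate x u y = cong (x ++_) (trans (++-assoc P (u ++ P) y) (cong (P ++_) (++-assoc u P y)))
      pumped : ∀ x y → Dec (length Z′ ≡ 0) → L M (x ++ P ++ U′ ++ P ++ y) ⇔ L M (x ++ P ++ [] ++ P ++ y)
      -- The game takes place around a nonempty Z′. If Z′ is empty, there is nothing to copy from
      -- and U′ is empty as well.
      pumped x y (yes Z′≡0) = ⇔-reflexive (cong (λ u → L M (x ++ P ++ u ++ P ++ y)) (empty U′ copied))
        where
        empty : ∀ u → Copy u → u ≡ []
        empty []      _      = refl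
        empty (a ∷ u) copied = let j , j<0 , _ = copied 0 (s≤s z≤n) in contradiction (subst (j <_) Z′≡0 j<0) λ ()
      pumped x y (no  Z′≢0) = L⇔φ (x ++ P ++ U′ ++ P ++ y) ⟨⇔⟩
        Pumped.pumping K x y Z′ {{≢-nonZero Z′≢0}} Z′≋0 U′ [] U′≋0 (mod-reflexive refl) copied
          (λ _ ()) φ moduli rank<K
        ⟨⇔⟩ ⇔-sym (L⇔φ (x ++ P ++ [] ++ P ++ y))
      to-P : ∀ u u′ → u ∼ᴹ u′ → e ++ u ++ e ≃ P ++ u′ ++ P
      to-P u u′ u∼u′ = ≃-++ {e} {P} {u ++ e} {u′ ++ P} e≃Z′ᴷ (≃-++ {u} {u′} {e} {P} (∼⇒≃ {u} {u′} u∼u′) e≃Z′ᴷ)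
      without : e ++ U ++ e ≃ e ++ e
      without x y = to-P U U′ U∼U′ x y ⟨⇔⟩ ⇔-reflexive (cong (L M) (reassociate x U′ y)) ⟨⇔⟩ pumped x y
        (length Z′ ≟ 0) ⟨⇔⟩
        ⇔-reflexive (cong (L M) (sym (reassociate x [] y))) ⟨⇔⟩ ⇔-sym (to-P [] [] (λ _ → refl) x y)

  FO²[<,MOD]? : Dec (L M BelongsTo FO² [<,MOD])
  FO²[<,MOD]? = Dec.map′ condition⇒FO² (λ belongs i j e e′ → FO²⇒identities belongs (lookup (shorter n N) i)
    (lookup (shorter n N) j) (residue e) (residue e′)) condition?

mainTheorem6 : ((k : ℕ) → 1 ≤ k → Decidable (BΣ k [<,+1]) → Decidable (BΣ k Reg))
    × ((k : ℕ) → 1 ≤ k → Decidable (FO²[ k ] [<,+1]) → Decidable (FO²[ k ] Reg))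
    × (((k : ℕ) → 1 ≤ k → Decidable (FO²[ k ] [<,+1])) →
    Decidable (BΣ 2 [<]) →
    ((k : ℕ) → 1 ≤ k → Decidable (BΣ k [<]) → Decidable (BΣ k [<,+1])) →
    Decidable (FO² [<,MOD])
    × ((k : ℕ) → 1 ≤ k → Decidable (FO²[ k ] Reg))
    × Decidable (BΣ 2 Reg))
mainTheorem6 = BΣ-Reg , (λ k _ → FO²-Reg k) , λ FO²ₖ BΣ₂ straubing →
  Syntactic.FO²[<,MOD]? , (λ k 1≤k → FO²-Reg k (FO²ₖ k 1≤k)) , BΣ-Reg 2 (s≤s z≤n) (straubing 2 (s≤s z≤n) BΣ₂)
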